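{- Let $\mathcal P$ be the set of all primes and let $\mathcal P_2=\mathcal P\cup\{p_1p_2:\, p_1,p_2\in\mathcal P\}$ (the set of positive integers that are either a prime or a product of two, not necessarily distinct, primes). Then the sumset $$2^{\mathcal P}+\mathcal P_2=\{2^{p}+q:\, p\in\mathcal P,\ q\in\mathcal P_2\}$$ has positive lower density; that is, there exists a constant $c>0$ such that $|\{1\le n\le x:\, n\in 2^{\mathcal P}+\mathcal P_2\}|>cx$ for all sufficiently large $x$.
   Context: For a set $A$ of positive integers, its lower (asymptotic) density is $\liminf_{x\to\infty} A(x)/x$, where $A(x)=|\{1\le a\le x:\, a\in A\}|$. -}

module Defs where

open import Data.Nat using (ℕ; zero; suc; _+_; _*_; _^_; _≤_; _<_; s≤s; z≤n; >-nonZero)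
open import Data.Nat.Properties
open import Data.Nat.Primality using (Prime; prime?)
open import Data.Product using (Σ; ∃; ∃-syntax; _×_; _,_)
open import Data.Sum using (_⊎_; inj₁; inj₂)
open import Relation.Nullary using (Dec; yes; no; ¬_)
open import Relation.Nullary.Decidable using (map′; _×-dec_; _⊎-dec_)
open import Relation.Binary.PropositionalEquality using (_≡_; refl; sym; subst)

P₂ : ℕ → Set
P₂ q = Prime q ⊎ (∃[ p₁ ] ∃[ p₂ ] (Prime p₁ × Prime p₂ × q ≡ p₁ * p₂))

InSumset : ℕ → Set
InSumset n = ∃[ p ] ∃[ q ] (Prime p × P₂ q × n ≡ 2 ^ p + q)

private
  nz : ∀ {p} → Prime p → 1 ≤ p
  nz {zero} ()
  nz {suc p} _ = s≤s z≤n

  p<2^p : ∀ p → p < 2 ^ p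
  p<2^p zero = s≤s z≤n
  p<2^p (suc p) = ≤-trans (s≤s (p<2^p p))
    (subst (_≤ 2 ^ p + (2 ^ p + 0)) (+-comm (2 ^ p) 1)
      (+-monoʳ-≤ (2 ^ p) (≤-trans (m^n>0 2 p) (m≤m+n (2 ^ p) 0))))

  prod? : ∀ q → Dec (∃[ p₁ ] ∃[ p₂ ] (Prime p₁ × Prime p₂ × q ≡ p₁ * p₂))
  prod? q = map′ to from
    (anyUpTo? (λ a → anyUpTo? (λ b → prime? a ×-dec prime? b ×-dec q ≟ a * b) (suc q)) (suc q))
    where
    to : _ → _
    to (a , _ , b , _ , pa , pb , e) = a , b , pa , pb , e
    from : _ → _
    from (a , b , pa , pb , e) =
      a , s≤s (subst (a ≤_) (sym e) (m≤m*n a b {{>-nonZero (nz pb)}})) ,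
      b , s≤s (subst (b ≤_) (sym e) (m≤n*m b a {{>-nonZero (nz pa)}})) , pa , pb , e

P₂? : ∀ q → Dec (P₂ q)
P₂? q = prime? q ⊎-dec prod? q

InSumset? : ∀ n → Dec (InSumset n)
InSumset? n = map′ to from
  (anyUpTo? (λ p → anyUpTo? (λ q → prime? p ×-dec P₂? q ×-dec n ≟ 2 ^ p + q) (suc n)) (suc n))
  where
  to : _ → _
  to (p , _ , q , _ , pp , pq , e) = p , q , pp , pq , e
  from : _ → _
  from (p , q , pp , pq , e) =
    p , s≤s (subst (p ≤_) (sym e) (≤-trans (<⇒≤ (p<2^p p)) (m≤m+n (2 ^ p) q))) ,
    q , s≤s (subst (q ≤_) (sym e) (m≤n+m q (2 ^ p))) , pp , pq , e

count : ℕ → ℕ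
count zero = 0
count (suc x) with InSumset? (suc x)
... | yes _ = suc (count x)
... | no _ = count x

{-# OPTIONS --safe #-}
-- Let r(n) count the representations n = 2^p + q s with p, q, s prime, p < M ≍ log x,
-- q > (log x)³ below a small power of x, and s > q.  It suffices that Σ r(n) ≫ x and
-- Σ r(n)² ≤ Σ r(n) + O(x) over n ≤ x.
-- The first estimate follows from Chebyshev: the primes p have density 1/log log x, which is
-- compensated by Σ 1/q ≍ log log x.  For the second, fix p' < p and k = p - p'.  The terms with
-- equal q have q | 2^k - 1 and are negligible because q is large.  For q ≠ q' the solutions of
-- q' s' - q s = 2^p - 2^p' lie on a line, and an upper bound sieve of dimension two bounds their
-- number by the expected one times the square of Π_{r | 2^k - 1} r/(r-1).  The same sieve bounds
-- the number of pairs of primes with difference k, at the cost of Π_{r | k} r/(r-1) squared.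
-- As in Romanoff's theorem these factors are bounded on average over k, because a prime r divides
-- k (2^k - 1) for few k unless r belongs to the sparse set of divisors of Π_{k ≤ E} k (2^k - 1).
module Submission where

open import Defs
open import Data.Nat as ℕ using (ℕ; zero; suc; _+_; _*_; _^_; _∸_; _≤_; _<_; _≥_; z≤n; s≤s; NonZero)
import Data.Nat.Properties as ℕₚ
open import Data.Integer.Base as ℤ using (ℤ)
import Data.Integer.Properties as ℤₚ
open import Data.Rational.Base as ℚ using (ℚ; mkℚ)
import Data.Rational.Properties as ℚₚ
import Data.Rational.Unnormalised.Base as ℚᵘ
import Data.Rational.Unnormalised.Properties as ℚᵘₚ
open import Data.Nat.Coprimality using (Coprime; 1-coprimeTo; coprime-Bézout) renaming (sym to coprime-sym)
open import Data.Product using (∃; ∃-syntax; _×_; _,_; proj₁; proj₂)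
open import Data.Sum using (_⊎_; inj₁; inj₂)
open import Data.Empty using (⊥; ⊥-elim)
open import Data.Maybe.Base using (just; nothing)
open import Function.Base using (case_of_)
open import Relation.Nullary using (Dec; yes; no; ¬_)
open import Relation.Binary.PropositionalEquality
open import Relation.Binary.Bundles using (Preorder)
open import Relation.Binary.Definitions using (WeaklyDecidable)
open import Algebra.Bundles using (CommutativeRing)
open import Algebra.Structures using (IsCommutativeRing)
open import Algebra.Solver.Ring.AlmostCommutativeRing
  using (fromCommutativeRing; _-Raw-AlmostCommutative⟶_; Induced-equivalence)
import Algebra.Solver.Ring as RingSolver
open import Data.Nat.Primality using (composite?; ¬composite⇒prime; Prime; prime?; euclidsLemma; prime⇒nonZero; prime⇒nonTrivial; prime⇒irreducible; prime[2]; ¬prime[0]; ¬prime[1])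
open import Data.Nat.Divisibility
open import Data.Nat.DivMod using (_/_; _%_; m≡m%n+[m/n]*n; m%n<n; m/n*n≤m; m*n/n≡m; /-monoˡ-≤; m/n<m; m/n≤m)
open import Relation.Nullary.Decidable using (_×-dec_; _⊎-dec_; _→-dec_; ¬?; from-yes)
open import Data.Nat.Base using (_!)
open import Data.Nat.Tactic.RingSolver using (solve-∀)
open import Data.Nat.Induction using (<-rec)
open import Data.Nat.GCD using (module Bézout)

-- All parameters are powers of two, so that logarithms are exponents and rational arithmetic
-- suffices. For x of order 2^N put J = 2^ℓ, B = 2^(18ℓ) and M = 32 B, where M ≤ N ≤ 2^18 M; thus ℓ
-- has the order of log log x. The primes q run over 2^J ≤ q < 2^B. The number 18 comes from the
-- sieve, which sifts by primes up to z at the cost of an error z^18: differences of exponents are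
-- sifted up to 2^ℓ over a range M ≥ 2^(18ℓ), and cofactors up to 2^B over a range of at least 2^(N
-- - 2B) ≥ 2^(18B). The exponents being prime costs a factor ℓ in the first moment and ℓ² in the
-- second. The sum of 1/q over the chosen range has order log (B/J), hence ℓ, and makes up for both.
-- The terms with q = q' are summed trivially: they cost M³, which 2^J exceeds. Each sieve squares
-- its local factor, so what has to be averaged over k is the fourth power of the local factor of k
-- (2^k - 1). This average must be bounded uniformly in the sifting limit, because the limit 2^B is
-- exponential in M.

infixl 6 _⊕_ _⊖_
infixl 7 _⊗_
infix 4 _≼_

-- Opaque, so that conversion checking never unfolds rational arithmetic.
opaque
  Q : Set
  Q = ℚ

  _⊕_ _⊗_ : Q → Q → Q
  _⊕_ = ℚ._+_
  _⊗_ = ℚ._*_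

  ⊝_ : Q → Q
  ⊝_ = ℚ.-_

  _≼_ : Q → Q → Set
  _≼_ = ℚ._≤_

  abs : Q → Q
  abs = ℚ.∣_∣

  fromℤ : ℤ → Q
  fromℤ i = mkℚ i 0 (coprime-sym (1-coprimeTo _))

  inv : ℕ → Q
  -- A convention that keeps `inv` total and non-negative. It is met for instance at `p ∸ 1` with p
  -- = 1, where an indicator of primality annihilates the term.
  inv zero = ℚ.0ℚ
  inv (suc n) = mkℚ (ℤ.+ 1) n (1-coprimeTo _)

ι : ℕ → Q
ι n = fromℤ (ℤ.+ n)

_⊖_ : Q → Q → Q
x ⊖ y = x ⊕ (⊝ y)

opaque
  unfolding Q

  Q-isCommutativeRing : IsCommutativeRing _≡_ _⊕_ _⊗_ ⊝_ (ι 0) (ι 1)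
  Q-isCommutativeRing = CommutativeRing.isCommutativeRing ℚₚ.+-*-commutativeRing

Q-ring : CommutativeRing _ _
Q-ring = record { isCommutativeRing = Q-isCommutativeRing }

opaque
  unfolding Q

  fromℤ-+ : ∀ i j → fromℤ (i ℤ.+ j) ≡ fromℤ i ⊕ fromℤ j
  fromℤ-+ i j = ℚₚ.toℚᵘ-injective (ℚᵘₚ.≃-trans
    (ℚᵘ.*≡* (cong (ℤ._* ℤ.+ 1) (cong₂ ℤ._+_ (sym (ℤₚ.*-identityʳ i)) (sym (ℤₚ.*-identityʳ j)))))
    (ℚᵘₚ.≃-sym (ℚₚ.toℚᵘ-homo-+ (fromℤ i) (fromℤ j))))

  fromℤ-* : ∀ i j → fromℤ (i ℤ.* j) ≡ fromℤ i ⊗ fromℤ j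
  fromℤ-* i j = ℚₚ.toℚᵘ-injective (ℚᵘₚ.≃-sym (ℚₚ.toℚᵘ-homo-* (fromℤ i) (fromℤ j)))

  fromℤ-neg : ∀ i → fromℤ (ℤ.- i) ≡ ⊝ fromℤ i
  fromℤ-neg i = ℚₚ.toℚᵘ-injective (ℚᵘₚ.≃-sym (ℚₚ.toℚᵘ-homo‿- (fromℤ i)))

  ⊕-assoc : ∀ x y z → (x ⊕ y) ⊕ z ≡ x ⊕ (y ⊕ z)
  ⊕-assoc = ℚₚ.+-assoc
  ⊕-comm : ∀ x y → x ⊕ y ≡ y ⊕ x
  ⊕-comm = ℚₚ.+-comm
  ⊗-assoc : ∀ x y z → (x ⊗ y) ⊗ z ≡ x ⊗ (y ⊗ z)
  ⊗-assoc = ℚₚ.*-assoc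
  ⊗-comm : ∀ x y → x ⊗ y ≡ y ⊗ x
  ⊗-comm = ℚₚ.*-comm
  ⊕-idˡ : ∀ x → ι 0 ⊕ x ≡ x
  ⊕-idˡ = ℚₚ.+-identityˡ
  ⊕-idʳ : ∀ x → x ⊕ ι 0 ≡ x
  ⊕-idʳ = ℚₚ.+-identityʳ
  ⊗-idˡ : ∀ x → ι 1 ⊗ x ≡ x
  ⊗-idˡ = ℚₚ.*-identityˡ
  ⊗-idʳ : ∀ x → x ⊗ ι 1 ≡ x
  ⊗-idʳ = ℚₚ.*-identityʳ
  ⊗-zeroˡ : ∀ x → ι 0 ⊗ x ≡ ι 0
  ⊗-zeroˡ = ℚₚ.*-zeroˡ
  ⊗-zeroʳ : ∀ x → x ⊗ ι 0 ≡ ι 0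
  ⊗-zeroʳ = ℚₚ.*-zeroʳ
  ⊗-distribˡ : ∀ x y z → x ⊗ (y ⊕ z) ≡ x ⊗ y ⊕ x ⊗ z
  ⊗-distribˡ = ℚₚ.*-distribˡ-+
  ⊝-invʳ : ∀ x → x ⊕ (⊝ x) ≡ ι 0
  ⊝-invʳ = ℚₚ.+-inverseʳ

  ≼-refl : ∀ {x} → x ≼ x
  ≼-refl = ℚₚ.≤-refl
  ≼-reflexive : ∀ {x y} → x ≡ y → x ≼ y
  ≼-reflexive = ℚₚ.≤-reflexive
  ≼-trans : ∀ {x y z} → x ≼ y → y ≼ z → x ≼ z
  ≼-trans = ℚₚ.≤-trans
  ≼-antisym : ∀ {x y} → x ≼ y → y ≼ x → x ≡ y
  ≼-antisym = ℚₚ.≤-antisym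
  ≼-total : ∀ x y → x ≼ y ⊎ y ≼ x
  ≼-total = ℚₚ.≤-total
  ⊕-mono : ∀ {a b c d} → a ≼ b → c ≼ d → a ⊕ c ≼ b ⊕ d
  ⊕-mono = ℚₚ.+-mono-≤
  ⊗-monoˡ : ∀ {a b c} → ι 0 ≼ c → a ≼ b → c ⊗ a ≼ c ⊗ b
  ⊗-monoˡ {c = c} 0≤c = ℚₚ.*-monoˡ-≤-nonNeg c {{ℚ.nonNegative 0≤c}}

  ι-mono : ∀ {m n} → m ≤ n → ι m ≼ ι n
  ι-mono m≤n = ℚ.*≤* (subst₂ ℤ._≤_ (sym (ℤₚ.*-identityʳ _)) (sym (ℤₚ.*-identityʳ _)) (ℤ.+≤+ m≤n))
  ι-reflect : ∀ {m n} → ι m ≼ ι n → m ≤ n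
  ι-reflect (ℚ.*≤* le) = ℤₚ.drop‿+≤+ (subst₂ ℤ._≤_ (ℤₚ.*-identityʳ _) (ℤₚ.*-identityʳ _) le)

  abs-⊕ : ∀ x y → abs (x ⊕ y) ≼ abs x ⊕ abs y
  abs-⊕ = ℚₚ.∣p+q∣≤∣p∣+∣q∣
  abs-⊗ : ∀ x y → abs (x ⊗ y) ≡ abs x ⊗ abs y
  abs-⊗ = ℚₚ.∣p*q∣≡∣p∣*∣q∣
  abs-nonneg : ∀ x → ι 0 ≼ abs x
  abs-nonneg x = ℚₚ.0≤∣p∣ x
  abs-of-nonneg : ∀ {x} → ι 0 ≼ x → abs x ≡ x
  abs-of-nonneg = ℚₚ.0≤p⇒∣p∣≡p
  abs-neg : ∀ x → abs (⊝ x) ≡ abs x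
  abs-neg = ℚₚ.∣-p∣≡∣p∣

  inv-suc : ∀ n → ι (suc n) ⊗ inv (suc n) ≡ ι 1
  inv-suc n = ℚₚ.toℚᵘ-injective (ℚᵘₚ.≃-trans (ℚₚ.toℚᵘ-homo-* (ι (suc n)) (inv (suc n)))
    (ℚᵘ.*≡* (trans (ℤₚ.*-identityʳ _) (trans (ℤₚ.*-identityʳ _) (cong ℤ.+_ (sym (trans (ℕₚ.+-identityʳ (suc (n + 0))) (cong suc (ℕₚ.+-identityʳ n)))))))))
  inv-nonneg : ∀ n → ι 0 ≼ inv n
  inv-nonneg zero = ℚₚ.≤-refl
  inv-nonneg (suc n) = ℚ.*≤* (ℤ.+≤+ z≤n)

-- With integer coefficients the solver computes with numerals although `Q` is opaque: it sees
-- `fromℤ` only through the homomorphism laws.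
ℤ-morphism : CommutativeRing.rawRing ℤₚ.+-*-commutativeRing -Raw-AlmostCommutative⟶ fromCommutativeRing Q-ring
ℤ-morphism = record
  { ⟦_⟧ = fromℤ ; +-homo = fromℤ-+ ; *-homo = fromℤ-* ; -‿homo = fromℤ-neg ; 0-homo = refl ; 1-homo = refl }

ℤ-coeff≟ : WeaklyDecidable (Induced-equivalence ℤ-morphism)
ℤ-coeff≟ i j with i ℤₚ.≟ j
... | yes p = just (cong fromℤ p)
... | no _ = nothing

module QS = RingSolver (CommutativeRing.rawRing ℤₚ.+-*-commutativeRing) (fromCommutativeRing Q-ring) ℤ-morphism ℤ-coeff≟
open QS using (solve; _:=_; _:+_; _:*_; _:-_; :-_; con; Polynomial)

# : ∀ {n} → ℕ → Polynomial n
# n = con (ℤ.+ n)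

-- Inequalities between rationals

Q-preorder : Preorder _ _ _
Q-preorder = record { Carrier = Q ; _≈_ = _≡_ ; _≲_ = _≼_
  ; isPreorder = record { isEquivalence = isEquivalence ; reflexive = ≼-reflexive ; trans = ≼-trans } }

module ≼-Reasoning where
  open import Relation.Binary.Reasoning.Preorder Q-preorder public
    using (begin_; step-≲; step-≡-⟩; step-≡-∣; step-≡-⟨; _∎)

-- Most inequalities below are certified in this form: a non-negative difference is exhibited and
-- the ring solver checks the identity.
≼-by : ∀ {x y} d → ι 0 ≼ d → x ⊕ d ≡ y → x ≼ y
≼-by {x} d 0≼d e = ≼-trans (≼-reflexive (sym (⊕-idʳ x))) (≼-trans (⊕-mono ≼-refl 0≼d) (≼-reflexive e))

⊖-nonneg : ∀ {x y} → x ≼ y → ι 0 ≼ y ⊖ x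
⊖-nonneg {x} {y} x≼y = ≼-trans (≼-reflexive (sym (⊝-invʳ x))) (⊕-mono x≼y ≼-refl)

⊕-nonneg : ∀ {x y} → ι 0 ≼ x → ι 0 ≼ y → ι 0 ≼ x ⊕ y
⊕-nonneg p q = ≼-trans (≼-reflexive (sym (⊕-idˡ (ι 0)))) (⊕-mono p q)

⊗-nonneg : ∀ {x y} → ι 0 ≼ x → ι 0 ≼ y → ι 0 ≼ x ⊗ y
⊗-nonneg {x} p q = ≼-trans (≼-reflexive (sym (⊗-zeroʳ x))) (⊗-monoˡ p q)

⊗-monoʳ : ∀ {a b c} → ι 0 ≼ c → a ≼ b → a ⊗ c ≼ b ⊗ c
⊗-monoʳ {a} {b} {c} p q = subst₂ _≼_ (⊗-comm c a) (⊗-comm c b) (⊗-monoˡ p q)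

⊗-mono : ∀ {a b c d} → ι 0 ≼ a → ι 0 ≼ c → a ≼ b → c ≼ d → a ⊗ c ≼ b ⊗ d
⊗-mono 0≼a 0≼c a≼b c≼d = ≼-trans (⊗-monoʳ 0≼c a≼b) (⊗-monoˡ (≼-trans 0≼a a≼b) c≼d)

ι-nonneg : ∀ n → ι 0 ≼ ι n
ι-nonneg n = ι-mono z≤n

sq-nonneg : ∀ x → ι 0 ≼ x ⊗ x
sq-nonneg x with ≼-total (ι 0) x
... | inj₁ p = ⊗-nonneg p p
... | inj₂ p = ≼-trans (⊗-nonneg q q) (≼-reflexive (solve 1 (λ x → (:- x) :* (:- x) := x :* x) refl x))
  where
  q : ι 0 ≼ ⊝ x
  q = ≼-trans (⊖-nonneg p) (≼-reflexive (⊕-idˡ (⊝ x)))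

-- In the case b ≼ a the difference b - a is the sum of the non-negative terms cb - ca and (c - 1)(a
-- - b), so no division is involved.
⊗-cancel : ∀ {a b c} → ι 1 ≼ c → c ⊗ a ≼ c ⊗ b → a ≼ b
⊗-cancel {a} {b} {c} 1≼c ca≼cb with ≼-total a b
... | inj₁ p = p
... | inj₂ p = ≼-by ((c ⊗ b ⊖ c ⊗ a) ⊕ (c ⊖ ι 1) ⊗ (a ⊖ b))
    (⊕-nonneg (⊖-nonneg ca≼cb) (⊗-nonneg (⊖-nonneg 1≼c) (⊖-nonneg p)))
    (solve 3 (λ a b c → a :+ ((c :* b :- c :* a) :+ (c :- # 1) :* (a :- b)) := b) refl a b c)

ι-+ : ∀ m n → ι (m + n) ≡ ι m ⊕ ι n
ι-+ m n = fromℤ-+ (ℤ.+ m) (ℤ.+ n)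

ι-* : ∀ m n → ι (m * n) ≡ ι m ⊗ ι n
ι-* m n = trans (cong fromℤ (ℤₚ.pos-* m n)) (fromℤ-* (ℤ.+ m) (ℤ.+ n))

ι-suc : ∀ n → ι (suc n) ≡ ι 1 ⊕ ι n
ι-suc = ι-+ 1

ι⊗inv : ∀ {n} → 1 ≤ n → ι n ⊗ inv n ≡ ι 1
ι⊗inv {suc n} _ = inv-suc n

⊗-cancel-ι : ∀ {n a b} → 1 ≤ n → ι n ⊗ a ≼ ι n ⊗ b → a ≼ b
⊗-cancel-ι 1≤n = ⊗-cancel (ι-mono 1≤n)

inv-anti : ∀ {m n} → 1 ≤ m → m ≤ n → inv n ≼ inv m
inv-anti {m} {n} 1≤m m≤n = begin
  inv n  ≡⟨ ⊗-idʳ (inv n) ⟨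
  inv n ⊗ ι 1  ≡⟨ cong (inv n ⊗_) (ι⊗inv 1≤m) ⟨
  inv n ⊗ (ι m ⊗ inv m)  ≲⟨ ⊗-monoˡ (inv-nonneg n) (⊗-monoʳ (inv-nonneg m) (ι-mono m≤n)) ⟩
  inv n ⊗ (ι n ⊗ inv m)  ≡⟨ solve 3 (λ a b c → a :* (b :* c) := (b :* a) :* c) refl (inv n) (ι n) (inv m) ⟩
  (ι n ⊗ inv n) ⊗ inv m  ≡⟨ cong (_⊗ inv m) (ι⊗inv (ℕₚ.≤-trans 1≤m m≤n)) ⟩
  ι 1 ⊗ inv m  ≡⟨ ⊗-idˡ (inv m) ⟩
  inv m  ∎
  where open ≼-Reasoning

inv-1 : inv 1 ≡ ι 1
inv-1 = trans (sym (⊗-idˡ (inv 1))) (inv-suc 0)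

inv≼1 : ∀ {n} → 1 ≤ n → inv n ≼ ι 1
inv≼1 1≤n = ≼-trans (inv-anti (s≤s z≤n) 1≤n) (≼-reflexive inv-1)

inv-* : ∀ {m n} → 1 ≤ m → 1 ≤ n → inv (m * n) ≡ inv m ⊗ inv n
inv-* {m} {n} 1≤m 1≤n = begin
  inv (m * n)  ≡⟨ ⊗-idʳ _ ⟨
  inv (m * n) ⊗ ι 1  ≡⟨ cong (inv (m * n) ⊗_) (trans (cong₂ _⊗_ (ι⊗inv 1≤m) (ι⊗inv 1≤n)) (⊗-idˡ _)) ⟨
  inv (m * n) ⊗ ((ι m ⊗ inv m) ⊗ (ι n ⊗ inv n))  ≡⟨ solve 5 (λ a b c d e → a :* ((b :* c) :* (d :* e)) := (b :* d) :* a :* (c :* e)) refl _ _ _ _ _ ⟩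
  (ι m ⊗ ι n) ⊗ inv (m * n) ⊗ (inv m ⊗ inv n)  ≡⟨ cong (λ x → x ⊗ inv (m * n) ⊗ (inv m ⊗ inv n)) (ι-* m n) ⟨
  ι (m * n) ⊗ inv (m * n) ⊗ (inv m ⊗ inv n)  ≡⟨ cong (_⊗ (inv m ⊗ inv n)) (ι⊗inv (ℕₚ.*-mono-≤ 1≤m 1≤n)) ⟩
  ι 1 ⊗ (inv m ⊗ inv n)  ≡⟨ ⊗-idˡ _ ⟩
  inv m ⊗ inv n  ∎
  where open ≡-Reasoning

≼⇒≼inv⊗ : ∀ {n x y} → 1 ≤ n → ι n ⊗ x ≼ y → x ≼ inv n ⊗ y
≼⇒≼inv⊗ {n} {x} {y} 1≤n p = ⊗-cancel-ι 1≤n (≼-trans p (≼-reflexive (begin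
  y  ≡⟨ ⊗-idˡ y ⟨
  ι 1 ⊗ y  ≡⟨ cong (_⊗ y) (ι⊗inv 1≤n) ⟨
  ι n ⊗ inv n ⊗ y  ≡⟨ ⊗-assoc _ _ _ ⟩
  ι n ⊗ (inv n ⊗ y)  ∎)))
  where open ≡-Reasoning

abs≼ : ∀ {x b} → x ≼ b → ⊝ x ≼ b → abs x ≼ b
abs≼ {x} p q with ≼-total (ι 0) x
... | inj₁ r = ≼-trans (≼-reflexive (abs-of-nonneg r)) p
... | inj₂ r = ≼-trans (≼-reflexive (trans (sym (abs-neg x)) (abs-of-nonneg (≼-trans (⊖-nonneg r) (≼-reflexive (⊕-idˡ (⊝ x))))))) q

≼abs : ∀ x → x ≼ abs x
≼abs x with ≼-total (ι 0) x
... | inj₁ r = ≼-reflexive (sym (abs-of-nonneg r))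
... | inj₂ r = ≼-trans r (abs-nonneg x)

-- Indicators and finite sums

ind : ∀ {p} {P : Set p} → Dec P → Q
ind (yes _) = ι 1
ind (no _) = ι 0

ind-nonneg : ∀ {p} {P : Set p} (d : Dec P) → ι 0 ≼ ind d
ind-nonneg (yes _) = ι-nonneg 1
ind-nonneg (no _) = ≼-refl

ind≼1 : ∀ {p} {P : Set p} (d : Dec P) → ind d ≼ ι 1
ind≼1 (yes _) = ≼-refl
ind≼1 (no _) = ι-nonneg 1

ind-yes : ∀ {p} {P : Set p} (d : Dec P) → P → ind d ≡ ι 1
ind-yes (yes _) _ = refl
ind-yes (no ¬p) p = ⊥-elim (¬p p)

ind-no : ∀ {p} {P : Set p} (d : Dec P) → ¬ P → ind d ≡ ι 0
ind-no (yes p) ¬p = ⊥-elim (¬p p)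
ind-no (no _) _ = refl

ind-mono : ∀ {p q} {P : Set p} {R : Set q} (d : Dec P) (e : Dec R) → (P → R) → ind d ≼ ind e
ind-mono (yes p) e f = ≼-reflexive (sym (ind-yes e (f p)))
ind-mono (no _) e f = ind-nonneg e

Σ< : ℕ → (ℕ → Q) → Q
Σ< zero f = ι 0
Σ< (suc n) f = Σ< n f ⊕ f n

Σ-cong : ∀ n {f g : ℕ → Q} → (∀ k → k < n → f k ≡ g k) → Σ< n f ≡ Σ< n g
Σ-cong zero h = refl
Σ-cong (suc n) h = cong₂ _⊕_ (Σ-cong n (λ k k<n → h k (ℕₚ.m≤n⇒m≤1+n k<n))) (h n ℕₚ.≤-refl)

Σ-mono : ∀ n {f g : ℕ → Q} → (∀ k → k < n → f k ≼ g k) → Σ< n f ≼ Σ< n g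
Σ-mono zero h = ≼-refl
Σ-mono (suc n) h = ⊕-mono (Σ-mono n (λ k k<n → h k (ℕₚ.m≤n⇒m≤1+n k<n))) (h n ℕₚ.≤-refl)

Σ-zero : ∀ n → Σ< n (λ _ → ι 0) ≡ ι 0
Σ-zero zero = refl
Σ-zero (suc n) = trans (⊕-idʳ _) (Σ-zero n)

Σ-nonneg : ∀ n {f : ℕ → Q} → (∀ k → k < n → ι 0 ≼ f k) → ι 0 ≼ Σ< n f
Σ-nonneg n h = ≼-trans (≼-reflexive (sym (Σ-zero n))) (Σ-mono n h)

Σ-⊕ : ∀ n (f g : ℕ → Q) → Σ< n (λ k → f k ⊕ g k) ≡ Σ< n f ⊕ Σ< n g
Σ-⊕ zero f g = sym (⊕-idˡ (ι 0))
Σ-⊕ (suc n) f g = trans (cong (_⊕ (f n ⊕ g n)) (Σ-⊕ n f g))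
  (solve 4 (λ a b c d → a :+ b :+ (c :+ d) := a :+ c :+ (b :+ d)) refl _ _ _ _)

Σ-⊗ˡ : ∀ n c (f : ℕ → Q) → Σ< n (λ k → c ⊗ f k) ≡ c ⊗ Σ< n f
Σ-⊗ˡ zero c f = sym (⊗-zeroʳ c)
Σ-⊗ˡ (suc n) c f = trans (cong (_⊕ c ⊗ f n) (Σ-⊗ˡ n c f)) (sym (⊗-distribˡ c _ _))

Σ-⊗ʳ : ∀ n c (f : ℕ → Q) → Σ< n (λ k → f k ⊗ c) ≡ Σ< n f ⊗ c
Σ-⊗ʳ n c f = trans (Σ-cong n (λ k _ → ⊗-comm (f k) c)) (trans (Σ-⊗ˡ n c f) (⊗-comm c _))

Σ-const : ∀ n c → Σ< n (λ _ → c) ≡ ι n ⊗ c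
Σ-const zero c = sym (⊗-zeroˡ c)
Σ-const (suc n) c = begin
  Σ< n (λ _ → c) ⊕ c  ≡⟨ cong (_⊕ c) (Σ-const n c) ⟩
  ι n ⊗ c ⊕ c  ≡⟨ solve 2 (λ n c → n :* c :+ c := (# 1 :+ n) :* c) refl (ι n) c ⟩
  (ι 1 ⊕ ι n) ⊗ c  ≡⟨ cong (_⊗ c) (ι-suc n) ⟨
  ι (suc n) ⊗ c  ∎
  where open ≡-Reasoning

Σ-swap : ∀ m n (f : ℕ → ℕ → Q) → Σ< m (λ i → Σ< n (f i)) ≡ Σ< n (λ j → Σ< m (λ i → f i j))
Σ-swap zero n f = sym (Σ-zero n)
Σ-swap (suc m) n f = trans (cong (_⊕ Σ< n (f m)) (Σ-swap m n f)) (sym (Σ-⊕ n _ (f m)))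

Σ-split : ∀ m n (f : ℕ → Q) → Σ< (m + n) f ≡ Σ< m f ⊕ Σ< n (λ k → f (m + k))
Σ-split m zero f = trans (cong (λ k → Σ< k f) (ℕₚ.+-identityʳ m)) (sym (⊕-idʳ _))
Σ-split m (suc n) f = begin
  Σ< (m + suc n) f  ≡⟨ cong (λ k → Σ< k f) (ℕₚ.+-suc m n) ⟩
  Σ< (m + n) f ⊕ f (m + n)  ≡⟨ cong (_⊕ f (m + n)) (Σ-split m n f) ⟩
  Σ< m f ⊕ Σ< n (λ k → f (m + k)) ⊕ f (m + n)  ≡⟨ ⊕-assoc _ _ _ ⟩
  Σ< m f ⊕ (Σ< n (λ k → f (m + k)) ⊕ f (m + n))  ∎
  where open ≡-Reasoning

Σ-extend : ∀ {m n} {f : ℕ → Q} → m ≤ n → (∀ k → ι 0 ≼ f k) → Σ< m f ≼ Σ< n f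
Σ-extend {m} {n} {f} m≤n 0≼f = ≼-by (Σ< (n ∸ m) (λ k → f (m + k))) (Σ-nonneg (n ∸ m) (λ k _ → 0≼f (m + k)))
  (trans (sym (Σ-split m (n ∸ m) f)) (cong (λ k → Σ< k f) (ℕₚ.m+[n∸m]≡n m≤n)))

Σ-single : ∀ n (f : ℕ → Q) i c → ι 0 ≼ c → (∀ k → k < n → (k ≡ i × f k ≼ c) ⊎ f k ≼ ι 0) → Σ< n f ≼ c
Σ-single zero f i c 0≼c h = 0≼c
Σ-single (suc n) f i c 0≼c h with h n ℕₚ.≤-refl
... | inj₂ p = ≼-trans (⊕-mono (Σ-single n f i c 0≼c (λ k k<n → h k (ℕₚ.m≤n⇒m≤1+n k<n))) p) (≼-reflexive (⊕-idʳ c))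
... | inj₁ (refl , p) = ≼-trans (⊕-mono small p) (≼-reflexive (⊕-idˡ c))
  where
  small : Σ< n f ≼ ι 0
  small = ≼-trans (Σ-mono n (λ k k<n → aux k k<n (h k (ℕₚ.m≤n⇒m≤1+n k<n)))) (≼-reflexive (Σ-zero n))
    where
    aux : ∀ k → k < n → (k ≡ n × f k ≼ c) ⊎ f k ≼ ι 0 → f k ≼ ι 0
    aux k k<n (inj₁ (e , _)) = ⊥-elim (ℕₚ.<⇒≢ k<n e)
    aux k k<n (inj₂ p) = p

-- Every k that contributes names some j with k = ρ j. Since ρ is a function, distinct k name
-- distinct j, and injectivity of the naming comes for free: bound f k by the sum of g j over the j
-- with ρ j = k and exchange the sums.
Σ-reindex : ∀ m n (f g : ℕ → Q) (ρ : ℕ → ℕ) → (∀ j → j < n → ι 0 ≼ g j) →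
  (∀ k → k < m → (∃[ j ] (j < n × k ≡ ρ j × f k ≼ g j)) ⊎ f k ≼ ι 0) → Σ< m f ≼ Σ< n g
Σ-reindex m n f g ρ 0≼g h = begin
  Σ< m f  ≲⟨ Σ-mono m step ⟩
  Σ< m (λ k → Σ< n (λ j → ind (k ℕ.≟ ρ j) ⊗ g j))  ≡⟨ Σ-swap m n _ ⟩
  Σ< n (λ j → Σ< m (λ k → ind (k ℕ.≟ ρ j) ⊗ g j))  ≲⟨ Σ-mono n (λ j j<n → Σ-single m _ (ρ j) (g j) (0≼g j j<n) (λ k _ → one k j)) ⟩
  Σ< n g  ∎
  where
  open ≼-Reasoning
  one : ∀ k j → (k ≡ ρ j × ind (k ℕ.≟ ρ j) ⊗ g j ≼ g j) ⊎ ind (k ℕ.≟ ρ j) ⊗ g j ≼ ι 0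
  one k j with k ℕ.≟ ρ j
  ... | yes e = inj₁ (e , ≼-reflexive (⊗-idˡ _))
  ... | no _ = inj₂ (≼-reflexive (⊗-zeroˡ _))
  nonneg : ∀ k j → j < n → ι 0 ≼ ind (k ℕ.≟ ρ j) ⊗ g j
  nonneg k j j<n = ⊗-nonneg (ind-nonneg (k ℕ.≟ ρ j)) (0≼g j j<n)
  at : ∀ k n j → j < n → (∀ i → i < n → ι 0 ≼ ind (k ℕ.≟ ρ i) ⊗ g i) → k ≡ ρ j → g j ≼ Σ< n (λ j → ind (k ℕ.≟ ρ j) ⊗ g j)
  at k (suc n) j j<1+n pos e with j ℕ.≟ n
  ... | yes refl = ≼-by (Σ< n _) (Σ-nonneg n (λ i i<n → pos i (ℕₚ.m≤n⇒m≤1+n i<n)))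
        (trans (⊕-comm _ _) (cong (Σ< n _ ⊕_) (trans (sym (⊗-idˡ _)) (cong (_⊗ g n) (sym (ind-yes (k ℕ.≟ ρ n) e))))))
  ... | no j≢n = ≼-trans (at k n j (ℕₚ.≤∧≢⇒< (ℕ.s≤s⁻¹ j<1+n) j≢n) (λ i i<n → pos i (ℕₚ.m≤n⇒m≤1+n i<n)) e)
        (≼-by _ (pos n ℕₚ.≤-refl) refl)
  step : ∀ k → k < m → f k ≼ Σ< n (λ j → ind (k ℕ.≟ ρ j) ⊗ g j)
  step k k<m with h k k<m
  ... | inj₁ (j , j<n , e , p) = ≼-trans p (at k n j j<n (λ i → nonneg k i) e)
  ... | inj₂ p = ≼-trans p (Σ-nonneg n (λ i → nonneg k i))

Σ-at : ∀ n (f : ℕ → Q) j → j < n → (∀ i → i < n → ι 0 ≼ f i) → f j ≼ Σ< n f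
Σ-at (suc n) f j j<1+n pos with j ℕ.≟ n
... | yes refl = ≼-by (Σ< n _) (Σ-nonneg n (λ i i<n → pos i (ℕₚ.m≤n⇒m≤1+n i<n))) (⊕-comm _ _)
... | no j≢n = ≼-trans (Σ-at n f j (ℕₚ.≤∧≢⇒< (ℕ.s≤s⁻¹ j<1+n) j≢n) (λ i i<n → pos i (ℕₚ.m≤n⇒m≤1+n i<n)))
      (≼-by _ (pos n ℕₚ.≤-refl) refl)

Σ-abs : ∀ n (f : ℕ → Q) → abs (Σ< n f) ≼ Σ< n (λ k → abs (f k))
Σ-abs zero f = ≼-reflexive (abs-of-nonneg ≼-refl)
Σ-abs (suc n) f = ≼-trans (abs-⊕ _ _) (⊕-mono (Σ-abs n f) ≼-refl)

-- Primes, powers of two and counting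

prime≥2 : ∀ {p} → Prime p → 2 ≤ p
prime≥2 {p} pp = ℕ.nonTrivial⇒n>1 p {{prime⇒nonTrivial pp}}

prime≥1 : ∀ {p} → Prime p → 1 ≤ p
prime≥1 pp = ℕₚ.<⇒≤ (prime≥2 pp)

prime∣prime : ∀ {p q} → Prime p → Prime q → p ∣ q → p ≡ q
prime∣prime pp pq p∣q with prime⇒irreducible pq p∣q
... | inj₁ refl = ⊥-elim (¬prime[1] pp)
... | inj₂ e = e

prime∤1 : ∀ {p} → Prime p → ¬ p ∣ 1
prime∤1 pp p∣1 = ¬prime[1] (subst Prime (∣1⇒≡1 p∣1) pp)

2^n≥1 : ∀ n → 1 ≤ 2 ^ n
2^n≥1 = ℕₚ.m^n>0 2

2^-cancel-≤ : ∀ {a b} → 2 ^ a ≤ 2 ^ b → a ≤ b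
2^-cancel-≤ {a} {b} h with a ℕ.≤? b
... | yes p = p
... | no ¬p = ⊥-elim (ℕₚ.<⇒≱ (ℕₚ.^-monoʳ-< 2 (s≤s (s≤s z≤n)) (ℕₚ.≰⇒> ¬p)) h)

∣⇒≤′ : ∀ {m n} → 1 ≤ n → m ∣ n → m ≤ n
∣⇒≤′ {n = suc n} _ d = ∣⇒≤ d

module _ {P : ℕ → Set} (P? : ∀ n → Dec (P n)) where
  cnt : ℕ → ℕ
  cnt zero = 0
  cnt (suc n) with P? n
  ... | yes _ = suc (cnt n)
  ... | no _ = cnt n

  ι-cnt : ∀ n → ι (cnt n) ≡ Σ< n (λ k → ind (P? k))
  ι-cnt zero = refl
  ι-cnt (suc n) with P? n
  ... | yes _ = trans (ι-suc (cnt n)) (trans (⊕-comm _ _) (cong (_⊕ ι 1) (ι-cnt n)))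
  ... | no _ = trans (ι-cnt n) (sym (⊕-idʳ _))

pc : ℕ → ℕ
pc = cnt prime?

-- Binomial coefficients

ch : ℕ → ℕ → ℕ
ch n zero = 1
ch zero (suc k) = 0
ch (suc n) (suc k) = ch n k + ch n (suc k)

ch-absorb : ∀ n k → suc k * ch (suc n) (suc k) ≡ suc n * ch n k
ch-absorb zero zero = refl
ch-absorb zero (suc k) = ℕₚ.*-zeroʳ (suc (suc k))
ch-absorb (suc n) zero = trans (eq (ch (suc n) 1)) (cong suc (ch-absorb n zero))
  where
  eq : ∀ c → 1 * (1 + c) ≡ suc (1 * c)
  eq = solve-∀
ch-absorb (suc n) (suc k) = begin
  suc (suc k) * (ch (suc n) (suc k) + ch (suc n) (suc (suc k)))
    ≡⟨ e₁ k (ch (suc n) (suc k)) (ch (suc n) (suc (suc k))) ⟩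
  ch (suc n) (suc k) + (suc k * ch (suc n) (suc k) + suc (suc k) * ch (suc n) (suc (suc k)))
    ≡⟨ cong (ch (suc n) (suc k) +_) (cong₂ _+_ (ch-absorb n k) (ch-absorb n (suc k))) ⟩
  ch (suc n) (suc k) + (suc n * ch n k + suc n * ch n (suc k))
    ≡⟨ e₂ n (ch n k) (ch n (suc k)) ⟩
  suc (suc n) * ch (suc n) (suc k) ∎
  where
  open ≡-Reasoning
  e₁ : ∀ k a b → suc (suc k) * (a + b) ≡ a + (suc k * a + suc (suc k) * b)
  e₁ = solve-∀
  e₂ : ∀ n a b → (a + b) + (suc n * a + suc n * b) ≡ suc (suc n) * (a + b)
  e₂ = solve-∀

ch-row : ∀ n k → suc k * ch n (suc k) + k * ch n k ≡ n * ch n k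
ch-row n k = ℕₚ.+-cancelˡ-≡ (ch n k) _ _ (trans (e k (ch n k) (ch n (suc k))) (ch-absorb n k))
  where
  e : ∀ k a b → a + (suc k * b + k * a) ≡ suc k * (a + b)
  e = solve-∀

ch-! : ∀ a b → ch (a + b) a * (a ! * b !) ≡ (a + b) !
ch-! zero b = e (b !)
  where
  e : ∀ x → 1 * (1 * x) ≡ x
  e = solve-∀
ch-! (suc a) b = begin
  ch (suc (a + b)) (suc a) * (suc a * a ! * b !)  ≡⟨ e (suc a) (ch (suc (a + b)) (suc a)) (a !) (b !) ⟩
  suc a * ch (suc (a + b)) (suc a) * (a ! * b !)  ≡⟨ cong (_* (a ! * b !)) (ch-absorb (a + b) a) ⟩
  suc (a + b) * ch (a + b) a * (a ! * b !)  ≡⟨ ℕₚ.*-assoc (suc (a + b)) (ch (a + b) a) (a ! * b !) ⟩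
  suc (a + b) * (ch (a + b) a * (a ! * b !))  ≡⟨ cong (suc (a + b) *_) (ch-! a b) ⟩
  suc (a + b) * (a + b) !  ∎
  where
  open ≡-Reasoning
  e : ∀ s c x y → c * (s * x * y) ≡ s * c * (x * y)
  e = solve-∀

ch≤2^ : ∀ n k → ch n k ≤ 2 ^ n
ch≤2^ n zero = 2^n≥1 n
ch≤2^ zero (suc k) = z≤n
ch≤2^ (suc n) (suc k) = ℕₚ.+-mono-≤ (ch≤2^ n k) (ℕₚ.≤-trans (ch≤2^ n (suc k)) (ℕₚ.m≤m+n _ 0))

2^≤Σch : ∀ m → ι (2 ^ m) ≼ Σ< (suc m) (λ k → ι (ch m k))
2^≤Σch zero = ≼-reflexive (sym (⊕-idˡ _))
2^≤Σch (suc m) = begin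
  ι (2 ^ suc m)  ≡⟨ trans (cong ι (cong (2 ^ m +_) (ℕₚ.+-identityʳ (2 ^ m)))) (ι-+ (2 ^ m) (2 ^ m)) ⟩
  ι (2 ^ m) ⊕ ι (2 ^ m)  ≲⟨ ⊕-mono (2^≤Σch m) (2^≤Σch m) ⟩
  S ⊕ S  ≲⟨ ⊕-mono ≼-refl (Σ-extend {suc m} {suc (suc m)} (ℕₚ.n≤1+n _) (λ k → ι-nonneg (ch m k))) ⟩
  S ⊕ Σ< (suc (suc m)) f  ≡⟨ cong (S ⊕_) (Σ-split 1 (suc m) f) ⟩
  S ⊕ (Σ< 1 f ⊕ Σ< (suc m) (λ k → f (suc k)))  ≡⟨ solve 3 (λ a b c → a :+ (b :+ c) := b :+ (a :+ c)) refl S (Σ< 1 f) _ ⟩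
  Σ< 1 f ⊕ (S ⊕ Σ< (suc m) (λ k → f (suc k)))  ≡⟨ cong (Σ< 1 f ⊕_) (sym (Σ-⊕ (suc m) _ _)) ⟩
  Σ< 1 f ⊕ Σ< (suc m) (λ k → f k ⊕ f (suc k))  ≡⟨ cong (Σ< 1 f ⊕_) (Σ-cong (suc m) (λ k _ → sym (ι-+ (ch m k) (ch m (suc k))))) ⟩
  Σ< 1 g ⊕ Σ< (suc m) (λ k → g (suc k))  ≡⟨ sym (Σ-split 1 (suc m) g) ⟩
  Σ< (suc (suc m)) g ∎
  where
  open ≼-Reasoning
  f g : ℕ → Q
  f k = ι (ch m k)
  g k = ι (ch (suc m) k)
  S : Q
  S = Σ< (suc m) f

-- Chebyshev's lower bound

-- This is Leibniz' harmonic triangle: 1/((m+1)C(m,k)) is an integral combination of 1/1, ..., 1/(m+1).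
ch-∣ : ∀ {L n} → (∀ i → 1 ≤ i → i ≤ n → i ∣ L) → ∀ k m → k ≤ m → suc m ≤ n → suc m * ch m k ∣ L
ch-∣ {L} h zero m _ m<n = subst (_∣ L) (sym (ℕₚ.*-identityʳ (suc m))) (h (suc m) (s≤s z≤n) m<n)
ch-∣ {L} h (suc k) (suc m) (s≤s k≤m) m<n
  with ch-∣ h k (suc m) (ℕₚ.m≤n⇒m≤1+n k≤m) m<n | ch-∣ h k m k≤m (ℕₚ.<⇒≤ m<n)
... | divides u eu | divides w ew = ∣m+n∣m⇒∣n (subst (d ∣_) (trans key (ℕₚ.+-comm L _)) (n∣m*n w)) (subst (d ∣_) (e₀ u (suc (suc m)) Z) (n∣m*n u))
  where
  open ≡-Reasoning
  Z X d : ℕ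
  Z = ch (suc m) (suc k)
  X = ch (suc m) k
  d = suc (suc m) * Z
  e₀ : ∀ u a b → u * (a * b) ≡ u * a * b
  e₀ = solve-∀
  e₁ : ∀ k w m Z → suc k * (w * (suc (suc m) * Z)) + k * (w * (suc k * Z)) ≡ suc (suc m) * (w * (suc k * Z)) + k * (w * (suc k * Z))
  e₁ = solve-∀
  e₂ : ∀ m k L → suc k * L + k * L + suc m * L ≡ suc (suc m) * L + k * L + k * L
  e₂ = solve-∀
  e₃ : ∀ k u m Z X → suc k * (u * suc (suc m) * Z) + k * (u * (suc (suc m) * X)) ≡ u * suc (suc m) * (suc k * Z + k * X)
  e₃ = solve-∀
  e₄ : ∀ u m X → u * suc (suc m) * (suc m * X) ≡ suc m * (u * (suc (suc m) * X))
  e₄ = solve-∀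
  e₅ : ∀ k L A → suc k * (L + A) + k * L ≡ suc k * L + (suc k * A + k * L)
  e₅ = solve-∀
  e₆ : ∀ k L m → suc k * L + suc m * L ≡ suc (suc m) * L + k * L
  e₆ = solve-∀
  ew′ : L ≡ w * (suc k * Z)
  ew′ = trans ew (cong (w *_) (sym (ch-absorb m k)))
  uL : suc k * (u * suc (suc m) * Z) + k * L ≡ suc m * L
  uL = begin
    suc k * (u * suc (suc m) * Z) + k * L  ≡⟨ cong (λ x → suc k * (u * suc (suc m) * Z) + k * x) eu ⟩
    suc k * (u * suc (suc m) * Z) + k * (u * (suc (suc m) * X))  ≡⟨ e₃ k u m Z X ⟩
    u * suc (suc m) * (suc k * Z + k * X)  ≡⟨ cong (u * suc (suc m) *_) (ch-row (suc m) k) ⟩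
    u * suc (suc m) * (suc m * X)  ≡⟨ e₄ u m X ⟩
    suc m * (u * (suc (suc m) * X))  ≡⟨ cong (suc m *_) eu ⟨
    suc m * L ∎
  wL : suc k * (w * d) + k * L ≡ suc (suc m) * L + k * L
  wL = subst (λ L → suc k * (w * d) + k * L ≡ suc (suc m) * L + k * L) (sym ew′) (e₁ k w m Z)
  key : w * d ≡ L + u * suc (suc m) * Z
  key = sym (ℕₚ.*-cancelˡ-≡ _ _ (suc k) (ℕₚ.+-cancelʳ-≡ (k * L) _ _ (begin
    suc k * (L + u * suc (suc m) * Z) + k * L  ≡⟨ e₅ k L _ ⟩
    suc k * L + (suc k * (u * suc (suc m) * Z) + k * L)  ≡⟨ cong (suc k * L +_) uL ⟩
    suc k * L + suc m * L  ≡⟨ e₆ k L m ⟩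
    suc (suc m) * L + k * L  ≡⟨ wL ⟨
    suc k * (w * d) + k * L ∎)))

-- By `ch-∣` each (n+1) C(n,k) divides L, hence is at most L. Summing over the n + 1 values of k
-- gives (n+1) 2^n ≤ (n+1) L.
2^≤common-multiple : ∀ {L n} → 1 ≤ L → (∀ i → 1 ≤ i → i ≤ suc n → i ∣ L) → 2 ^ n ≤ L
2^≤common-multiple {L} {n} 1≤L h = ι-reflect (⊗-cancel-ι {suc n} (s≤s z≤n) (begin
  ι (suc n) ⊗ ι (2 ^ n)  ≲⟨ ⊗-monoˡ (ι-nonneg (suc n)) (2^≤Σch n) ⟩
  ι (suc n) ⊗ Σ< (suc n) (λ k → ι (ch n k))  ≡⟨ Σ-⊗ˡ (suc n) _ _ ⟨
  Σ< (suc n) (λ k → ι (suc n) ⊗ ι (ch n k))  ≲⟨ Σ-mono (suc n) (λ k k≤n → ≼-trans (≼-reflexive (sym (ι-* (suc n) (ch n k))))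
                                                      (ι-mono (∣⇒≤′ 1≤L (ch-∣ h k n (ℕ.s≤s⁻¹ k≤n) ℕₚ.≤-refl)))) ⟩
  Σ< (suc n) (λ k → ι L)  ≡⟨ Σ-const (suc n) (ι L) ⟩
  ι (suc n) ⊗ ι L  ∎))
  where open ≼-Reasoning

prime-factor : ∀ m → 2 ≤ m → ∃[ p ] (Prime p × p ∣ m)
prime-factor = <-rec _ step
  where
  step : ∀ m → (∀ {m'} → m' < m → 2 ≤ m' → ∃[ p ] (Prime p × p ∣ m')) → 2 ≤ m → ∃[ p ] (Prime p × p ∣ m)
  step (suc zero) rec (s≤s ())
  step m@(suc (suc _)) rec 2≤m with composite? m
  ... | no ¬c = m , ¬composite⇒prime ¬c , ∣-refl
  ... | yes (hasNonTrivialDivisor {divisor = d} d<m d∣m) with rec d<m (ℕ.nonTrivial⇒n>1 d)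
  ...  | p , pp , p∣d = p , pp , ∣-trans p∣d d∣m

-- Cancel one prime p from both m and L. The hypothesis passes to the quotients: for p itself it is
-- used with the exponent raised by one, and for q ≠ p a power of q dividing p x divides x.
∣-by-prime-powers : ∀ m → 1 ≤ m → ∀ L → (∀ p a → Prime p → p ^ a ∣ m → p ^ a ∣ L) → m ∣ L
∣-by-prime-powers = <-rec _ step
  where
  step : ∀ m → (∀ {m'} → m' < m → 1 ≤ m' → ∀ L → (∀ p a → Prime p → p ^ a ∣ m' → p ^ a ∣ L) → m' ∣ L) →
    1 ≤ m → ∀ L → (∀ p a → Prime p → p ^ a ∣ m → p ^ a ∣ L) → m ∣ L
  step (suc zero) rec _ L h = 1∣ L
  step m@(suc (suc _)) rec 1≤m L h with prime-factor m (s≤s (s≤s z≤n))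
  ... | p , pp , divides m' em with h p 1 pp (subst (_∣ m) (sym (ℕₚ.*-identityʳ p)) (divides m' em))
  ...  | divides L' eL = subst₂ _∣_ (sym (trans em (ℕₚ.*-comm m' p))) (sym (trans eL' (ℕₚ.*-comm L' p)))
            (*-monoʳ-∣ p (rec m'<m 1≤m' L' h'))
    where
    instance
      _ : NonZero p
      _ = prime⇒nonZero pp
    eL' : L ≡ L' * p
    eL' = trans eL (cong (L' *_) (ℕₚ.*-identityʳ p))
    1≤m' : 1 ≤ m'
    1≤m' = ℕₚ.n≢0⇒n>0 (λ e → case trans em (cong (_* p) e) of λ ())
    m'<m : m' < m
    m'<m = subst (m' <_) (sym em) (ℕₚ.m<m*n m' p {{ℕ.>-nonZero 1≤m'}} (prime≥2 pp))
    h' : ∀ q b → Prime q → q ^ b ∣ m' → q ^ b ∣ L'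
    h' q b pq d with q ℕ.≟ p
    ... | yes refl = *-cancelˡ-∣ p (subst (p * p ^ b ∣_) (trans eL' (ℕₚ.*-comm L' p))
            (h p (suc b) pp (subst (p * p ^ b ∣_) (sym (trans em (ℕₚ.*-comm m' p))) (*-monoʳ-∣ p d))))
    ... | no q≢p = strip b L' (subst (q ^ b ∣_) (trans eL' (ℕₚ.*-comm L' p)) (h q b pq (∣-trans d (divides p (trans em (ℕₚ.*-comm m' p))))))
      where
      strip : ∀ b x → q ^ b ∣ p * x → q ^ b ∣ x
      strip zero x _ = 1∣ x
      strip (suc b) x d with euclidsLemma p x pq (∣-trans (m∣m*n (q ^ b)) d)
      ... | inj₁ q∣p = ⊥-elim (q≢p (prime∣prime pq pp q∣p))
      ... | inj₂ (divides y ey) = subst (q * q ^ b ∣_) (trans (ℕₚ.*-comm q y) (sym ey)) (*-monoʳ-∣ q (strip b y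
              (*-cancelˡ-∣ q {{prime⇒nonZero pq}} (subst (q * q ^ b ∣_) (trans (cong (p *_) ey) (e p y q)) d))))
        where
        e : ∀ p y q → p * (y * q) ≡ q * (p * y)
        e = solve-∀

floor-log : ∀ p → 2 ≤ p → ∀ n → ∃[ e ] (p ^ e ≤ suc n × suc n < p ^ suc e)
floor-log p 2≤p zero = 0 , ℕₚ.≤-refl , subst (1 <_) (sym (ℕₚ.*-identityʳ p)) 2≤p
floor-log p 2≤p (suc n) with floor-log p 2≤p n
... | e , lo , hi with p ^ suc e ℕ.≤? suc (suc n)
...  | no ¬h = e , ℕₚ.m≤n⇒m≤1+n lo , ℕₚ.≰⇒> ¬h
...  | yes h = suc e , h , ℕₚ.<-≤-trans (s≤s hi) (ℕₚ.≤-trans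
        (ℕₚ.≤-trans (ℕₚ.+-monoˡ-≤ (p ^ suc e) (ℕₚ.≤-trans (s≤s z≤n) hi)) (ℕₚ.+-monoʳ-≤ (p ^ suc e) (ℕₚ.m≤m+n _ 0)))
        (ℕₚ.*-monoˡ-≤ (p ^ suc e) 2≤p))

module _ (n : ℕ) where
  -- The part of the least common multiple of 1, ..., n + 1 that is composed of primes below i. Each
  -- prime contributes a power of at most n + 1.
  primePowers : ℕ → ℕ
  primePowers zero = 1
  primePowers (suc i) with prime? i
  ... | yes pi = i ^ proj₁ (floor-log i (prime≥2 pi) n) * primePowers i
  ... | no _ = primePowers i

  primePowers≤ : ∀ i → primePowers i ≤ suc n ^ pc i
  primePowers≤ zero = ℕₚ.≤-refl
  primePowers≤ (suc i) with prime? i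
  ... | yes pi = ℕₚ.*-mono-≤ (proj₁ (proj₂ (floor-log i (prime≥2 pi) n))) (primePowers≤ i)
  ... | no _ = primePowers≤ i

  primePowers≥1 : ∀ i → 1 ≤ primePowers i
  primePowers≥1 zero = ℕₚ.≤-refl
  primePowers≥1 (suc i) with prime? i
  ... | yes pi = ℕₚ.*-mono-≤ (ℕₚ.m^n>0 i {{prime⇒nonZero pi}} (proj₁ (floor-log i (prime≥2 pi) n))) (primePowers≥1 i)
  ... | no _ = primePowers≥1 i

  ∣primePowers : ∀ i p a → p < i → Prime p → p ^ a ≤ suc n → p ^ a ∣ primePowers i
  ∣primePowers (suc i) p a p<1+i pp le with p ℕ.≟ i
  ∣primePowers (suc i) p a p<1+i pp le | yes refl with prime? p
  ... | no ¬p = ⊥-elim (¬p pp)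
  ... | yes pp' with floor-log p (prime≥2 pp') n
  ...  | e , lo , hi = ∣-trans (divides (p ^ (e ∸ a)) (trans (cong (p ^_) (sym (ℕₚ.m∸n+n≡m a≤e))) (ℕₚ.^-distribˡ-+-* p (e ∸ a) a))) (m∣m*n (primePowers p))
    where
    a≤e : a ≤ e
    a≤e with a ℕ.≤? e
    ... | yes q = q
    ... | no ¬q = ⊥-elim (ℕₚ.<⇒≱ hi (ℕₚ.≤-trans (ℕₚ.^-monoʳ-≤ p {{prime⇒nonZero pp}} (ℕₚ.≰⇒> ¬q)) le))
  ∣primePowers (suc i) p a p<1+i pp le | no p≢i with prime? i
  ... | yes pi = ∣n⇒∣m*n (i ^ proj₁ (floor-log i (prime≥2 pi) n)) (∣primePowers i p a (ℕₚ.≤∧≢⇒< (ℕ.s≤s⁻¹ p<1+i) p≢i) pp le)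
  ... | no _ = ∣primePowers i p a (ℕₚ.≤∧≢⇒< (ℕ.s≤s⁻¹ p<1+i) p≢i) pp le

chebyshev-lower : ∀ j → 2 ^ j ≤ j * pc (2 ^ j) + 2
chebyshev-lower zero = s≤s z≤n
chebyshev-lower (suc j) with 2 ^ suc j in eq | ℕₚ.^-monoʳ-≤ 2 {1} {suc j} (s≤s z≤n)
... | suc zero | s≤s ()
... | suc (suc m) | _ = ℕₚ.≤-trans (ℕₚ.+-monoˡ-≤ 2 m≤) (ℕₚ.≤-reflexive refl) ∙ ℕₚ.+-comm 2 m
  where
  _∙_ : ∀ {a b c} → a ≤ b → c ≡ a → c ≤ b
  p ∙ refl = p
  n : ℕ
  n = suc (suc m)
  L : ℕ
  -- Here 2^(j+1) = n = m + 2: the prime powers in L are at most n and their primes lie below n. So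
  -- 2^m ≤ L ≤ n ^ pc n, and the difference between m and n is the summand 2 of the statement.
  L = primePowers (suc m) n
  div : ∀ i → 1 ≤ i → i ≤ suc m → i ∣ L
  div i 1≤i i≤ = ∣-by-prime-powers i 1≤i L f
    where
    f : ∀ p a → Prime p → p ^ a ∣ i → p ^ a ∣ L
    f p zero pp d = 1∣ L
    f p (suc a) pp d = ∣primePowers (suc m) n p (suc a)
      (s≤s (ℕₚ.≤-trans (∣⇒≤′ 1≤i (∣-trans (m∣m*n (p ^ a)) d)) i≤)) pp
      (ℕₚ.≤-trans (∣⇒≤′ 1≤i d) (ℕₚ.m≤n⇒m≤1+n i≤))
  m≤ : m ≤ suc j * pc n
  m≤ = 2^-cancel-≤ (begin
    2 ^ m  ≤⟨ 2^≤common-multiple (primePowers≥1 (suc m) n) div ⟩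
    L  ≤⟨ primePowers≤ (suc m) n ⟩
    n ^ pc n  ≡⟨ cong (_^ pc n) eq ⟨
    (2 ^ suc j) ^ pc n  ≡⟨ ℕₚ.^-*-assoc 2 (suc j) (pc n) ⟩
    2 ^ (suc j * pc n)  ∎)
    where open ℕₚ.≤-Reasoning

-- Chebyshev's upper bound

-- Distinct primes dividing X have a product at most X.
cnt-prime-divisors : ∀ {X A} {P : ℕ → Set} (P? : ∀ n → Dec (P n)) n → 1 ≤ X →
  (∀ r → r < n → P r → Prime r × r ∣ X × A ≤ r) → A ^ cnt P? n ≤ X
cnt-prime-divisors {X} {A} {P} P? n 1≤X h = ℕₚ.≤-trans (lower n ℕₚ.≤-refl) (∣⇒≤′ 1≤X (prod∣ n ℕₚ.≤-refl))
  where
  prod : ℕ → ℕ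
  prod zero = 1
  prod (suc r) with P? r
  ... | yes _ = r * prod r
  ... | no _ = prod r
  lower : ∀ i → i ≤ n → A ^ cnt P? i ≤ prod i
  lower zero _ = ℕₚ.≤-refl
  lower (suc i) i<n with P? i
  ... | yes p = ℕₚ.*-mono-≤ (proj₂ (proj₂ (h i i<n p))) (lower i (ℕₚ.<⇒≤ i<n))
  ... | no _ = lower i (ℕₚ.<⇒≤ i<n)
  no-dvd : ∀ p → Prime p → ∀ i → i ≤ n → i ≤ p → ¬ p ∣ prod i
  no-dvd p pp zero _ _ d = prime∤1 pp d
  no-dvd p pp (suc i) i<n i<p d with P? i
  ... | no _ = no-dvd p pp i (ℕₚ.<⇒≤ i<n) (ℕₚ.<⇒≤ i<p) d
  ... | yes q with euclidsLemma i (prod i) pp d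
  ...  | inj₁ p∣i = ℕₚ.<⇒≱ i<p (∣⇒≤′ (prime≥1 (proj₁ (h i i<n q))) p∣i)
  ...  | inj₂ p∣ = no-dvd p pp i (ℕₚ.<⇒≤ i<n) (ℕₚ.<⇒≤ i<p) p∣
  prod∣ : ∀ i → i ≤ n → prod i ∣ X
  prod∣ zero _ = 1∣ X
  prod∣ (suc i) i<n with P? i
  ... | no _ = prod∣ i (ℕₚ.<⇒≤ i<n)
  ... | yes q with h i i<n q | prod∣ i (ℕₚ.<⇒≤ i<n)
  ...  | pi , i∣X , _ | divides c e with euclidsLemma c (prod i) pi (subst (i ∣_) e i∣X)
  ...  | inj₂ d = ⊥-elim (no-dvd i pi i (ℕₚ.<⇒≤ i<n) ℕₚ.≤-refl d)
  ...  | inj₁ (divides c' e') = divides c' (trans e (trans (cong (_* prod i) e') (ℕₚ.*-assoc c' i _)))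

prime∣! : ∀ p n → 1 ≤ p → p ≤ n → p ∣ n !
prime∣! p zero 1≤p p≤0 = ⊥-elim (ℕₚ.<⇒≱ 1≤p p≤0)
prime∣! p (suc n) 1≤p p≤ with p ℕ.≟ suc n
... | yes refl = m∣m*n (n !)
... | no p≢ = ∣n⇒∣m*n (suc n) (prime∣! p n 1≤p (ℕ.s≤s⁻¹ (ℕₚ.≤∧≢⇒< p≤ p≢)))

prime∤! : ∀ {p} → Prime p → ∀ n → n < p → ¬ p ∣ n !
prime∤! pp zero _ d = prime∤1 pp d
prime∤! pp (suc n) n<p d with euclidsLemma (suc n) (n !) pp d
... | inj₁ p∣ = ℕₚ.<⇒≱ n<p (∣⇒≤ p∣)
... | inj₂ p∣ = prime∤! pp n (ℕₚ.<⇒≤ n<p) p∣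

2^j-not-prime : ∀ {j} → 2 ≤ j → ¬ Prime (2 ^ j)
2^j-not-prime {suc zero} (s≤s ()) pp
2^j-not-prime {suc (suc j)} _ pp with prime∣prime prime[2] pp (m∣m*n (2 ^ suc j))
... | e = ℕₚ.<⇒≢ (ℕₚ.^-monoʳ-< 2 (s≤s (s≤s z≤n)) {1} {suc (suc j)} (s≤s (s≤s z≤n))) e

primeFrom? : ∀ A n → Dec (A ≤ n × Prime n)
primeFrom? A n = (A ℕ.≤? n) ×-dec prime? n

-- Every prime strictly between n = 2^j and 2n divides C(2n, n) ≤ 2^(2n). The condition j ≥ 2
-- ensures that n itself is not prime.
chebyshev-upper : ∀ j → 2 ≤ j → j * cnt (primeFrom? (2 ^ j)) (2 ^ suc j) ≤ 2 * 2 ^ j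
chebyshev-upper j 2≤j = 2^-cancel-≤ (begin
  2 ^ (j * c)  ≡⟨ ℕₚ.^-*-assoc 2 j c ⟨
  n ^ c  ≤⟨ cnt-prime-divisors (primeFrom? n) (2 ^ suc j) X≥1 h ⟩
  ch (n + n) n  ≤⟨ ch≤2^ (n + n) n ⟩
  2 ^ (n + n)  ≡⟨ cong (2 ^_) (cong (n +_) (ℕₚ.+-identityʳ n)) ⟨
  2 ^ (2 * n)  ∎)
  where
  open ℕₚ.≤-Reasoning
  n c : ℕ
  n = 2 ^ j
  c = cnt (primeFrom? n) (2 ^ suc j)
  X≥1 : 1 ≤ ch (n + n) n
  X≥1 with ch (n + n) n | ch-! n n
  ... | zero | e = ⊥-elim (ℕₚ.<⇒≢ (ℕₚ.1≤n! (n + n)) e)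
  ... | suc _ | _ = s≤s z≤n
  h : ∀ r → r < 2 ^ suc j → n ≤ r × Prime r → Prime r × r ∣ ch (n + n) n × n ≤ r
  h r r< (n≤r , pr) = pr , d , n≤r
    where
    n<r : n < r
    n<r = ℕₚ.≤∧≢⇒< n≤r (λ e → 2^j-not-prime 2≤j (subst Prime (sym e) pr))
    d : r ∣ ch (n + n) n
    d with euclidsLemma (ch (n + n) n) (n ! * n !) pr (subst (r ∣_) (sym (ch-! n n))
             (prime∣! r (n + n) (prime≥1 pr) (ℕₚ.<⇒≤ (subst (r <_) (cong (n +_) (ℕₚ.+-identityʳ n)) r<))))
    ... | inj₁ q = q
    ... | inj₂ q with euclidsLemma (n !) (n !) pr q
    ...  | inj₁ q' = ⊥-elim (prime∤! pr n n<r q')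
    ...  | inj₂ q' = ⊥-elim (prime∤! pr n n<r q')

-- A quadratic upper-bound sieve of dimension two

abs-⊗≼ : ∀ {x y e} → ι 0 ≼ y → abs x ≼ ι 1 → y ≼ e → abs (x ⊗ y) ≼ e
abs-⊗≼ {x} {y} {e} 0≼y h y≼e = begin
  abs (x ⊗ y)  ≡⟨ abs-⊗ x y ⟩
  abs x ⊗ abs y  ≡⟨ cong (abs x ⊗_) (abs-of-nonneg 0≼y) ⟩
  abs x ⊗ y  ≲⟨ ⊗-monoʳ 0≼y h ⟩
  ι 1 ⊗ y  ≡⟨ ⊗-idˡ y ⟩
  y  ≲⟨ y≼e ⟩
  e  ∎
  where open ≼-Reasoning

-- For c < r and ρ ≤ r this is the number of members of the class c mod r among the numbers below m
-- r + ρ.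
residueSize : ℕ → ℕ → ℕ → ℕ
residueSize m ρ c with c ℕ.<? ρ
... | yes _ = suc m
... | no _ = m

Σ-ind< : ∀ r ρ → ρ ≤ r → ∀ (h : ℕ → Q) → Σ< r (λ c → ind (c ℕ.<? ρ) ⊗ h c) ≡ Σ< ρ h
Σ-ind< r ρ ρ≤r h = begin
  Σ< r k  ≡⟨ cong (λ n → Σ< n k) (ℕₚ.m+[n∸m]≡n ρ≤r) ⟨
  Σ< (ρ + (r ∸ ρ)) k  ≡⟨ Σ-split ρ (r ∸ ρ) k ⟩
  Σ< ρ k ⊕ Σ< (r ∸ ρ) (λ c → k (ρ + c))  ≡⟨ cong₂ _⊕_ (Σ-cong ρ (λ c c<ρ → trans (cong (_⊗ h c) (ind-yes (c ℕ.<? ρ) c<ρ)) (⊗-idˡ _)))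
      (trans (Σ-cong (r ∸ ρ) (λ c _ → trans (cong (_⊗ h (ρ + c)) (ind-no (ρ + c ℕ.<? ρ) (ℕₚ.≤⇒≯ (ℕₚ.m≤m+n ρ c)))) (⊗-zeroˡ _))) (Σ-zero (r ∸ ρ))) ⟩
  Σ< ρ h ⊕ ι 0  ≡⟨ ⊕-idʳ _ ⟩
  Σ< ρ h  ∎
  where
  open ≡-Reasoning
  k : ℕ → Q
  k c = ind (c ℕ.<? ρ) ⊗ h c

Σ-blocks : ∀ m r (f : ℕ → Q) → Σ< (m * r) f ≡ Σ< r (λ c → Σ< m (λ s → f (c + r * s)))
Σ-blocks zero r f = sym (Σ-zero r)
Σ-blocks (suc m) r f = begin
  Σ< (r + m * r) f  ≡⟨ cong (λ n → Σ< n f) (ℕₚ.+-comm r (m * r)) ⟩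
  Σ< (m * r + r) f  ≡⟨ Σ-split (m * r) r f ⟩
  Σ< (m * r) f ⊕ Σ< r (λ c → f (m * r + c))  ≡⟨ cong₂ _⊕_ (Σ-blocks m r f) (Σ-cong r (λ c _ → cong f (e m r c))) ⟩
  Σ< r (λ c → Σ< m (λ s → f (c + r * s))) ⊕ Σ< r (λ c → f (c + r * m)) ≡⟨ Σ-⊕ r _ _ ⟨
  Σ< r (λ c → Σ< (suc m) (λ s → f (c + r * s)))  ∎
  where
  open ≡-Reasoning
  e : ∀ m r c → m * r + c ≡ c + r * m
  e = solve-∀

Σ-residues : ∀ m r ρ → ρ ≤ r → ∀ (f : ℕ → Q) →
  Σ< (m * r + ρ) f ≡ Σ< r (λ c → Σ< (residueSize m ρ c) (λ s → f (c + r * s)))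
Σ-residues m r ρ ρ≤r f = begin
  Σ< (m * r + ρ) f  ≡⟨ Σ-split (m * r) ρ f ⟩
  Σ< (m * r) f ⊕ Σ< ρ (λ c → f (m * r + c))  ≡⟨ cong₂ _⊕_ (Σ-blocks m r f) (sym (Σ-ind< r ρ ρ≤r _)) ⟩
  Σ< r (λ c → Σ< m (λ s → f (c + r * s))) ⊕ Σ< r (λ c → ind (c ℕ.<? ρ) ⊗ f (m * r + c)) ≡⟨ Σ-⊕ r _ _ ⟨
  Σ< r (λ c → Σ< m (λ s → f (c + r * s)) ⊕ ind (c ℕ.<? ρ) ⊗ f (m * r + c)) ≡⟨ Σ-cong r (λ c _ → last c) ⟩
  Σ< r (λ c → Σ< (residueSize m ρ c) (λ s → f (c + r * s)))  ∎
  where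
  open ≡-Reasoning
  e : ∀ m r c → m * r + c ≡ c + r * m
  e = solve-∀
  last : ∀ c → Σ< m (λ s → f (c + r * s)) ⊕ ind (c ℕ.<? ρ) ⊗ f (m * r + c) ≡ Σ< (residueSize m ρ c) (λ s → f (c + r * s))
  last c with c ℕ.<? ρ
  ... | yes _ = cong (Σ< m (λ s → f (c + r * s)) ⊕_) (trans (⊗-idˡ _) (cong f (e m r c)))
  ... | no _ = trans (cong (Σ< m (λ s → f (c + r * s)) ⊕_) (⊗-zeroˡ _)) (⊕-idʳ _)

-- If X has mean Γ along every progression of difference b r, then multiplying by an
-- r-periodic function h multiplies the mean by that of h.
module PeriodicMean
  (r : ℕ) (1≤r : 1 ≤ r) (a b : ℕ) (h X : ℕ → Q) (Γ E : Q)
  (h-period : ∀ t x → h (t + r * x) ≡ h t) (h≼1 : ∀ t → abs (h t) ≼ ι 1)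
  (0≼Γ : ι 0 ≼ Γ) (Γ≼E : Γ ≼ E)
  (X-mean : ∀ a' T → abs (Σ< T (λ s → X (a' + b * r * s)) ⊖ ι T ⊗ Γ) ≼ E)
  where

  private
    T/r : ℕ → Q
    T/r T = ι T ⊗ inv r

  size-error : ∀ m ρ → ρ ≤ r → ∀ c → abs (ι (residueSize m ρ c) ⊖ T/r (m * r + ρ)) ≼ ι 1
  size-error m ρ ρ≤r c = subst (λ x → abs (ι (residueSize m ρ c) ⊖ x) ≼ ι 1) (sym T/r≡) (bound c)
    where
    θ : Q
    θ = ι ρ ⊗ inv r
    0≼θ : ι 0 ≼ θ
    0≼θ = ⊗-nonneg (ι-nonneg ρ) (inv-nonneg r)
    θ≼1 : θ ≼ ι 1
    θ≼1 = ≼-trans (⊗-monoʳ (inv-nonneg r) (ι-mono ρ≤r)) (≼-reflexive (ι⊗inv 1≤r))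
    T/r≡ : T/r (m * r + ρ) ≡ ι m ⊕ θ
    T/r≡ = begin
      ι (m * r + ρ) ⊗ inv r  ≡⟨ cong (_⊗ inv r) (trans (ι-+ (m * r) ρ) (cong (_⊕ ι ρ) (ι-* m r))) ⟩
      (ι m ⊗ ι r ⊕ ι ρ) ⊗ inv r  ≡⟨ solve 4 (λ m r ρ i → (m :* r :+ ρ) :* i := m :* (r :* i) :+ ρ :* i) refl (ι m) (ι r) (ι ρ) (inv r) ⟩
      ι m ⊗ (ι r ⊗ inv r) ⊕ θ  ≡⟨ cong (λ x → ι m ⊗ x ⊕ θ) (ι⊗inv 1≤r) ⟩
      ι m ⊗ ι 1 ⊕ θ  ≡⟨ cong (_⊕ θ) (⊗-idʳ (ι m)) ⟩
      ι m ⊕ θ  ∎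
      where open ≡-Reasoning
    bound : ∀ c → abs (ι (residueSize m ρ c) ⊖ (ι m ⊕ θ)) ≼ ι 1
    bound c with c ℕ.<? ρ
    ... | yes _ = abs≼
      (≼-by θ 0≼θ (trans (cong (λ x → x ⊖ (ι m ⊕ θ) ⊕ θ) (ι-suc m)) (solve 2 (λ m t → (# 1 :+ m) :- (m :+ t) :+ t := # 1) refl (ι m) θ)))
      (≼-by ((ι 1 ⊖ θ) ⊕ ι 1) (⊕-nonneg (⊖-nonneg θ≼1) (ι-nonneg 1))
        (trans (cong (λ x → ⊝ (x ⊖ (ι m ⊕ θ)) ⊕ ((ι 1 ⊖ θ) ⊕ ι 1)) (ι-suc m)) (solve 2 (λ m t → :- ((# 1 :+ m) :- (m :+ t)) :+ ((# 1 :- t) :+ # 1) := # 1) refl (ι m) θ)))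
    ... | no _ = abs≼
      (≼-by (ι 1 ⊕ θ) (⊕-nonneg (ι-nonneg 1) 0≼θ) (solve 2 (λ m t → m :- (m :+ t) :+ (# 1 :+ t) := # 1) refl (ι m) θ))
      (≼-by (ι 1 ⊖ θ) (⊖-nonneg θ≼1) (solve 2 (λ m t → :- (m :- (m :+ t)) :+ (# 1 :- t) := # 1) refl (ι m) θ))

  mean′ : ∀ m ρ → ρ ≤ r → abs (Σ< (m * r + ρ) (λ s → h (a + b * s) ⊗ X (a + b * s))
      ⊖ T/r (m * r + ρ) ⊗ Σ< r (λ c → h (a + b * c)) ⊗ Γ) ≼ ι (2 * r) ⊗ E
  mean′ m ρ ρ≤r = begin
    abs (Σ< T (λ s → h (a + b * s) ⊗ X (a + b * s)) ⊖ T/r T ⊗ Σ< r (λ c → h (a + b * c)) ⊗ Γ)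
      ≡⟨ cong abs expand ⟩
    abs (Σ< r (λ c → h (a + b * c) ⊗ (S c ⊖ T/r T ⊗ Γ)))
      ≲⟨ Σ-abs r _ ⟩
    Σ< r (λ c → abs (h (a + b * c) ⊗ (S c ⊖ T/r T ⊗ Γ)))
      ≲⟨ Σ-mono r (λ c _ → each c) ⟩
    Σ< r (λ _ → E ⊕ E)
      ≡⟨ Σ-const r _ ⟩
    ι r ⊗ (E ⊕ E)
      ≡⟨ solve 2 (λ r e → r :* (e :+ e) := (# 2 :* r) :* e) refl (ι r) E ⟩
    (ι 2 ⊗ ι r) ⊗ E
      ≡⟨ cong (_⊗ E) (ι-* 2 r) ⟨
    ι (2 * r) ⊗ E ∎
    where
    open ≼-Reasoning
    T : ℕ
    T = m * r + ρ
    S : ℕ → Q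
    S c = Σ< (residueSize m ρ c) (λ s → X (a + b * c + b * r * s))
    e₁ : ∀ a b c r s → a + b * (c + r * s) ≡ a + b * c + r * (b * s)
    e₁ = solve-∀
    e₂ : ∀ a b c r s → a + b * (c + r * s) ≡ a + b * c + b * r * s
    e₂ = solve-∀
    expand : Σ< T (λ s → h (a + b * s) ⊗ X (a + b * s)) ⊖ T/r T ⊗ Σ< r (λ c → h (a + b * c)) ⊗ Γ
      ≡ Σ< r (λ c → h (a + b * c) ⊗ (S c ⊖ T/r T ⊗ Γ))
    expand = sym (trans
      (Σ-cong r (λ c _ → solve 4 (λ h s t g → h :* (s :- t :* g) := h :* s :+ (:- (t :* g)) :* h) refl (h (a + b * c)) (S c) (T/r T) Γ))
      (trans (Σ-⊕ r _ _) (trans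
        (cong₂ _⊕_
          (sym (trans (Σ-residues m r ρ ρ≤r _) (Σ-cong r (λ c _ → trans
            (Σ-cong (residueSize m ρ c) (λ s _ → cong₂ _⊗_ (trans (cong h (e₁ a b c r s)) (h-period (a + b * c) (b * s))) (cong X (e₂ a b c r s))))
            (Σ-⊗ˡ (residueSize m ρ c) _ _)))))
          (Σ-⊗ˡ r _ _))
        (solve 4 (λ x t h g → x :+ (:- (t :* g)) :* h := x :- t :* h :* g) refl _ (T/r T) _ Γ))))
    -- One E is the error in the mean of X along the class of c; the other bounds Γ, since the size
    -- of the class is T/r up to 1.
    each : ∀ c → abs (h (a + b * c) ⊗ (S c ⊖ T/r T ⊗ Γ)) ≼ E ⊕ E
    each c = begin
      abs (h (a + b * c) ⊗ Y)  ≡⟨ abs-⊗ _ _ ⟩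
      abs (h (a + b * c)) ⊗ abs Y  ≲⟨ ⊗-monoʳ (abs-nonneg Y) (h≼1 (a + b * c)) ⟩
      ι 1 ⊗ abs Y  ≡⟨ ⊗-idˡ _ ⟩
      abs Y  ≡⟨ cong abs (solve 4 (λ s n t g → s :- t :* g := (s :- n :* g) :+ (n :- t) :* g) refl (S c) (ι n) (T/r T) Γ) ⟩
      abs ((S c ⊖ ι n ⊗ Γ) ⊕ (ι n ⊖ T/r T) ⊗ Γ) ≲⟨ abs-⊕ _ _ ⟩
      abs (S c ⊖ ι n ⊗ Γ) ⊕ abs ((ι n ⊖ T/r T) ⊗ Γ) ≲⟨ ⊕-mono (X-mean (a + b * c) n) (abs-⊗≼ 0≼Γ (size-error m ρ ρ≤r c) Γ≼E) ⟩
      E ⊕ E ∎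
      where
      n : ℕ
      n = residueSize m ρ c
      Y : Q
      Y = S c ⊖ T/r T ⊗ Γ

  mean : ∀ T → abs (Σ< T (λ s → h (a + b * s) ⊗ X (a + b * s))
      ⊖ T/r T ⊗ Σ< r (λ c → h (a + b * c)) ⊗ Γ) ≼ ι (2 * r) ⊗ E
  mean T = subst (λ T → abs (Σ< T (λ s → h (a + b * s) ⊗ X (a + b * s)) ⊖ T/r T ⊗ Σ< r (λ c → h (a + b * c)) ⊗ Γ) ≼ ι (2 * r) ⊗ E)
    (sym (trans (m≡m%n+[m/n]*n T r) (ℕₚ.+-comm (T % r) _))) (mean′ (T / r) (T % r) (ℕₚ.<⇒≤ (m%n<n T r)))
    where
    instance
      _ : NonZero r
      _ = ℕ.>-nonZero 1≤r

≤/ : ∀ {a b} r .{{_ : NonZero r}} → a * r ≤ b → a ≤ b / r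
≤/ {a} {b} r h = subst (_≤ b / r) (m*n/n≡m a r) (/-monoˡ-≤ r h)

-- The fourth power makes replacing y by y / r gain r⁴, which absorbs the factor 2r lost by
-- splitting a progression into residue classes mod r.
errorBound : ℕ → ℕ → ℕ → ℕ
errorBound z y y' = suc z * (y * y') ^ 4

-- After multiplication by r² the three new terms cost at most 6 (y y')^4, and 6 ≤ r² because r ≥ 5.
-- They therefore fit into the increase of the first factor from r to r + 1.
errorBound-step : ∀ z y y' → 5 ≤ suc z → let q = y / suc z; q' = y' / suc z in
  errorBound z y y' + (2 * suc z) * (errorBound z y q' + errorBound z q y' + errorBound z q q') ≤ errorBound (suc z) y y'
errorBound-step z y y' 5≤r = begin
  r * A + 2 * r * (r * a₁ + r * a₂ + r * a₃)  ≡⟨ e₁ r A a₁ a₂ a₃ ⟩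
  2 * (r * r) * (a₁ + a₂ + a₃) + r * A  ≤⟨ ℕₚ.+-monoˡ-≤ (r * A) main ⟩
  suc r * A  ∎
  where
  open ℕₚ.≤-Reasoning
  r q q' A a₁ a₂ a₃ : ℕ
  r = suc z
  q = y / r
  q' = y' / r
  A = (y * y') ^ 4
  a₁ = (y * q') ^ 4
  a₂ = (q * y') ^ 4
  a₃ = (q * q') ^ 4
  e₁ : ∀ r A a b c → r * A + 2 * r * (r * a + r * b + r * c) ≡ 2 * (r * r) * (a + b + c) + r * A
  e₁ = solve-∀
  ^4-* : ∀ a b → a ^ 4 * b ^ 4 ≡ (a * b) ^ 4
  ^4-* = unfolded
    where
    unfolded : ∀ a b → a * (a * (a * (a * 1))) * (b * (b * (b * (b * 1)))) ≡ a * b * (a * b * (a * b * (a * b * 1)))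
    unfolded = solve-∀
  b₁ : a₁ * r ^ 4 ≤ A
  b₁ = ℕₚ.≤-trans (ℕₚ.≤-reflexive (trans (^4-* (y * q') r) (cong (_^ 4) (ℕₚ.*-assoc y q' r)))) (ℕₚ.^-monoˡ-≤ 4 (ℕₚ.*-monoʳ-≤ y (m/n*n≤m y' r)))
  e₂ : ∀ q y r → q * y * r ≡ q * r * y
  e₂ = solve-∀
  b₂ : a₂ * r ^ 4 ≤ A
  b₂ = ℕₚ.≤-trans (ℕₚ.≤-reflexive (trans (^4-* (q * y') r) (cong (_^ 4) (e₂ q y' r)))) (ℕₚ.^-monoˡ-≤ 4 (ℕₚ.*-monoˡ-≤ y' (m/n*n≤m y r)))
  q≤y : q ≤ y
  q≤y = ℕₚ.≤-trans (ℕₚ.m≤m*n q r) (m/n*n≤m y r)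
  b₃ : a₃ * r ^ 4 ≤ A
  b₃ = ℕₚ.≤-trans (ℕₚ.*-monoˡ-≤ (r ^ 4) (ℕₚ.^-monoˡ-≤ 4 (ℕₚ.*-monoˡ-≤ q' q≤y))) b₁
  e₃ : ∀ r a b c → r * r * (2 * (r * r) * (a + b + c)) ≡ 2 * (a * (r * (r * (r * (r * 1)))) + b * (r * (r * (r * (r * 1)))) + c * (r * (r * (r * (r * 1)))))
  e₃ = solve-∀
  e₄ : ∀ A → 2 * (A + A + A) ≡ 6 * A
  e₄ = solve-∀
  main : 2 * (r * r) * (a₁ + a₂ + a₃) ≤ A
  main = ℕₚ.*-cancelˡ-≤ (r * r) (begin
    r * r * (2 * (r * r) * (a₁ + a₂ + a₃))  ≡⟨ e₃ r a₁ a₂ a₃ ⟩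
    2 * (a₁ * r ^ 4 + a₂ * r ^ 4 + a₃ * r ^ 4)  ≤⟨ ℕₚ.*-monoʳ-≤ 2 (ℕₚ.+-mono-≤ (ℕₚ.+-mono-≤ b₁ b₂) b₃) ⟩
    2 * (A + A + A)  ≡⟨ e₄ A ⟩
    6 * A  ≤⟨ ℕₚ.*-monoˡ-≤ A (ℕₚ.≤-trans (ℕₚ.m≤m+n 6 19) (ℕₚ.*-mono-≤ 5≤r 5≤r)) ⟩
    r * r * A  ∎)

-- The primes dividing H are not sifted. As 6 divides H, the others are at least 5, so that `γ r` is
-- at most 1 and the functions `ψ r` are bounded by 1, as `PeriodicMean` requires.
module Sieve (H : ℕ) (6∣H : 6 ∣ H) where

  Sv : ℕ → Set
  Sv r = Prime r × ¬ r ∣ H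

  Sv? : ∀ r → Dec (Sv r)
  Sv? r = prime? r ×-dec ¬? (r ∣? H)

  sv≥5 : ∀ {r} → Sv r → 5 ≤ r
  sv≥5 {0} (p , _) = ⊥-elim (¬prime[0] p)
  sv≥5 {1} (p , _) = ⊥-elim (¬prime[1] p)
  sv≥5 {2} (_ , n) = ⊥-elim (n (∣-trans (divides 3 refl) 6∣H))
  sv≥5 {3} (_ , n) = ⊥-elim (n (∣-trans (divides 2 refl) 6∣H))
  sv≥5 {4} (p , _) = ⊥-elim (2^j-not-prime {2} (s≤s (s≤s z≤n)) p)
  sv≥5 {suc (suc (suc (suc (suc _))))} _ = s≤s (s≤s (s≤s (s≤s (s≤s z≤n))))

  -- The solution of (r - 2) γ = 2: a function equal to -1 on two classes mod r and to γ on the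
  -- other r - 2 then has mean zero.
  γ : ℕ → Q
  γ r = ι 2 ⊗ inv (r ∸ 2)

  0≼γ : ∀ r → ι 0 ≼ γ r
  0≼γ r = ⊗-nonneg (ι-nonneg 2) (inv-nonneg (r ∸ 2))

  γ≼1 : ∀ {r} → 5 ≤ r → γ r ≼ ι 1
  γ≼1 {r} 5≤r = ≼-trans (⊗-monoˡ (ι-nonneg 2) (inv-anti {2} {r ∸ 2} (s≤s z≤n) (ℕₚ.≤-trans (ℕₚ.n≤1+n 2) (ℕₚ.∸-monoˡ-≤ 2 5≤r))))
    (≼-reflexive (ι⊗inv {2} (s≤s z≤n)))

  r⊗γ : ∀ {r} → 5 ≤ r → ι r ⊗ γ r ≡ ι 2 ⊕ ι 2 ⊗ γ r
  r⊗γ {r} 5≤r = begin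
    ι r ⊗ γ r  ≡⟨ cong (λ n → ι n ⊗ γ r) (ℕₚ.m+[n∸m]≡n {2} {r} (ℕₚ.≤-trans (s≤s (s≤s z≤n)) 5≤r)) ⟨
    ι (2 + (r ∸ 2)) ⊗ γ r  ≡⟨ cong (_⊗ γ r) (ι-+ 2 (r ∸ 2)) ⟩
    (ι 2 ⊕ ι (r ∸ 2)) ⊗ (ι 2 ⊗ i)  ≡⟨ solve 2 (λ s i → (# 2 :+ s) :* (# 2 :* i) := # 2 :* (s :* i) :+ # 2 :* (# 2 :* i)) refl (ι (r ∸ 2)) i ⟩
    ι 2 ⊗ (ι (r ∸ 2) ⊗ i) ⊕ ι 2 ⊗ γ r  ≡⟨ cong (λ x → ι 2 ⊗ x ⊕ ι 2 ⊗ γ r) (ι⊗inv {r ∸ 2} (ℕₚ.≤-trans (s≤s z≤n) (ℕₚ.∸-monoˡ-≤ 2 5≤r))) ⟩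
    ι 2 ⊗ ι 1 ⊕ ι 2 ⊗ γ r  ≡⟨ cong (_⊕ ι 2 ⊗ γ r) (⊗-idʳ (ι 2)) ⟩
    ι 2 ⊕ ι 2 ⊗ γ r  ∎
    where
    open ≡-Reasoning
    i : Q
    i = inv (r ∸ 2)

  g : ℕ → Q
  g r with Sv? r
  ... | yes _ = γ r
  ... | no _ = ι 0

  0≼g : ∀ r → ι 0 ≼ g r
  0≼g r with Sv? r
  ... | yes _ = 0≼γ r
  ... | no _ = ≼-refl

  -- The sum, over squarefree d ≤ y composed of sifted primes up to z, of the product of the `γ r`
  -- with r dividing d. The recursion asks whether z + 1 divides d.
  G : ℕ → ℕ → Q
  G zero y = ind (1 ℕ.≤? y)
  G (suc z) y = G z y ⊕ g (suc z) ⊗ G z (y / suc z)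

  -- The same sum over d ≤ min(y, y'): the mean that orthogonality predicts for the product of
  -- `F z y` and `F z y'`.
  Γ : ℕ → ℕ → ℕ → Q
  Γ zero y y' = ind (1 ℕ.≤? y) ⊗ ind (1 ℕ.≤? y')
  Γ (suc z) y y' = Γ z y y' ⊕ g (suc z) ⊗ Γ z (y / suc z) (y' / suc z)

  Γ-diag : ∀ z y → Γ z y y ≡ G z y
  Γ-diag zero y with 1 ℕ.≤? y
  ... | yes _ = ⊗-idˡ (ι 1)
  ... | no _ = ⊗-zeroʳ (ι 0)
  Γ-diag (suc z) y = cong₂ _⊕_ (Γ-diag z y) (cong (g (suc z) ⊗_) (Γ-diag z (y / suc z)))

  0≼Γ : ∀ z y y' → ι 0 ≼ Γ z y y'
  0≼Γ zero y y' = ⊗-nonneg (ind-nonneg (1 ℕ.≤? y)) (ind-nonneg (1 ℕ.≤? y'))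
  0≼Γ (suc z) y y' = ⊕-nonneg (0≼Γ z y y') (⊗-nonneg (0≼g (suc z)) (0≼Γ z (y / suc z) (y' / suc z)))

  Γ-base : ∀ y y' → Γ zero y y' ≼ ι (errorBound zero y y')
  Γ-base y y' with 1 ℕ.≤? y | 1 ℕ.≤? y'
  ... | yes p | yes q = ≼-trans (≼-reflexive (⊗-idˡ (ι 1))) (ι-mono (ℕₚ.≤-trans (ℕₚ.m^n>0 (y * y') {{ℕ.>-nonZero (ℕₚ.*-mono-≤ p q)}} 4) (ℕₚ.m≤m+n _ 0)))
  ... | yes _ | no _ = ≼-trans (≼-reflexive (⊗-zeroʳ (ι 1))) (ι-nonneg _)
  ... | no _ | _ = ≼-trans (≼-reflexive (⊗-zeroˡ _)) (ι-nonneg _)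

  errorBound-mono : ∀ z y y' → errorBound z y y' ≤ errorBound (suc z) y y'
  errorBound-mono z y y' = ℕₚ.*-monoˡ-≤ ((y * y') ^ 4) (ℕₚ.n≤1+n (suc z))

  errorBound-stepQ : ∀ z y y' → 5 ≤ suc z → let q = y / suc z; q' = y' / suc z; D = λ y y' → ι (errorBound z y y') in
    D y y' ⊕ ι (2 * suc z) ⊗ (D y q' ⊕ D q y' ⊕ D q q') ≼ ι (errorBound (suc z) y y')
  errorBound-stepQ z y y' h = ≼-trans (≼-reflexive (sym (trans (ι-+ (errorBound z y y') _) (cong (ι (errorBound z y y') ⊕_)
      (trans (ι-* (2 * suc z) _) (cong (ι (2 * suc z) ⊗_) (trans (ι-+ (errorBound z y q' + errorBound z q y') _) (cong (_⊕ ι (errorBound z q q')) (ι-+ (errorBound z y q') _)))))))))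
    (ι-mono (errorBound-step z y y' h))
    where
    q q' : ℕ
    q = y / suc z
    q' = y' / suc z

  Γ≼D : ∀ z y y' → Γ z y y' ≼ ι (errorBound z y y')
  Γ≼D zero y y' = Γ-base y y'
  Γ≼D (suc z) y y' with Sv? (suc z)
  ... | no _ = ≼-trans (≼-reflexive (trans (cong (Γ z y y' ⊕_) (⊗-zeroˡ _)) (⊕-idʳ _)))
        (≼-trans (Γ≼D z y y') (ι-mono (errorBound-mono z y y')))
  ... | yes s = ≼-trans (⊕-mono (Γ≼D z y y') small) (errorBound-stepQ z y y' (sv≥5 s))
    where
    q q' : ℕ
    q = y / suc z
    q' = y' / suc z
    D : ℕ → ℕ → Q
    D y y' = ι (errorBound z y y')
    0≼D : ∀ y y' → ι 0 ≼ D y y'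
    0≼D y y' = ι-nonneg (errorBound z y y')
    small : γ (suc z) ⊗ Γ z q q' ≼ ι (2 * suc z) ⊗ (D y q' ⊕ D q y' ⊕ D q q')
    small = ⊗-mono (0≼γ (suc z)) (0≼Γ z q q') (≼-trans (γ≼1 (sv≥5 s)) (ι-mono {1} {2 * suc z} (s≤s z≤n)))
      (≼-trans (Γ≼D z q q') (≼-by _ (⊕-nonneg (0≼D y q') (0≼D q y')) (⊕-comm _ _)))

  module _ {Bad : ℕ → ℕ → Set} (Bad? : ∀ r t → Dec (Bad r t))
    (bad-period : ∀ {r} → Sv r → ∀ t x → ind (Bad? r (t + r * x)) ≡ ind (Bad? r t))
    (bad-count : ∀ {r} → Sv r → ∀ a b → ¬ r ∣ b → Σ< r (λ c → ind (Bad? r (a + b * c))) ≡ ι 2)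
    where

    -- ψ r is -1 on the two bad classes mod r and γ r on the others: it has mean 0 and mean square
    -- γ r.  Hence the products of the φ r over the squarefree d ≤ y are orthogonal, and their sum F
    -- takes the value G wherever no r is bad.
    ψ : ℕ → ℕ → Q
    ψ r t = γ r ⊖ ind (Bad? r t) ⊗ (γ r ⊕ ι 1)

    φ : ℕ → ℕ → Q
    φ r t with Sv? r
    ... | yes _ = ψ r t
    ... | no _ = ι 0

    F : ℕ → ℕ → ℕ → Q
    F zero y t = ind (1 ℕ.≤? y)
    F (suc z) y t = F z y t ⊕ φ (suc z) t ⊗ F z (y / suc z) t

    F-good : ∀ z y t → (∀ r → r ≤ z → Sv r → ¬ Bad r t) → F z y t ≡ G z y
    F-good zero y t h = refl
    F-good (suc z) y t h = cong₂ _⊕_ (F-good z y t h') (cong₂ _⊗_ φ≡g (F-good z (y / suc z) t h'))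
      where
      h' : ∀ r → r ≤ z → Sv r → ¬ Bad r t
      h' r r≤z = h r (ℕₚ.m≤n⇒m≤1+n r≤z)
      φ≡g : φ (suc z) t ≡ g (suc z)
      φ≡g with Sv? (suc z)
      ... | no _ = refl
      ... | yes s = trans (cong (λ x → γ (suc z) ⊖ x ⊗ (γ (suc z) ⊕ ι 1)) (ind-no (Bad? (suc z) t) (h (suc z) ℕₚ.≤-refl s)))
              (solve 1 (λ c → c :- # 0 :* (c :+ # 1) := c) refl (γ (suc z)))

    module _ {r} (s : Sv r) where
      ψ-period : ∀ t x → ψ r (t + r * x) ≡ ψ r t
      ψ-period t x = cong (λ i → γ r ⊖ i ⊗ (γ r ⊕ ι 1)) (bad-period s t x)

      ψ≼1 : ∀ t → abs (ψ r t) ≼ ι 1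
      ψ≼1 t with Bad? r t
      ... | yes _ = ≼-reflexive (trans (cong abs (solve 1 (λ c → c :- # 1 :* (c :+ # 1) := :- # 1) refl (γ r))) (trans (abs-neg (ι 1)) (abs-of-nonneg (ι-nonneg 1))))
      ... | no _ = ≼-trans (≼-reflexive (trans (cong abs (solve 1 (λ c → c :- # 0 :* (c :+ # 1) := c) refl (γ r))) (abs-of-nonneg (0≼γ r)))) (γ≼1 (sv≥5 s))

      ψ-sq : ∀ t → ψ r t ⊗ ψ r t ≡ γ r ⊗ γ r ⊕ (ι 1 ⊖ γ r ⊗ γ r) ⊗ ind (Bad? r t)
      ψ-sq t with Bad? r t
      ... | yes _ = solve 1 (λ c → (c :- # 1 :* (c :+ # 1)) :* (c :- # 1 :* (c :+ # 1)) := c :* c :+ (# 1 :- c :* c) :* # 1) refl (γ r)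
      ... | no _ = solve 1 (λ c → (c :- # 0 :* (c :+ # 1)) :* (c :- # 0 :* (c :+ # 1)) := c :* c :+ (# 1 :- c :* c) :* # 0) refl (γ r)

      ψ-mean : ∀ a b → ¬ r ∣ b → Σ< r (λ c → ψ r (a + b * c)) ≡ ι 0
      ψ-mean a b r∤b = begin
        Σ< r (λ c → γ r ⊖ i c ⊗ (γ r ⊕ ι 1))  ≡⟨ Σ-cong r (λ c _ → solve 2 (λ g i → g :- i :* (g :+ # 1) := g :+ (:- (g :+ # 1)) :* i) refl (γ r) (i c)) ⟩
        Σ< r (λ c → γ r ⊕ (⊝ (γ r ⊕ ι 1)) ⊗ i c)  ≡⟨ Σ-⊕ r _ _ ⟩
        Σ< r (λ _ → γ r) ⊕ Σ< r (λ c → (⊝ (γ r ⊕ ι 1)) ⊗ i c) ≡⟨ cong₂ _⊕_ (Σ-const r (γ r)) (trans (Σ-⊗ˡ r _ i) (cong ((⊝ (γ r ⊕ ι 1)) ⊗_) (bad-count s a b r∤b))) ⟩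
        ι r ⊗ γ r ⊕ (⊝ (γ r ⊕ ι 1)) ⊗ ι 2  ≡⟨ cong (_⊕ (⊝ (γ r ⊕ ι 1)) ⊗ ι 2) (r⊗γ (sv≥5 s)) ⟩
        ι 2 ⊕ ι 2 ⊗ γ r ⊕ (⊝ (γ r ⊕ ι 1)) ⊗ ι 2  ≡⟨ solve 1 (λ g → # 2 :+ # 2 :* g :+ (:- (g :+ # 1)) :* # 2 := # 0) refl (γ r) ⟩
        ι 0  ∎
        where
        open ≡-Reasoning
        i : ℕ → Q
        i c = ind (Bad? r (a + b * c))

      ψ-sq-mean : ∀ a b → ¬ r ∣ b → Σ< r (λ c → ψ r (a + b * c) ⊗ ψ r (a + b * c)) ≡ ι r ⊗ γ r
      ψ-sq-mean a b r∤b = begin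
        Σ< r (λ c → ψ r (a + b * c) ⊗ ψ r (a + b * c))  ≡⟨ Σ-cong r (λ c _ → ψ-sq (a + b * c)) ⟩
        Σ< r (λ c → γ r ⊗ γ r ⊕ (ι 1 ⊖ γ r ⊗ γ r) ⊗ i c) ≡⟨ Σ-⊕ r _ _ ⟩
        Σ< r (λ _ → γ r ⊗ γ r) ⊕ Σ< r (λ c → (ι 1 ⊖ γ r ⊗ γ r) ⊗ i c) ≡⟨ cong₂ _⊕_ (Σ-const r _) (trans (Σ-⊗ˡ r _ i) (cong ((ι 1 ⊖ γ r ⊗ γ r) ⊗_) (bad-count s a b r∤b))) ⟩
        ι r ⊗ (γ r ⊗ γ r) ⊕ (ι 1 ⊖ γ r ⊗ γ r) ⊗ ι 2  ≡⟨ cong (_⊕ (ι 1 ⊖ γ r ⊗ γ r) ⊗ ι 2) (trans (sym (⊗-assoc (ι r) (γ r) (γ r))) (cong (_⊗ γ r) (r⊗γ (sv≥5 s)))) ⟩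
        (ι 2 ⊕ ι 2 ⊗ γ r) ⊗ γ r ⊕ (ι 1 ⊖ γ r ⊗ γ r) ⊗ ι 2 ≡⟨ solve 1 (λ g → (# 2 :+ # 2 :* g) :* g :+ (# 1 :- g :* g) :* # 2 := # 2 :+ # 2 :* g) refl (γ r) ⟩
        ι 2 ⊕ ι 2 ⊗ γ r  ≡⟨ r⊗γ (sv≥5 s) ⟨
        ι r ⊗ γ r  ∎
        where
        open ≡-Reasoning
        i : ℕ → Q
        i c = ind (Bad? r (a + b * c))

    FF : ℕ → ℕ → ℕ → ℕ → Q
    FF z y y' t = F z y t ⊗ F z y' t

    -- Expand both recursions at r = z + 1. The cross terms contain `ψ r` once and have mean 0; the
    -- last term contains its square, of mean `γ r`. `PeriodicMean` controls all three, but it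
    -- applies the induction hypothesis along the difference b r, which is why the statement covers
    -- all progressions a + b s.
    second-moment : ∀ z y y' a b → (∀ r → r ≤ z → Sv r → ¬ r ∣ b) → ∀ T →
      abs (Σ< T (λ s → FF z y y' (a + b * s)) ⊖ ι T ⊗ Γ z y y') ≼ ι (errorBound z y y')
    second-moment zero y y' a b h T = ≼-trans (≼-reflexive (trans
      (cong abs (trans (cong (_⊖ ι T ⊗ Γ zero y y') (Σ-const T (Γ zero y y'))) (⊝-invʳ _)))
      (abs-of-nonneg ≼-refl))) (ι-nonneg (errorBound zero y y'))
    second-moment (suc z) y y' a b h T with Sv? (suc z)
    ... | no _ = ≼-trans (≼-reflexive (cong abs (cong₂ _⊖_
            (Σ-cong T (λ s _ → solve 4 (λ p q u v → (p :+ # 0 :* u) :* (q :+ # 0 :* v) := p :* q) refl _ _ _ _))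
            (cong (ι T ⊗_) (trans (cong (Γ z y y' ⊕_) (⊗-zeroˡ _)) (⊕-idʳ _))))))
          (≼-trans (second-moment z y y' a b (λ r r≤z → h r (ℕₚ.m≤n⇒m≤1+n r≤z)) T) (ι-mono (errorBound-mono z y y')))
    ... | yes s = begin
      abs (Σ< T (λ s → (f y (t s) ⊕ p (t s) ⊗ f q (t s)) ⊗ (f y' (t s) ⊕ p (t s) ⊗ f q' (t s))) ⊖ ι T ⊗ (Γ z y y' ⊕ γ r ⊗ Γ z q q'))
        ≡⟨ cong abs expand ⟩
      abs (A ⊕ (B₁ ⊕ B₂ ⊕ C))
        ≲⟨ ≼-trans (abs-⊕ A _) (⊕-mono ≼-refl (≼-trans (abs-⊕ (B₁ ⊕ B₂) C) (⊕-mono (abs-⊕ B₁ B₂) ≼-refl))) ⟩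
      abs A ⊕ (abs B₁ ⊕ abs B₂ ⊕ abs C)
        ≲⟨ ⊕-mono (second-moment z y y' a b h' T) (⊕-mono (⊕-mono (term y q') (term q y')) termC) ⟩
      D y y' ⊕ (ι (2 * r) ⊗ D y q' ⊕ ι (2 * r) ⊗ D q y' ⊕ ι (2 * r) ⊗ D q q')
        ≡⟨ solve 5 (λ d r x y z → d :+ (r :* x :+ r :* y :+ r :* z) := d :+ r :* (x :+ y :+ z)) refl (D y y') (ι (2 * r)) (D y q') (D q y') (D q q') ⟩
      D y y' ⊕ ι (2 * r) ⊗ (D y q' ⊕ D q y' ⊕ D q q')
        ≲⟨ errorBound-stepQ z y y' (sv≥5 s) ⟩
      ι (errorBound (suc z) y y') ∎
      where
      open ≼-Reasoning
      r q q' : ℕ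
      r = suc z
      q = y / r
      q' = y' / r
      D : ℕ → ℕ → Q
      D y y' = ι (errorBound z y y')
      f : ℕ → ℕ → Q
      f = F z
      p : ℕ → Q
      p = ψ r
      t : ℕ → ℕ
      t s = a + b * s
      h' : ∀ r → r ≤ z → Sv r → ¬ r ∣ b
      h' r r≤z = h r (ℕₚ.m≤n⇒m≤1+n r≤z)
      h″ : ∀ r' → r' ≤ z → Sv r' → ¬ r' ∣ b * r
      h″ r' r'≤z s' d with euclidsLemma b r (proj₁ s') d
      ... | inj₁ d' = h' r' r'≤z s' d'
      ... | inj₂ d' = ℕₚ.<⇒≢ (s≤s r'≤z) (prime∣prime (proj₁ s') (proj₁ s) d')
      r∤b : ¬ r ∣ b
      r∤b = h r ℕₚ.≤-refl s
      A B₁ B₂ C : Q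
      A = Σ< T (λ s → FF z y y' (t s)) ⊖ ι T ⊗ Γ z y y'
      B : ℕ → ℕ → Q
      B u v = Σ< T (λ s → p (t s) ⊗ FF z u v (t s))
      B₁ = B y q'
      B₂ = B q y'
      C = Σ< T (λ s → (p (t s) ⊗ p (t s)) ⊗ FF z q q' (t s)) ⊖ ι T ⊗ (γ r ⊗ Γ z q q')
      expand : Σ< T (λ s → (f y (t s) ⊕ p (t s) ⊗ f q (t s)) ⊗ (f y' (t s) ⊕ p (t s) ⊗ f q' (t s))) ⊖ ι T ⊗ (Γ z y y' ⊕ γ r ⊗ Γ z q q')
        ≡ A ⊕ (B₁ ⊕ B₂ ⊕ C)
      expand = trans (cong (_⊖ ι T ⊗ (Γ z y y' ⊕ γ r ⊗ Γ z q q')) (trans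
        (Σ-cong T (λ s _ → solve 5 (λ p u v u' v' → (u :+ p :* u') :* (v :+ p :* v') := u :* v :+ (p :* (u :* v') :+ p :* (u' :* v) :+ (p :* p) :* (u' :* v')))
          refl (p (t s)) (f y (t s)) (f y' (t s)) (f q (t s)) (f q' (t s))))
        (trans (Σ-⊕ T _ _) (cong (Σ< T (λ s → FF z y y' (t s)) ⊕_) (trans (Σ-⊕ T _ _) (cong (_⊕ Σ< T (λ s → (p (t s) ⊗ p (t s)) ⊗ FF z q q' (t s))) (Σ-⊕ T _ _)))))))
        (solve 8 (λ a b₁ b₂ c T x g y → a :+ (b₁ :+ b₂ :+ c) :- T :* (x :+ g :* y) := (a :- T :* x) :+ (b₁ :+ b₂ :+ (c :- T :* (g :* y))))
          refl _ B₁ B₂ _ (ι T) (Γ z y y') (γ r) (Γ z q q'))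
      term : ∀ u v → abs (B u v) ≼ ι (2 * r) ⊗ D u v
      term u v = ≼-trans (≼-reflexive (cong abs (sym (trans
          (cong (λ x → B u v ⊖ ι T ⊗ inv r ⊗ x ⊗ Γ z u v) (ψ-mean s a b r∤b))
          (solve 4 (λ b t i g → b :- t :* i :* # 0 :* g := b) refl (B u v) (ι T) (inv r) (Γ z u v))))))
        (PeriodicMean.mean r (s≤s z≤n) a b p (FF z u v) (Γ z u v) (D u v) (ψ-period s) (ψ≼1 s) (0≼Γ z u v) (Γ≼D z u v)
          (λ a' → second-moment z u v a' (b * r) h″) T)
      termC : abs C ≼ ι (2 * r) ⊗ D q q'
      termC = ≼-trans (≼-reflexive (cong abs (cong (Σ< T (λ s → (p (t s) ⊗ p (t s)) ⊗ FF z q q' (t s)) ⊖_) (sym (trans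
          (cong (λ x → ι T ⊗ inv r ⊗ x ⊗ Γ z q q') (ψ-sq-mean s a b r∤b))
          (trans (solve 5 (λ T i r g G → T :* i :* (r :* g) :* G := (r :* i) :* (T :* (g :* G))) refl (ι T) (inv r) (ι r) (γ r) (Γ z q q'))
            (trans (cong (_⊗ (ι T ⊗ (γ r ⊗ Γ z q q'))) (ι⊗inv {r} (s≤s z≤n))) (⊗-idˡ _))))))))
        (PeriodicMean.mean r (s≤s z≤n) a b (λ t → p t ⊗ p t) (FF z q q') (Γ z q q') (D q q')
          (λ t x → cong₂ _⊗_ (ψ-period s t x) (ψ-period s t x))
          (λ t → ≼-trans (≼-reflexive (abs-⊗ (p t) (p t))) (≼-trans (⊗-mono (abs-nonneg (p t)) (abs-nonneg (p t)) (ψ≼1 s t) (ψ≼1 s t)) (≼-reflexive (⊗-idˡ (ι 1)))))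
          (0≼Γ z q q') (Γ≼D z q q') (λ a' → second-moment z q q' a' (b * r) h″) T)

    -- Where f may be positive the value of F is G, and elsewhere its square is non-negative, so f
    -- G² ≤ F² pointwise. The sum of F² is T G up to the error bound.
    sieve-quadratic : ∀ z y T (f : ℕ → Q) → (∀ t → t < T → f t ≼ ι 0 ⊎ (f t ≼ ι 1 × (∀ r → r ≤ z → Sv r → ¬ Bad r t))) →
      Σ< T f ⊗ (G z y ⊗ G z y) ≼ ι T ⊗ G z y ⊕ ι (errorBound z y y)
    sieve-quadratic z y T f hf = begin
      Σ< T f ⊗ (G z y ⊗ G z y)  ≡⟨ Σ-⊗ʳ T _ f ⟨
      Σ< T (λ t → f t ⊗ (G z y ⊗ G z y))  ≲⟨ Σ-mono T each ⟩
      Σ< T (λ t → FF z y y (0 + 1 * t))  ≡⟨ solve 2 (λ s g → s := g :+ (s :- g)) refl _ (ι T ⊗ Γ z y y) ⟩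
      ι T ⊗ Γ z y y ⊕ (Σ< T (λ t → FF z y y (0 + 1 * t)) ⊖ ι T ⊗ Γ z y y)
        ≲⟨ ⊕-mono ≼-refl (≼-trans (≼abs _) (second-moment z y y 0 1 (λ r _ s → prime∤1 (proj₁ s)) T)) ⟩
      ι T ⊗ Γ z y y ⊕ ι (errorBound z y y)  ≡⟨ cong (λ x → ι T ⊗ x ⊕ ι (errorBound z y y)) (Γ-diag z y) ⟩
      ι T ⊗ G z y ⊕ ι (errorBound z y y)  ∎
      where
      open ≼-Reasoning
      each : ∀ t → t < T → f t ⊗ (G z y ⊗ G z y) ≼ FF z y y (0 + 1 * t)
      each t t<T with hf t t<T
      ... | inj₁ le = ≼-trans (⊗-monoʳ (sq-nonneg (G z y)) le) (≼-trans (≼-reflexive (⊗-zeroˡ _)) (sq-nonneg (F z y (0 + 1 * t))))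
      ... | inj₂ (le , good) = ≼-trans (⊗-monoʳ (sq-nonneg (G z y)) le) (≼-reflexive (trans (⊗-idˡ _)
              (sym (cong₂ _⊗_ F≡ F≡))))
        where
        F≡ : F z y (0 + 1 * t) ≡ G z y
        F≡ = trans (cong (F z y) (ℕₚ.*-identityˡ t)) (F-good z y t good)

-- Smooth numbers and the main term of the sieve

-- The bound `p < suc n` makes the quantifier finite, hence decidable, and excludes no prime divisor
-- of a positive n.
Smooth : ℕ → ℕ → Set
Smooth z n = ∀ {p} → p < suc n → Prime p → p ∣ n → p ≤ z

smooth? : ∀ z n → Dec (Smooth z n)
smooth? z n = ℕₚ.allUpTo? (λ p → prime? p →-dec (p ∣? n →-dec p ℕ.≤? z)) (suc n)

smooth-intro : ∀ {z n} → (∀ p → Prime p → p ∣ n → p ≤ z) → Smooth z n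
smooth-intro h {p} _ = h p

smooth-elim : ∀ {z n} → 1 ≤ n → Smooth z n → ∀ p → Prime p → p ∣ n → p ≤ z
smooth-elim 1≤n s p pp p∣n = s (s≤s (∣⇒≤′ 1≤n p∣n)) pp p∣n

U : ℕ → ℕ → Q
U z y = Σ< y (λ k → ind (smooth? z (suc k)) ⊗ inv (suc k))

0≼U-term : ∀ z k → ι 0 ≼ ind (smooth? z (suc k)) ⊗ inv (suc k)
0≼U-term z k = ⊗-nonneg (ind-nonneg (smooth? z (suc k))) (inv-nonneg (suc k))

0≼U : ∀ z y → ι 0 ≼ U z y
0≼U z y = Σ-nonneg y (λ k _ → 0≼U-term z k)

U-mono : ∀ z {y y'} → y ≤ y' → U z y ≼ U z y'
U-mono z y≤y' = Σ-extend y≤y' (0≼U-term z)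

U-zero : ∀ y → U 0 y ≼ ind (1 ℕ.≤? y)
U-zero zero = ≼-refl
U-zero (suc y) = Σ-single (suc y) _ 0 (ι 1) (ι-nonneg 1) each
  where
  each : ∀ k → k < suc y → (k ≡ 0 × ind (smooth? 0 (suc k)) ⊗ inv (suc k) ≼ ι 1) ⊎ ind (smooth? 0 (suc k)) ⊗ inv (suc k) ≼ ι 0
  each zero _ = inj₁ (refl , ≼-trans (⊗-mono (ind-nonneg (smooth? 0 1)) (inv-nonneg 1) (ind≼1 (smooth? 0 1)) (≼-reflexive inv-1)) (≼-reflexive (⊗-idˡ (ι 1))))
  each (suc k) _ = inj₂ (≼-reflexive (trans (cong (_⊗ inv (2 + k)) (ind-no (smooth? 0 (2 + k)) rough)) (⊗-zeroˡ _)))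
    where
    rough : ¬ Smooth 0 (2 + k)
    rough s with prime-factor (2 + k) (s≤s (s≤s z≤n))
    ... | p , pp , d = ℕₚ.<⇒≱ (prime≥1 pp) (smooth-elim (s≤s z≤n) s p pp d)

U-composite : ∀ z y → ¬ Prime (suc z) → U (suc z) y ≼ U z y
U-composite z y np = Σ-mono y (λ k _ → ⊗-monoʳ (inv-nonneg (suc k)) (ind-mono (smooth? (suc z) (suc k)) (smooth? z (suc k))
  (λ s → smooth-intro (λ p pp d → ℕ.s≤s⁻¹ (ℕₚ.≤∧≢⇒< (smooth-elim (s≤s z≤n) s p pp d) (λ e → np (subst Prime e pp)))))))

-- An r-smooth n, with r = z + 1, is either z-smooth or r times an r-smooth number not exceeding y /
-- r.
U-peel : ∀ z y → Prime (suc z) → U (suc z) y ≼ U z y ⊕ inv (suc z) ⊗ U (suc z) (y / suc z)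
U-peel z y pr = begin
  U r y  ≲⟨ Σ-mono y (λ k _ → split k) ⟩
  Σ< y (λ k → term z k ⊕ mult k)  ≡⟨ Σ-⊕ y _ _ ⟩
  U z y ⊕ Σ< y mult  ≲⟨ ⊕-mono ≼-refl (Σ-reindex y (y / r) mult _ (λ j → ℕ.pred (r * suc j)) (λ j _ → ⊗-nonneg (inv-nonneg r) (0≼U-term r j)) (λ k → reindex k)) ⟩
  U z y ⊕ Σ< (y / r) (λ j → inv r ⊗ term r j)  ≡⟨ cong (U z y ⊕_) (Σ-⊗ˡ (y / r) (inv r) (term r)) ⟩
  U z y ⊕ inv r ⊗ U r (y / r)  ∎
  where
  open ≼-Reasoning
  r : ℕ
  r = suc z
  term : ℕ → ℕ → Q
  term z k = ind (smooth? z (suc k)) ⊗ inv (suc k)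
  mult : ℕ → Q
  mult k = ind (r ∣? suc k) ⊗ term r k
  split : ∀ k → term r k ≼ term z k ⊕ mult k
  split k with r ∣? suc k
  ... | yes _ = ≼-by (term z k) (0≼U-term z k) (trans (⊕-comm _ _) (cong (term z k ⊕_) (sym (⊗-idˡ (term r k)))))
  ... | no r∤n = ≼-trans (⊗-monoʳ (inv-nonneg (suc k)) (ind-mono (smooth? r (suc k)) (smooth? z (suc k))
            (λ s → smooth-intro (λ p pp d → ℕ.s≤s⁻¹ (ℕₚ.≤∧≢⇒< (smooth-elim (s≤s z≤n) s p pp d) (λ e → r∤n (subst (_∣ suc k) e d)))))))
        (≼-by _ (≼-reflexive (sym (⊗-zeroˡ (term r k)))) refl)
  reindex : ∀ k → k < y → (∃[ j ] (j < y / r × k ≡ ℕ.pred (r * suc j) × mult k ≼ inv r ⊗ term r j)) ⊎ mult k ≼ ι 0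
  reindex k k<y with r ∣? suc k
  ... | no _ = inj₂ (≼-reflexive (⊗-zeroˡ _))
  ... | yes (divides (suc j) e) = inj₁ (j , j< , cong ℕ.pred e′ , (begin
      ι 1 ⊗ term r k  ≡⟨ ⊗-idˡ _ ⟩
      ind (smooth? r (suc k)) ⊗ inv (suc k)  ≡⟨ cong (λ n → ind (smooth? r (suc k)) ⊗ inv n) e′ ⟩
      ind (smooth? r (suc k)) ⊗ inv (r * suc j)  ≡⟨ cong (ind (smooth? r (suc k)) ⊗_) (inv-* {r} {suc j} (s≤s z≤n) (s≤s z≤n)) ⟩
      ind (smooth? r (suc k)) ⊗ (inv r ⊗ inv (suc j))  ≲⟨ ⊗-monoʳ (⊗-nonneg (inv-nonneg r) (inv-nonneg (suc j))) (ind-mono (smooth? r (suc k)) (smooth? r (suc j)) sm) ⟩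
      ind (smooth? r (suc j)) ⊗ (inv r ⊗ inv (suc j))  ≡⟨ solve 3 (λ a b c → a :* (b :* c) := b :* (a :* c)) refl _ (inv r) _ ⟩
      inv r ⊗ term r j ∎))
    where
    e′ : suc k ≡ r * suc j
    e′ = trans e (ℕₚ.*-comm (suc j) r)
    j< : j < y / r
    j< = ≤/ r (subst (_≤ y) e k<y)
    sm : Smooth r (suc k) → Smooth r (suc j)
    sm s = smooth-intro (λ p pp d → smooth-elim (s≤s z≤n) s p pp (∣-trans d (divides r e′)))

inv-suc-telescope : ∀ z → 1 ≤ z → inv (suc z) ⊗ (ι 1 ⊕ inv z) ≡ inv z
inv-suc-telescope z 1≤z = begin
  inv (suc z) ⊗ (ι 1 ⊕ inv z)  ≡⟨ cong (λ x → inv (suc z) ⊗ (x ⊕ inv z)) (ι⊗inv 1≤z) ⟨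
  inv (suc z) ⊗ (ι z ⊗ inv z ⊕ inv z)  ≡⟨ solve 3 (λ a b c → a :* (b :* c :+ c) := ((# 1 :+ b) :* a) :* c) refl (inv (suc z)) (ι z) (inv z) ⟩
  ((ι 1 ⊕ ι z) ⊗ inv (suc z)) ⊗ inv z  ≡⟨ cong (λ x → (x ⊗ inv (suc z)) ⊗ inv z) (ι-suc z) ⟨
  (ι (suc z) ⊗ inv (suc z)) ⊗ inv z  ≡⟨ cong (_⊗ inv z) (inv-suc z) ⟩
  ι 1 ⊗ inv z  ≡⟨ ⊗-idˡ _ ⟩
  inv z  ∎
  where open ≡-Reasoning

-- Iterating `U-peel` sums 1/r + 1/r² + ... = 1/(r - 1) = 1/z. In the induction on y this geometric
-- series appears as the identity (1/r)(1 + 1/z) = 1/z.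
U-prime : ∀ z → Prime (suc z) → ∀ y → U (suc z) y ≼ U z y ⊕ inv z ⊗ U z (y / suc z)
U-prime z pr = <-rec _ step
  where
  1≤z : 1 ≤ z
  1≤z = ℕ.s≤s⁻¹ (prime≥2 pr)
  open ≼-Reasoning
  step : ∀ y → (∀ {y'} → y' < y → U (suc z) y' ≼ U z y' ⊕ inv z ⊗ U z (y' / suc z)) → U (suc z) y ≼ U z y ⊕ inv z ⊗ U z (y / suc z)
  step zero rec = ⊕-nonneg (0≼U z 0) (⊗-nonneg (inv-nonneg z) (0≼U z (0 / suc z)))
  step y@(suc _) rec = begin
    U (suc z) y  ≲⟨ U-peel z y pr ⟩
    U z y ⊕ inv (suc z) ⊗ U (suc z) y₁  ≲⟨ ⊕-mono ≼-refl (⊗-monoˡ (inv-nonneg (suc z)) (≼-trans (rec (m/n<m y (suc z) (prime≥2 pr)))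
                                                                    (⊕-mono ≼-refl (⊗-monoˡ (inv-nonneg z) (U-mono z (m/n≤m y₁ (suc z))))))) ⟩
    U z y ⊕ inv (suc z) ⊗ (U z y₁ ⊕ inv z ⊗ U z y₁)  ≡⟨ cong (U z y ⊕_) (solve 3 (λ a b c → a :* (c :+ b :* c) := (a :* (# 1 :+ b)) :* c) refl (inv (suc z)) (inv z) (U z y₁)) ⟩
    U z y ⊕ (inv (suc z) ⊗ (ι 1 ⊕ inv z)) ⊗ U z y₁  ≡⟨ cong (λ x → U z y ⊕ x ⊗ U z y₁) (inv-suc-telescope z 1≤z) ⟩
    U z y ⊕ inv z ⊗ U z y₁  ∎
    where
    y₁ : ℕ
    y₁ = y / suc z

harmonic-half : ∀ n → 1 ≤ n → ι 1 ≼ ι 2 ⊗ Σ< n (λ k → inv (suc (n + k)))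
harmonic-half n 1≤n = begin
  ι 1  ≡⟨ ι⊗inv {n + n} (ℕₚ.≤-trans 1≤n (ℕₚ.m≤m+n n n)) ⟨
  ι (n + n) ⊗ inv (n + n)  ≡⟨ cong (_⊗ inv (n + n)) (ι-+ n n) ⟩
  (ι n ⊕ ι n) ⊗ inv (n + n)  ≡⟨ solve 2 (λ n i → (n :+ n) :* i := # 2 :* (n :* i)) refl (ι n) (inv (n + n)) ⟩
  ι 2 ⊗ (ι n ⊗ inv (n + n))  ≡⟨ cong (ι 2 ⊗_) (Σ-const n _) ⟨
  ι 2 ⊗ Σ< n (λ _ → inv (n + n))  ≲⟨ ⊗-monoˡ (ι-nonneg 2) (Σ-mono n (λ k k<n → inv-anti (s≤s z≤n) (ℕₚ.≤-trans (ℕₚ.≤-reflexive (sym (ℕₚ.+-suc n k))) (ℕₚ.+-monoʳ-≤ n k<n)))) ⟩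
  ι 2 ⊗ Σ< n (λ k → inv (suc (n + k)))  ∎
  where open ≼-Reasoning

harmonic : ℕ → Q
harmonic n = Σ< n (λ k → inv (suc k))

harmonic-step : ∀ ℓ → ι 2 ⊗ harmonic (2 ^ ℓ) ⊕ ι 1 ≼ ι 2 ⊗ harmonic (2 ^ suc ℓ)
harmonic-step ℓ = begin
  ι 2 ⊗ harmonic n ⊕ ι 1  ≲⟨ ⊕-mono ≼-refl (harmonic-half n (2^n≥1 ℓ)) ⟩
  ι 2 ⊗ harmonic n ⊕ ι 2 ⊗ Σ< n (λ k → inv (suc (n + k))) ≡⟨ ⊗-distribˡ _ _ _ ⟨
  ι 2 ⊗ (harmonic n ⊕ Σ< n (λ k → inv (suc (n + k))))  ≡⟨ cong (ι 2 ⊗_) (Σ-split n n _) ⟨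
  ι 2 ⊗ harmonic (n + n)  ≡⟨ cong (λ m → ι 2 ⊗ harmonic (n + m)) (ℕₚ.+-identityʳ n) ⟨
  ι 2 ⊗ harmonic (2 ^ suc ℓ)  ∎
  where
  open ≼-Reasoning
  n : ℕ
  n = 2 ^ ℓ

harmonic-grow : ∀ ℓ m → ι 2 ⊗ harmonic (2 ^ ℓ) ⊕ ι m ≼ ι 2 ⊗ harmonic (2 ^ (m + ℓ))
harmonic-grow ℓ zero = ≼-reflexive (⊕-idʳ _)
harmonic-grow ℓ (suc m) = begin
  ι 2 ⊗ harmonic (2 ^ ℓ) ⊕ ι (suc m)  ≡⟨ trans (cong (ι 2 ⊗ harmonic (2 ^ ℓ) ⊕_) (trans (ι-suc m) (⊕-comm _ _))) (sym (⊕-assoc _ _ _)) ⟩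
  ι 2 ⊗ harmonic (2 ^ ℓ) ⊕ ι m ⊕ ι 1  ≲⟨ ⊕-mono (harmonic-grow ℓ m) ≼-refl ⟩
  ι 2 ⊗ harmonic (2 ^ (m + ℓ)) ⊕ ι 1  ≲⟨ harmonic-step (m + ℓ) ⟩
  ι 2 ⊗ harmonic (2 ^ suc (m + ℓ))  ∎
  where open ≼-Reasoning

-- For y = z every n ≤ y is smooth, so U is the whole harmonic sum.
U-full : ∀ ℓ → ι ℓ ≼ ι 2 ⊗ U (2 ^ ℓ) (2 ^ ℓ)
U-full ℓ = ≼-trans (≼-trans lower (≼-reflexive (cong (λ m → ι 2 ⊗ harmonic (2 ^ m)) (ℕₚ.+-identityʳ ℓ)))) (⊗-monoˡ (ι-nonneg 2) (Σ-mono (2 ^ ℓ) (λ k k<n → ≼-reflexive (sym (trans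
  (cong (_⊗ inv (suc k)) (ind-yes (smooth? (2 ^ ℓ) (suc k)) (smooth-intro (λ p pp d → ℕₚ.≤-trans (∣⇒≤ d) k<n)))) (⊗-idˡ _))))))
  where
  lower : ι ℓ ≼ ι 2 ⊗ harmonic (2 ^ (ℓ + 0))
  lower = ≼-trans (≼-by _ (⊗-nonneg (ι-nonneg 2) (Σ-nonneg 1 (λ k _ → inv-nonneg (suc k)))) (⊕-comm _ _)) (harmonic-grow 0 ℓ)

-- The local factor p/(p-1) at the primes p dividing K.

σ : ℕ → ℕ → Q
σ K p = ι 1 ⊕ ind (prime? p ×-dec p ∣? K) ⊗ inv (p ∸ 1)

S : ℕ → ℕ → Q
S K zero = ι 1
S K (suc z) = S K z ⊗ σ K (suc z)

1≼σ : ∀ K p → ι 1 ≼ σ K p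
1≼σ K p = ≼-by _ (⊗-nonneg (ind-nonneg (prime? p ×-dec p ∣? K)) (inv-nonneg (p ∸ 1))) refl

0≼σ : ∀ K p → ι 0 ≼ σ K p
0≼σ K p = ≼-trans (ι-nonneg 1) (1≼σ K p)

1≼S : ∀ K z → ι 1 ≼ S K z
1≼S K zero = ≼-refl
1≼S K (suc z) = ≼-trans (≼-reflexive (sym (⊗-idˡ (ι 1)))) (⊗-mono (ι-nonneg 1) (ι-nonneg 1) (1≼S K z) (1≼σ K (suc z)))

0≼S : ∀ K z → ι 0 ≼ S K z
0≼S K z = ≼-trans (ι-nonneg 1) (1≼S K z)

module SieveMainTerm (H : ℕ) (6∣H : 6 ∣ H) where
  open Sieve H 6∣H

  g₁ : ℕ → Q
  g₁ r with Sv? r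
  ... | yes _ = inv (r ∸ 1)
  ... | no _ = ι 0

  0≼g₁ : ∀ r → ι 0 ≼ g₁ r
  0≼g₁ r with Sv? r
  ... | yes _ = inv-nonneg (r ∸ 1)
  ... | no _ = ≼-refl

  -- (1 + 1/(r-1))² - 1 ≤ 2/(r-2)
  g₁≼g : ∀ r → g₁ r ⊕ g₁ r ⊕ g₁ r ⊗ g₁ r ≼ g r
  g₁≼g r with Sv? r
  ... | no _ = ≼-reflexive (solve 0 (# 0 :+ # 0 :+ # 0 :* # 0 := # 0) refl)
  ... | yes s = go r (sv≥5 s)
    where
    go : ∀ r → 5 ≤ r → inv (r ∸ 1) ⊕ inv (r ∸ 1) ⊕ inv (r ∸ 1) ⊗ inv (r ∸ 1) ≼ ι 2 ⊗ inv (r ∸ 2)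
    go (suc zero) (s≤s ())
    go (suc (suc k)) 5≤r = ≼-by (i ⊗ i ⊕ ι 2 ⊗ i ⊗ i ⊗ j)
      (⊕-nonneg (sq-nonneg i) (⊗-nonneg (⊗-nonneg (⊗-nonneg (ι-nonneg 2) (inv-nonneg (suc k))) (inv-nonneg (suc k))) (inv-nonneg k)))
      (begin
        i ⊕ i ⊕ i ⊗ i ⊕ (i ⊗ i ⊕ ι 2 ⊗ i ⊗ i ⊗ j)  ≡⟨ solve 2 (λ i j → i :+ i :+ i :* i :+ (i :* i :+ # 2 :* i :* i :* j) := # 2 :* (i :* (# 1 :+ i :* (# 1 :+ j)))) refl i j ⟩
        ι 2 ⊗ (i ⊗ (ι 1 ⊕ i ⊗ (ι 1 ⊕ j)))  ≡⟨ cong (λ x → ι 2 ⊗ (i ⊗ (ι 1 ⊕ x))) e ⟩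
        ι 2 ⊗ (i ⊗ (ι 1 ⊕ j))  ≡⟨ cong (ι 2 ⊗_) e ⟩
        ι 2 ⊗ j  ∎)
      where
      open ≡-Reasoning
      i j : Q
      i = inv (suc k)
      j = inv k
      e : i ⊗ (ι 1 ⊕ j) ≡ j
      e = inv-suc-telescope k (ℕₚ.≤-trans (s≤s z≤n) (ℕ.s≤s⁻¹ (ℕ.s≤s⁻¹ 5≤r)))

  -- The analogue of `G` for a sieve of dimension one, with the weight 1/(r - 1) in place of 2/(r -
  -- 2). It compares directly with sums of 1/n.
  G₁ : ℕ → ℕ → Q
  G₁ zero y = ind (1 ℕ.≤? y)
  G₁ (suc z) y = G₁ z y ⊕ g₁ (suc z) ⊗ G₁ z (y / suc z)

  0≼G₁ : ∀ z y → ι 0 ≼ G₁ z y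
  0≼G₁ zero y = ind-nonneg (1 ℕ.≤? y)
  0≼G₁ (suc z) y = ⊕-nonneg (0≼G₁ z y) (⊗-nonneg (0≼g₁ (suc z)) (0≼G₁ z (y / suc z)))

  0≼G : ∀ z y → ι 0 ≼ G z y
  0≼G z y = ≼-trans (0≼Γ z y y) (≼-reflexive (Γ-diag z y))

  1≼G : ∀ z {y} → 1 ≤ y → ι 1 ≼ G z y
  1≼G zero {y} 1≤y = ≼-reflexive (sym (ind-yes (1 ℕ.≤? y) 1≤y))
  1≼G (suc z) {y} 1≤y = ≼-trans (1≼G z 1≤y) (≼-by _ (⊗-nonneg (0≼g (suc z)) (0≼G z (y / suc z))) refl)

  G-mono : ∀ z {y y'} → y ≤ y' → G z y ≼ G z y'
  G-mono zero {y} {y'} y≤y' = ind-mono (1 ℕ.≤? y) (1 ℕ.≤? y') (λ p → ℕₚ.≤-trans p y≤y')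
  G-mono (suc z) y≤y' = ⊕-mono (G-mono z y≤y') (⊗-monoˡ (0≼g (suc z)) (G-mono z (/-monoˡ-≤ (suc z) y≤y')))

  -- Group the pairs d, d' by their least common multiple, which is at most y y'. A prime r of it
  -- divides d, or d', or both, with total weight 2/(r - 1) + 1/(r - 1)², and `g₁≼g` bounds this by
  -- the weight in `G`.
  G₁⊗G₁≼G : ∀ z y y' → G₁ z y ⊗ G₁ z y' ≼ G z (y * y')
  G₁⊗G₁≼G zero y y' with 1 ℕ.≤? y | 1 ℕ.≤? y'
  ... | yes p | yes q = ≼-reflexive (trans (⊗-idˡ (ι 1)) (sym (ind-yes (1 ℕ.≤? y * y') (ℕₚ.*-mono-≤ p q))))
  ... | yes _ | no _ = ≼-trans (≼-reflexive (⊗-zeroʳ _)) (ind-nonneg (1 ℕ.≤? y * y'))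
  ... | no _ | _ = ≼-trans (≼-reflexive (⊗-zeroˡ _)) (ind-nonneg (1 ℕ.≤? y * y'))
  G₁⊗G₁≼G (suc z) y y' = begin
    (a ⊕ γ₁ ⊗ b) ⊗ (a' ⊕ γ₁ ⊗ b')
      ≡⟨ solve 5 (λ a b a' b' g → (a :+ g :* b) :* (a' :+ g :* b') := a :* a' :+ (g :* (a :* b') :+ g :* (b :* a') :+ g :* g :* (b :* b'))) refl a b a' b' γ₁ ⟩
    a ⊗ a' ⊕ (γ₁ ⊗ (a ⊗ b') ⊕ γ₁ ⊗ (b ⊗ a') ⊕ γ₁ ⊗ γ₁ ⊗ (b ⊗ b'))
      ≲⟨ ⊕-mono (G₁⊗G₁≼G z y y') (⊕-mono (⊕-mono
           (⊗-monoˡ (0≼g₁ r) (≼-trans (G₁⊗G₁≼G z y q') (G-mono z (≤/ r le₁))))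
           (⊗-monoˡ (0≼g₁ r) (≼-trans (G₁⊗G₁≼G z q y') (G-mono z (≤/ r le₂)))))
           (⊗-monoˡ (⊗-nonneg (0≼g₁ r) (0≼g₁ r)) (≼-trans (G₁⊗G₁≼G z q q') (G-mono z (≤/ r le₃))))) ⟩
    G z (y * y') ⊕ (γ₁ ⊗ c ⊕ γ₁ ⊗ c ⊕ γ₁ ⊗ γ₁ ⊗ c)
      ≡⟨ cong (G z (y * y') ⊕_) (solve 2 (λ g c → g :* c :+ g :* c :+ g :* g :* c := (g :+ g :+ g :* g) :* c) refl γ₁ c) ⟩
    G z (y * y') ⊕ (γ₁ ⊕ γ₁ ⊕ γ₁ ⊗ γ₁) ⊗ c
      ≲⟨ ⊕-mono ≼-refl (⊗-monoʳ (0≼G z (y * y' / r)) (g₁≼g r)) ⟩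
    G z (y * y') ⊕ g r ⊗ c ∎
    where
    open ≼-Reasoning
    r q q' : ℕ
    r = suc z
    q = y / r
    q' = y' / r
    a b a' b' c γ₁ : Q
    a = G₁ z y
    b = G₁ z q
    a' = G₁ z y'
    b' = G₁ z q'
    c = G z (y * y' / r)
    γ₁ = g₁ r
    le₁ : y * q' * r ≤ y * y'
    le₁ = ℕₚ.≤-trans (ℕₚ.≤-reflexive (ℕₚ.*-assoc y q' r)) (ℕₚ.*-monoʳ-≤ y (m/n*n≤m y' r))
    e₂ : ∀ q y r → q * y * r ≡ q * r * y
    e₂ = solve-∀
    le₂ : q * y' * r ≤ y * y'
    le₂ = ℕₚ.≤-trans (ℕₚ.≤-reflexive (e₂ q y' r)) (ℕₚ.*-monoˡ-≤ y' (m/n*n≤m y r))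
    le₃ : q * q' * r ≤ y * y'
    le₃ = ℕₚ.≤-trans (ℕₚ.*-monoˡ-≤ r (ℕₚ.*-monoˡ-≤ q' (m/n≤m y r))) le₁

  -- Going from z to z + 1, a sifted prime enlarges `G₁`, a prime r dividing H multiplies `S` by 1 +
  -- 1/(r - 1), and a composite number adds nothing to `U`.
  U≼S⊗G₁ : ∀ z y → U z y ≼ S H z ⊗ G₁ z y
  U≼S⊗G₁ zero y = ≼-trans (U-zero y) (≼-reflexive (sym (⊗-idˡ _)))
  U≼S⊗G₁ (suc z) y with Sv? (suc z)
  ... | yes s@(pr , _) = begin
    U (suc z) y  ≲⟨ U-prime z pr y ⟩
    U z y ⊕ inv z ⊗ U z (y / suc z)  ≲⟨ ⊕-mono (U≼S⊗G₁ z y) (⊗-monoˡ (inv-nonneg z) (U≼S⊗G₁ z (y / suc z))) ⟩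
    S H z ⊗ G₁ z y ⊕ inv z ⊗ (S H z ⊗ G₁ z (y / suc z)) ≡⟨ solve 4 (λ s a i b → s :* a :+ i :* (s :* b) := s :* (a :+ i :* b)) refl (S H z) _ (inv z) _ ⟩
    S H z ⊗ (G₁ z y ⊕ inv z ⊗ G₁ z (y / suc z))  ≲⟨ ⊗-monoʳ (⊕-nonneg (0≼G₁ z y) (⊗-nonneg (inv-nonneg z) (0≼G₁ z (y / suc z)))) S≼ ⟩
    S H (suc z) ⊗ (G₁ z y ⊕ inv z ⊗ G₁ z (y / suc z))  ∎
    where
    open ≼-Reasoning
    S≼ : S H z ≼ S H (suc z)
    S≼ = ≼-trans (≼-reflexive (sym (⊗-idʳ _))) (⊗-monoˡ (0≼S H z) (1≼σ H (suc z)))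
  ... | no ¬s = ≼-trans bound (≼-reflexive (cong (S H (suc z) ⊗_) (sym (trans (cong (G₁ z y ⊕_) (⊗-zeroˡ _)) (⊕-idʳ _)))))
    where
    open ≼-Reasoning
    bound : U (suc z) y ≼ S H z ⊗ σ H (suc z) ⊗ G₁ z y
    bound with prime? (suc z) | suc z ∣? H
    ... | yes pr | no ∤H = ⊥-elim (¬s (pr , ∤H))
    ... | no np | _ = begin
      U (suc z) y  ≲⟨ U-composite z y np ⟩
      U z y  ≲⟨ U≼S⊗G₁ z y ⟩
      S H z ⊗ G₁ z y  ≡⟨ solve 3 (λ s i a → s :* a := s :* (# 1 :+ # 0 :* i) :* a) refl (S H z) (inv z) (G₁ z y) ⟩
      S H z ⊗ (ι 1 ⊕ ι 0 ⊗ inv z) ⊗ G₁ z y  ∎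
    ... | yes pr | yes _ = begin
      U (suc z) y  ≲⟨ U-prime z pr y ⟩
      U z y ⊕ inv z ⊗ U z (y / suc z)  ≲⟨ ⊕-mono ≼-refl (⊗-monoˡ (inv-nonneg z) (U-mono z (m/n≤m y (suc z)))) ⟩
      U z y ⊕ inv z ⊗ U z y  ≡⟨ solve 2 (λ u i → u :+ i :* u := (# 1 :+ i) :* u) refl (U z y) (inv z) ⟩
      (ι 1 ⊕ inv z) ⊗ U z y  ≲⟨ ⊗-monoˡ (⊕-nonneg (ι-nonneg 1) (inv-nonneg z)) (U≼S⊗G₁ z y) ⟩
      (ι 1 ⊕ inv z) ⊗ (S H z ⊗ G₁ z y)  ≡⟨ solve 3 (λ s i a → (# 1 :+ i) :* (s :* a) := s :* (# 1 :+ # 1 :* i) :* a) refl (S H z) (inv z) (G₁ z y) ⟩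
      S H z ⊗ (ι 1 ⊕ ι 1 ⊗ inv z) ⊗ G₁ z y  ∎

-- Linear forms

prime-coprime : ∀ {r b} → Prime r → ¬ r ∣ b → Coprime r b
prime-coprime pr r∤b (d∣r , d∣b) with prime⇒irreducible pr d∣r
... | inj₁ e = e
... | inj₂ refl = ⊥-elim (r∤b d∣b)

root-exists : ∀ {r b} → Prime r → ¬ r ∣ b → ∀ a → ∃[ c ] (c < r × r ∣ a + b * c)
root-exists {r} {b} pr r∤b a = reduce (root r (coprime-Bézout (prime-coprime pr r∤b)) (prime≥1 pr))
  where
  instance
    _ : NonZero r
    _ = prime⇒nonZero pr
  root : ∀ r → Bézout.Identity 1 r b → 1 ≤ r → ∃[ c ] (r ∣ a + b * c)
  root r (Bézout.+- x y eq) _ = y * a , divides (a * x) (trans (e₁ a b y) (trans (cong (a *_) eq) (sym (ℕₚ.*-assoc a x r))))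
    where
    e₁ : ∀ a b y → a + b * (y * a) ≡ a * (1 + y * b)
    e₁ = solve-∀
  -- Now y b = 1 + x r, so c should be y times -a; in ℕ the factor r' = r - 1 plays the part of -1.
  root (suc r') (Bézout.-+ x y eq) _ = y * (r' * a) , divides (a + x * (r' * a))
      (trans (e₁ a b y (r' * a)) (trans (cong (λ n → a + n * (r' * a)) (sym eq)) (e₂ a x r')))
    where
    e₁ : ∀ a b y w → a + b * (y * w) ≡ a + (y * b) * w
    e₁ = solve-∀
    e₂ : ∀ a x r' → a + (1 + x * suc r') * (r' * a) ≡ (a + x * (r' * a)) * suc r'
    e₂ = solve-∀
  reduce : ∃[ c ] (r ∣ a + b * c) → ∃[ c ] (c < r × r ∣ a + b * c)
  reduce (c , d) = c % r , m%n<n c r , ∣m+n∣m⇒∣n (subst (r ∣_) e d) (n∣m*n (b * (c / r)))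
    where
    e₁ : ∀ a b x q r → a + b * (x + q * r) ≡ b * q * r + (a + b * x)
    e₁ = solve-∀
    e : a + b * c ≡ b * (c / r) * r + (a + b * (c % r))
    e = trans (cong (λ c → a + b * c) (m≡m%n+[m/n]*n c r)) (e₁ a b (c % r) (c / r) r)

root-unique-≤ : ∀ {r b} → Prime r → ¬ r ∣ b → ∀ a {c d} → c ≤ d → d < r → r ∣ a + b * c → r ∣ a + b * d → c ≡ d
root-unique-≤ {r} {b} pr r∤b a {c} {d} c≤d d<r rc rd with d ∸ c in eq
... | zero = ℕₚ.≤-antisym c≤d (ℕₚ.m∸n≡0⇒m≤n eq)
... | suc k with euclidsLemma b (suc k) pr (∣m+n∣m⇒∣n (subst (r ∣_) e rd) rc)
  where
  e₁ : ∀ a b c k → a + b * (c + k) ≡ a + b * c + b * k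
  e₁ = solve-∀
  e : a + b * d ≡ a + b * c + b * suc k
  e = trans (cong (λ d → a + b * d) (sym (trans (cong (c +_) (sym eq)) (ℕₚ.m+[n∸m]≡n c≤d)))) (e₁ a b c (suc k))
...  | inj₁ r∣b = ⊥-elim (r∤b r∣b)
...  | inj₂ r∣ = ⊥-elim (ℕₚ.<⇒≱ d<r (ℕₚ.≤-trans (∣⇒≤ r∣) (subst (_≤ d) eq (ℕₚ.m∸n≤m d c))))

root-unique : ∀ {r b} → Prime r → ¬ r ∣ b → ∀ a {c d} → c < r → d < r → r ∣ a + b * c → r ∣ a + b * d → c ≡ d
root-unique pr r∤b a {c} {d} c<r d<r rc rd with ℕₚ.≤-total c d
... | inj₁ c≤d = root-unique-≤ pr r∤b a c≤d d<r rc rd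
... | inj₂ d≤c = sym (root-unique-≤ pr r∤b a d≤c c<r rd rc)

root-count : ∀ {r b} → Prime r → ¬ r ∣ b → ∀ a → Σ< r (λ c → ind (r ∣? (a + b * c))) ≡ ι 1
root-count {r} {b} pr r∤b a = exactly-one (root-exists pr r∤b a)
  where
  f : ℕ → Q
  f c = ind (r ∣? (a + b * c))
  only : ∀ {c} → c < r → r ∣ a + b * c → ∀ d → d < r → Dec (d ≡ c) → (d ≡ c × f d ≼ ι 1) ⊎ f d ≼ ι 0
  only c<r rc d d<r (yes e) = inj₁ (e , ind≼1 (r ∣? (a + b * d)))
  only c<r rc d d<r (no ne) = inj₂ (≼-reflexive (ind-no (r ∣? (a + b * d)) (λ rd → ne (root-unique pr r∤b a d<r c<r rd rc))))
  exactly-one : ∃[ c ] (c < r × r ∣ a + b * c) → Σ< r f ≡ ι 1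
  exactly-one (c , c<r , rc) = ≼-antisym
    (Σ-single r f c (ι 1) (ι-nonneg 1) (λ d d<r → only c<r rc d d<r (d ℕ.≟ c)))
    (≼-trans (≼-reflexive (sym (ind-yes (r ∣? (a + b * c)) rc))) (Σ-at r f c c<r (λ i _ → ind-nonneg (r ∣? (a + b * i)))))

ind-⊎ : ∀ {P R : Set} (d : Dec P) (e : Dec R) → ¬ (P × R) → ind (d ⊎-dec e) ≡ ind d ⊕ ind e
ind-⊎ (yes p) (yes q) h = ⊥-elim (h (p , q))
ind-⊎ (yes _) (no _) h = sym (⊕-idʳ (ι 1))
ind-⊎ (no _) (yes _) h = sym (⊕-idˡ (ι 1))
ind-⊎ (no _) (no _) h = sym (⊕-idˡ (ι 0))

ind-cong : ∀ {P R : Set} (d : Dec P) (e : Dec R) → (P → R) → (R → P) → ind d ≡ ind e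
ind-cong d e f g = ≼-antisym (ind-mono d e f) (ind-mono e d g)

-- With y = y' = z² the fourth power contributes z^16, and z + 1 ≤ z² the remaining two factors z.
errorBound≤ : ∀ z → 2 ≤ z → errorBound z (z * z) (z * z) ≤ z ^ 18
errorBound≤ z 2≤z = begin
  suc z * (z * z * (z * z)) ^ 4  ≤⟨ ℕₚ.*-monoˡ-≤ ((z * z * (z * z)) ^ 4) z+1≤ ⟩
  z * z * (z * z * (z * z)) ^ 4  ≡⟨ cong₂ _*_ (sq z) (cong (_^ 4) (quad z)) ⟩
  z ^ 2 * (z ^ 4) ^ 4  ≡⟨ cong (z ^ 2 *_) (ℕₚ.^-*-assoc z 4 4) ⟩
  z ^ 2 * z ^ 16  ≡⟨ ℕₚ.^-distribˡ-+-* z 2 16 ⟨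
  z ^ 18  ∎
  where
  open ℕₚ.≤-Reasoning
  sq : ∀ z → z * z ≡ z * (z * 1)
  sq = solve-∀
  quad : ∀ z → z * z * (z * z) ≡ z * (z * (z * (z * 1)))
  quad = solve-∀
  z+1≤ : suc z ≤ z * z
  z+1≤ = ℕₚ.≤-trans (ℕₚ.+-monoˡ-≤ z (ℕₚ.<⇒≤ 2≤z)) (ℕₚ.≤-trans (ℕₚ.+-monoʳ-≤ z (ℕₚ.m≤m+n z 0)) (ℕₚ.*-monoˡ-≤ z 2≤z))

opaque
  errorBound-2^ : ∀ ℓ → 1 ≤ ℓ → let z = 2 ^ ℓ in errorBound z (z * z) (z * z) ≤ 2 ^ (18 * ℓ)
  errorBound-2^ ℓ 1≤ℓ = subst (errorBound (2 ^ ℓ) (2 ^ ℓ * 2 ^ ℓ) (2 ^ ℓ * 2 ^ ℓ) ≤_)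
    (trans (ℕₚ.^-*-assoc 2 ℓ 18) (cong (2 ^_) (ℕₚ.*-comm ℓ 18))) (errorBound≤ (2 ^ ℓ) (ℕₚ.^-monoʳ-≤ 2 1≤ℓ))

-- Modulo a prime outside H both leading coefficients are invertible and the forms have no common
-- zero. Hence exactly two classes of t are bad, as the weight 2/(r - 2) presupposes.
module LinearForms (H : ℕ) (6∣H : 6 ∣ H) (α β α' β' : ℕ)
  (admissible : ∀ r → Prime r → ¬ r ∣ H → ¬ r ∣ β × ¬ r ∣ β' × (∀ t → r ∣ α + β * t → ¬ r ∣ α' + β' * t)) where
  open Sieve H 6∣H
  open SieveMainTerm H 6∣H

  Bad : ℕ → ℕ → Set
  Bad r t = r ∣ α + β * t ⊎ r ∣ α' + β' * t

  Bad? : ∀ r t → Dec (Bad r t)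
  Bad? r t = r ∣? (α + β * t) ⊎-dec r ∣? (α' + β' * t)

  shift : ∀ a b r t x → a + b * (t + r * x) ≡ b * x * r + (a + b * t)
  shift = solve-∀

  bad-period : ∀ {r} → Sv r → ∀ t x → ind (Bad? r (t + r * x)) ≡ ind (Bad? r t)
  bad-period {r} _ t x = ind-cong (Bad? r (t + r * x)) (Bad? r t) to from
    where
    to : Bad r (t + r * x) → Bad r t
    to (inj₁ d) = inj₁ (∣m+n∣m⇒∣n (subst (r ∣_) (shift α β r t x) d) (n∣m*n (β * x)))
    to (inj₂ d) = inj₂ (∣m+n∣m⇒∣n (subst (r ∣_) (shift α' β' r t x) d) (n∣m*n (β' * x)))
    from : Bad r t → Bad r (t + r * x)
    from (inj₁ d) = inj₁ (subst (r ∣_) (sym (shift α β r t x)) (∣m∣n⇒∣m+n (n∣m*n (β * x)) d))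
    from (inj₂ d) = inj₂ (subst (r ∣_) (sym (shift α' β' r t x)) (∣m∣n⇒∣m+n (n∣m*n (β' * x)) d))

  bad-count : ∀ {r} → Sv r → ∀ a b → ¬ r ∣ b → Σ< r (λ c → ind (Bad? r (a + b * c))) ≡ ι 2
  bad-count {r} (pr , r∤H) a b r∤b with admissible r pr r∤H
  ... | r∤β , r∤β' , disjoint = begin
    Σ< r (λ c → ind (Bad? r (a + b * c)))
      ≡⟨ Σ-cong r (λ c _ → ind-⊎ (r ∣? (α + β * (a + b * c))) (r ∣? (α' + β' * (a + b * c))) (λ (d , d') → disjoint (a + b * c) d d')) ⟩
    Σ< r (λ c → ind (r ∣? (α + β * (a + b * c))) ⊕ ind (r ∣? (α' + β' * (a + b * c))))
      ≡⟨ Σ-⊕ r _ _ ⟩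
    Σ< r (λ c → ind (r ∣? (α + β * (a + b * c)))) ⊕ Σ< r (λ c → ind (r ∣? (α' + β' * (a + b * c))))
      ≡⟨ cong₂ _⊕_ (one α β r∤β) (one α' β' r∤β') ⟩
    ι 1 ⊕ ι 1
      ≡⟨ ι-+ 1 1 ⟨
    ι 2 ∎
    where
    open ≡-Reasoning
    e : ∀ α β a b c → α + β * (a + b * c) ≡ (α + β * a) + β * b * c
    e = solve-∀
    one : ∀ α β → ¬ r ∣ β → Σ< r (λ c → ind (r ∣? (α + β * (a + b * c)))) ≡ ι 1
    one α β r∤β = trans (Σ-cong r (λ c _ → cong (λ n → ind (r ∣? n)) (e α β a b c))) (root-count pr r∤βb (α + β * a))
      where
      r∤βb : ¬ r ∣ β * b
      r∤βb d with euclidsLemma β b pr d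
      ... | inj₁ d' = r∤β d'
      ... | inj₂ d' = r∤b d'

  -- With z = 2^ℓ and y = z² one has G(z, z²) ≥ G₁(z, z)², and G₁(z, z) is at least U(z, z)/S ≥
  -- ℓ/(2S). So 1/G is at most 4 S²/ℓ². As G ≥ 1, the error term can be divided by G as well.
  sieve-bound : ∀ ℓ → 1 ≤ ℓ → ∀ T (f : ℕ → Q) → (∀ t → t < T → ι 0 ≼ f t) →
    (∀ t → t < T → f t ≼ ι 0 ⊎ (f t ≼ ι 1 × (∀ r → r ≤ 2 ^ ℓ → Prime r → ¬ r ∣ α + β * t × ¬ r ∣ α' + β' * t))) →
    Σ< T f ⊗ ι (ℓ * ℓ) ≼ ι 4 ⊗ (ι T ⊕ ι (2 ^ (18 * ℓ))) ⊗ (S H (2 ^ ℓ) ⊗ S H (2 ^ ℓ))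
  sieve-bound ℓ 1≤ℓ T f 0≼f hf = begin
    N ⊗ ι (ℓ * ℓ)  ≡⟨ cong (N ⊗_) (ι-* ℓ ℓ) ⟩
    N ⊗ (ι ℓ ⊗ ι ℓ)  ≲⟨ ⊗-monoˡ 0≼N (⊗-mono (ι-nonneg ℓ) (ι-nonneg ℓ) ℓ≼ ℓ≼) ⟩
    N ⊗ ((ι 2 ⊗ (s ⊗ g₁')) ⊗ (ι 2 ⊗ (s ⊗ g₁'))) ≡⟨ solve 3 (λ n s g → n :* ((# 2 :* (s :* g)) :* (# 2 :* (s :* g))) := (# 4 :* (s :* s)) :* (n :* (g :* g))) refl N s g₁' ⟩
    (ι 4 ⊗ (s ⊗ s)) ⊗ (N ⊗ (g₁' ⊗ g₁'))  ≲⟨ ⊗-monoˡ (⊗-nonneg (ι-nonneg 4) (sq-nonneg s)) (⊗-monoˡ 0≼N (G₁⊗G₁≼G z z z)) ⟩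
    (ι 4 ⊗ (s ⊗ s)) ⊗ (N ⊗ G z (z * z))  ≲⟨ ⊗-monoˡ (⊗-nonneg (ι-nonneg 4) (sq-nonneg s)) NG≼ ⟩
    (ι 4 ⊗ (s ⊗ s)) ⊗ (ι T ⊕ D)  ≡⟨ solve 3 (λ a b c → (a :* b) :* c := a :* c :* b) refl (ι 4) (s ⊗ s) (ι T ⊕ D) ⟩
    ι 4 ⊗ (ι T ⊕ D) ⊗ (s ⊗ s)  ∎
    where
    open ≼-Reasoning
    z : ℕ
    z = 2 ^ ℓ
    N s g₁' D g' : Q
    N = Σ< T f
    s = S H z
    g₁' = G₁ z z
    g' = G z (z * z)
    D = ι (2 ^ (18 * ℓ))
    0≼N : ι 0 ≼ N
    0≼N = Σ-nonneg T 0≼f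
    ℓ≼ : ι ℓ ≼ ι 2 ⊗ (s ⊗ g₁')
    ℓ≼ = ≼-trans (U-full ℓ) (⊗-monoˡ (ι-nonneg 2) (U≼S⊗G₁ z z))
    hf' : ∀ t → t < T → f t ≼ ι 0 ⊎ (f t ≼ ι 1 × (∀ r → r ≤ z → Sv r → ¬ Bad r t))
    hf' t t<T with hf t t<T
    ... | inj₁ p = inj₁ p
    ... | inj₂ (p , good) = inj₂ (p , λ r r≤z (pr , _) → λ { (inj₁ d) → proj₁ (good r r≤z pr) d ; (inj₂ d) → proj₂ (good r r≤z pr) d })
    1≼g' : ι 1 ≼ g'
    1≼g' = 1≼G z (ℕₚ.*-mono-≤ (2^n≥1 ℓ) (2^n≥1 ℓ))
    NG≼ : N ⊗ g' ≼ ι T ⊕ D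
    NG≼ = ⊗-cancel 1≼g' (begin
      g' ⊗ (N ⊗ g')  ≡⟨ solve 2 (λ n g → g :* (n :* g) := n :* (g :* g)) refl N g' ⟩
      N ⊗ (g' ⊗ g')  ≲⟨ sieve-quadratic Bad? bad-period bad-count z (z * z) T f hf' ⟩
      ι T ⊗ g' ⊕ ι (errorBound z (z * z) (z * z)) ≲⟨ ⊕-mono ≼-refl (ι-mono (errorBound-2^ ℓ 1≤ℓ)) ⟩
      ι T ⊗ g' ⊕ D  ≡⟨ cong (ι T ⊗ g' ⊕_) (⊗-idˡ D) ⟨
      ι T ⊗ g' ⊕ ι 1 ⊗ D  ≲⟨ ⊕-mono ≼-refl (⊗-monoʳ (ι-nonneg _) 1≼g') ⟩
      ι T ⊗ g' ⊕ g' ⊗ D  ≡⟨ solve 3 (λ t g d → t :* g :+ g :* d := g :* (t :+ d)) refl (ι T) g' D ⟩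
      g' ⊗ (ι T ⊕ D)  ∎)

-- The average of the local factors of k(2^k - 1)

ind-or : ∀ {P R T : Set} (d : Dec P) (e : Dec R) (f : Dec T) → (P → R ⊎ T) → ind d ≼ ind e ⊕ ind f
ind-or (no _) e f h = ⊕-nonneg (ind-nonneg e) (ind-nonneg f)
ind-or (yes p) e f h with h p
... | inj₁ r = ≼-by (ind f) (ind-nonneg f) (cong (_⊕ ind f) (sym (ind-yes e r)))
... | inj₂ t = ≼-by (ind e) (ind-nonneg e) (trans (⊕-comm _ _) (cong (ind e ⊕_) (sym (ind-yes f t))))

S-mono : ∀ K {z z'} → z ≤ z' → S K z ≼ S K z'
S-mono K {z} z≤z' = go (ℕₚ.≤⇒≤′ z≤z')
  where
  go : ∀ {z'} → z ℕ.≤′ z' → S K z ≼ S K z'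
  go (ℕ.≤′-reflexive refl) = ≼-refl
  go (ℕ.≤′-step {n = n} h) = ≼-trans (go h) (≼-trans (≼-reflexive (sym (⊗-idʳ _))) (⊗-monoˡ (0≼S K n) (1≼σ K (suc n))))

S-∣ : ∀ {K K'} → K ∣ K' → ∀ z → S K z ≼ S K' z
S-∣ d zero = ≼-refl
S-∣ {K} {K'} d (suc z) = ⊗-mono (0≼S K z) (0≼σ K (suc z)) (S-∣ d z)
  (⊕-mono ≼-refl (⊗-monoʳ (inv-nonneg z) (ind-mono (prime? (suc z) ×-dec suc z ∣? K) (prime? (suc z) ×-dec suc z ∣? K') (λ (p , q) → p , ∣-trans q d))))

S-* : ∀ K K' z → S (K * K') z ≼ S K z ⊗ S K' z
S-* K K' zero = ≼-reflexive (sym (⊗-idˡ (ι 1)))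
S-* K K' (suc z) = begin
  S (K * K') z ⊗ (ι 1 ⊕ i ⊗ inv z)  ≲⟨ ⊗-mono (0≼S (K * K') z) (0≼σ (K * K') (suc z)) (S-* K K' z) local ⟩
  S K z ⊗ S K' z ⊗ (σ K (suc z) ⊗ σ K' (suc z)) ≡⟨ solve 4 (λ a b c d → a :* b :* (c :* d) := a :* c :* (b :* d)) refl (S K z) (S K' z) (σ K (suc z)) (σ K' (suc z)) ⟩
  S K (suc z) ⊗ S K' (suc z)  ∎
  where
  open ≼-Reasoning
  i j j' : Q
  i = ind (prime? (suc z) ×-dec suc z ∣? (K * K'))
  j = ind (prime? (suc z) ×-dec suc z ∣? K)
  j' = ind (prime? (suc z) ×-dec suc z ∣? K')
  i≼ : i ≼ j ⊕ j'
  i≼ = ind-or (prime? (suc z) ×-dec suc z ∣? (K * K')) (prime? (suc z) ×-dec suc z ∣? K) (prime? (suc z) ×-dec suc z ∣? K')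
    (λ (p , d) → case euclidsLemma K K' p d of λ { (inj₁ x) → inj₁ (p , x) ; (inj₂ x) → inj₂ (p , x) })
  local : ι 1 ⊕ i ⊗ inv z ≼ σ K (suc z) ⊗ σ K' (suc z)
  local = begin
    ι 1 ⊕ i ⊗ inv z  ≲⟨ ⊕-mono ≼-refl (⊗-monoʳ (inv-nonneg z) i≼) ⟩
    ι 1 ⊕ (j ⊕ j') ⊗ inv z  ≲⟨ ≼-by ((j ⊗ inv z) ⊗ (j' ⊗ inv z))
        (⊗-nonneg (⊗-nonneg (ind-nonneg (prime? (suc z) ×-dec suc z ∣? K)) (inv-nonneg z)) (⊗-nonneg (ind-nonneg (prime? (suc z) ×-dec suc z ∣? K')) (inv-nonneg z)))
        (solve 3 (λ a b v → # 1 :+ (a :+ b) :* v :+ (a :* v) :* (b :* v) := (# 1 :+ a :* v) :* (# 1 :+ b :* v)) refl j j' (inv z)) ⟩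
    (ι 1 ⊕ j ⊗ inv z) ⊗ (ι 1 ⊕ j' ⊗ inv z) ∎

-- Only the factor at q itself differs from 1, and 1 + 1/(q - 1) ≤ 2.
S-prime : ∀ {q} → Prime q → ∀ z → S q z ≼ ι 2
S-prime {q} pq z = ≼-trans (go z) (bound (q ℕ.≤? z))
  where
  bound : ∀ {P : Set} (d : Dec P) → ι 1 ⊕ ind d ≼ ι 2
  bound d = ≼-trans (⊕-mono ≼-refl (ind≼1 d)) (≼-reflexive (sym (ι-+ 1 1)))
  go : ∀ z → S q z ≼ ι 1 ⊕ ind (q ℕ.≤? z)
  go zero = ≼-by _ (ind-nonneg (q ℕ.≤? 0)) refl
  go (suc z) = step (suc z ℕ.≟ q)
    where
    open ≼-Reasoning
    step : Dec (suc z ≡ q) → S q (suc z) ≼ ι 1 ⊕ ind (q ℕ.≤? suc z)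
    step (no ne) = begin
      S q z ⊗ (ι 1 ⊕ ind (prime? (suc z) ×-dec suc z ∣? q) ⊗ inv z) ≡⟨ cong (λ x → S q z ⊗ (ι 1 ⊕ x ⊗ inv z)) (ind-no (prime? (suc z) ×-dec suc z ∣? q) (λ (p , d) → ne (prime∣prime p pq d))) ⟩
      S q z ⊗ (ι 1 ⊕ ι 0 ⊗ inv z) ≡⟨ solve 2 (λ s v → s :* (# 1 :+ # 0 :* v) := s) refl (S q z) (inv z) ⟩
      S q z ≲⟨ go z ⟩
      ι 1 ⊕ ind (q ℕ.≤? z) ≲⟨ ⊕-mono ≼-refl (ind-mono (q ℕ.≤? z) (q ℕ.≤? suc z) ℕₚ.m≤n⇒m≤1+n) ⟩
      ι 1 ⊕ ind (q ℕ.≤? suc z) ∎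
    step (yes refl) = begin
      S q z ⊗ (ι 1 ⊕ ind (prime? (suc z) ×-dec suc z ∣? q) ⊗ inv z)
        ≲⟨ ⊗-mono (0≼S q z) (0≼σ q (suc z)) (≼-trans (go z) (≼-reflexive (trans (cong (ι 1 ⊕_) (ind-no (q ℕ.≤? z) ℕₚ.1+n≰n)) (⊕-idʳ (ι 1)))))
             (⊕-mono ≼-refl (⊗-mono (ind-nonneg (prime? (suc z) ×-dec suc z ∣? q)) (inv-nonneg z) (ind≼1 (prime? (suc z) ×-dec suc z ∣? q)) (inv≼1 (ℕ.s≤s⁻¹ (prime≥2 pq))))) ⟩
      ι 1 ⊗ (ι 1 ⊕ ι 1 ⊗ ι 1) ≡⟨ solve 0 (# 1 :* (# 1 :+ # 1 :* # 1) := # 1 :+ # 1) refl ⟩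
      ι 1 ⊕ ι 1 ≡⟨ cong (ι 1 ⊕_) (ind-yes (q ℕ.≤? suc z) ℕₚ.≤-refl) ⟨
      ι 1 ⊕ ind (q ℕ.≤? suc z) ∎

-- Collects the primes of both sieves: those of k from pairs of exponents with difference k, those
-- of 2^k - 1 from pairs of cofactors.
K : ℕ → ℕ
K k = k * (2 ^ k ∸ 1)

-- An upper bound for the excess over 1 of the fourth power of r/(r - 1), from (1 + x)^4 ≤ 1 + 15 x
-- on [0, 1].
ω : ℕ → Q
ω r = ind (prime? r) ⊗ (ι 15 ⊗ inv (r ∸ 1))

0≼ω : ∀ r → ι 0 ≼ ω r
0≼ω r = ⊗-nonneg (ind-nonneg (prime? r)) (⊗-nonneg (ι-nonneg 15) (inv-nonneg (r ∸ 1)))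

-- A bound for `Φ` valid for every k. It grows like a power of log z, so it is affordable only
-- against a saving in the number of k.
β : ℕ → Q
β zero = ι 1
β (suc z) = β z ⊗ (ι 1 ⊕ ω (suc z))

0≼1⊕ω : ∀ r → ι 0 ≼ ι 1 ⊕ ω r
0≼1⊕ω r = ⊕-nonneg (ι-nonneg 1) (0≼ω r)

0≼β : ∀ z → ι 0 ≼ β z
0≼β zero = ι-nonneg 1
0≼β (suc z) = ⊗-nonneg (0≼β z) (0≼1⊕ω (suc z))

β-suc : ∀ z → β z ≼ β (suc z)
β-suc z = ≼-by (β z ⊗ ω (suc z)) (⊗-nonneg (0≼β z) (0≼ω (suc z))) (solve 2 (λ b w → b :+ b :* w := b :* (# 1 :+ w)) refl (β z) (ω (suc z)))

-- Each of the two sieves contributes the square of a local factor, hence fourth powers.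
pow4 : Q → Q
pow4 x = x ⊗ x ⊗ (x ⊗ x)

pow4-mono : ∀ {x y} → ι 0 ≼ x → x ≼ y → pow4 x ≼ pow4 y
pow4-mono 0≼x x≼y = ⊗-mono (⊗-nonneg 0≼x 0≼x) (⊗-nonneg 0≼x 0≼x) (⊗-mono 0≼x 0≼x x≼y x≼y) (⊗-mono 0≼x 0≼x x≼y x≼y)

pow4-⊗ : ∀ x y → pow4 (x ⊗ y) ≡ pow4 x ⊗ pow4 y
pow4-⊗ = solve 2 (λ x y → x :* y :* (x :* y) :* (x :* y :* (x :* y)) := x :* x :* (x :* x) :* (y :* y :* (y :* y))) refl

pow4-1+ : ∀ x → ι 0 ≼ x → x ≼ ι 1 → pow4 (ι 1 ⊕ x) ≼ ι 1 ⊕ ι 15 ⊗ x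
pow4-1+ x 0≼x x≼1 = ≼-by (x ⊗ (ι 1 ⊖ x) ⊗ (ι 11 ⊕ ι 5 ⊗ x ⊕ x ⊗ x))
  (⊗-nonneg (⊗-nonneg 0≼x (⊖-nonneg x≼1)) (⊕-nonneg (⊕-nonneg (ι-nonneg 11) (⊗-nonneg (ι-nonneg 5) 0≼x)) (sq-nonneg x)))
  (solve 1 (λ x → (# 1 :+ x) :* (# 1 :+ x) :* ((# 1 :+ x) :* (# 1 :+ x)) :+ x :* (# 1 :- x) :* (# 11 :+ # 5 :* x :+ x :* x) := # 1 :+ # 15 :* x) refl x)

σ⁴ : ∀ k r → 1 ≤ r → pow4 (σ k (suc r)) ≼ ι 1 ⊕ ω (suc r) ⊗ ind (suc r ∣? k)
σ⁴ k r 1≤r = go (prime? (suc r)) (suc r ∣? k)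
  where
  open ≼-Reasoning
  go : ∀ {P R : Set} (d : Dec P) (e : Dec R) → pow4 (ι 1 ⊕ ind (d ×-dec e) ⊗ inv r) ≼ ι 1 ⊕ (ind d ⊗ (ι 15 ⊗ inv r)) ⊗ ind e
  go (yes _) (yes _) = ≼-trans (≼-reflexive (cong (λ x → pow4 (ι 1 ⊕ x)) (⊗-idˡ (inv r)))) (≼-trans (pow4-1+ (inv r) (inv-nonneg r) (inv≼1 1≤r))
    (≼-reflexive (solve 1 (λ v → # 1 :+ # 15 :* v := # 1 :+ (# 1 :* (# 15 :* v)) :* # 1) refl (inv r))))
  go (yes _) (no _) = ≼-reflexive (solve 1 (λ v → (# 1 :+ # 0 :* v) :* (# 1 :+ # 0 :* v) :* ((# 1 :+ # 0 :* v) :* (# 1 :+ # 0 :* v)) := # 1 :+ (# 1 :* (# 15 :* v)) :* # 0) refl (inv r))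
  go (no _) e = ≼-reflexive (solve 2 (λ v i → (# 1 :+ # 0 :* v) :* (# 1 :+ # 0 :* v) :* ((# 1 :+ # 0 :* v) :* (# 1 :+ # 0 :* v)) := # 1 :+ (# 0 :* (# 15 :* v)) :* i) refl (inv r) (ind e))

σ⁴-0 : ∀ k → pow4 (σ k 1) ≼ ι 1 ⊕ ω 1 ⊗ ind (1 ∣? k)
σ⁴-0 k = ≼-trans (≼-reflexive (trans (cong (λ x → pow4 (ι 1 ⊕ x ⊗ inv 0)) (ind-no (prime? 1 ×-dec 1 ∣? k) (λ (p , _) → ¬prime[1] p)))
    (solve 1 (λ v → (# 1 :+ # 0 :* v) :* (# 1 :+ # 0 :* v) :* ((# 1 :+ # 0 :* v) :* (# 1 :+ # 0 :* v)) := # 1) refl (inv 0))))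
  (≼-by _ (⊗-nonneg (0≼ω 1) (ind-nonneg (1 ∣? k))) refl)

σ⁴≼ : ∀ k z → pow4 (σ k (suc z)) ≼ ι 1 ⊕ ω (suc z) ⊗ ind (suc z ∣? k)
σ⁴≼ k zero = σ⁴-0 k
σ⁴≼ k (suc z) = σ⁴ k (suc z) (s≤s z≤n)

Φ : ℕ → ℕ → Q
Φ z k = pow4 (S (K k) z)

0≼pow4 : ∀ x → ι 0 ≼ pow4 x
0≼pow4 x = sq-nonneg (x ⊗ x)

Φ≼β : ∀ z k → Φ z k ≼ β z
Φ≼β zero k = ≼-reflexive (solve 0 (# 1 :* # 1 :* (# 1 :* # 1) := # 1) refl)
Φ≼β (suc z) k = begin
  pow4 (S (K k) z ⊗ σ (K k) (suc z))  ≡⟨ pow4-⊗ (S (K k) z) (σ (K k) (suc z)) ⟩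
  Φ z k ⊗ pow4 (σ (K k) (suc z))  ≲⟨ ⊗-mono (0≼pow4 _) (0≼pow4 _) (Φ≼β z k) (σ⁴≼ (K k) z) ⟩
  β z ⊗ (ι 1 ⊕ ω (suc z) ⊗ ind (suc z ∣? K k))  ≲⟨ ⊗-monoˡ (0≼β z) (⊕-mono ≼-refl (≼-trans (⊗-monoˡ (0≼ω (suc z)) (ind≼1 (suc z ∣? K k))) (≼-reflexive (⊗-idʳ _)))) ⟩
  β z ⊗ (ι 1 ⊕ ω (suc z))  ∎
  where open ≼-Reasoning

-- A new prime changes `Φ` only if it divides `K k`, and then the crude bound `β z` is spent. Summed
-- over k, this leaves the number of k that the prime hits.
Φ-suc : ∀ z k → Φ (suc z) k ≼ Φ z k ⊕ β z ⊗ (ω (suc z) ⊗ ind (suc z ∣? K k))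
Φ-suc z k = begin
  pow4 (S (K k) z ⊗ σ (K k) (suc z))  ≡⟨ pow4-⊗ (S (K k) z) (σ (K k) (suc z)) ⟩
  Φ z k ⊗ pow4 (σ (K k) (suc z))  ≲⟨ ⊗-monoˡ (0≼pow4 _) (σ⁴≼ (K k) z) ⟩
  Φ z k ⊗ (ι 1 ⊕ x)  ≡⟨ trans (⊗-distribˡ _ _ _) (cong (_⊕ Φ z k ⊗ x) (⊗-idʳ _)) ⟩
  Φ z k ⊕ Φ z k ⊗ x  ≲⟨ ⊕-mono ≼-refl (⊗-monoʳ (⊗-nonneg (0≼ω (suc z)) (ind-nonneg (suc z ∣? K k))) (Φ≼β z k)) ⟩
  Φ z k ⊕ β z ⊗ x  ∎
  where
  open ≼-Reasoning
  x : Q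
  x = ω (suc z) ⊗ ind (suc z ∣? K k)

-- Two elements of P differ by more than E.
module _ {P : ℕ → Set} (P? : ∀ n → Dec (P n)) (E : ℕ)
  (diff : ∀ k d → P k → P (k + d) → P d) (avoid : ∀ k → 1 ≤ k → k ≤ E → ¬ P k) where

  sparse-last : ∀ n → ∃[ l ] (l ≤ n × (l ≡ 0 ⊎ P l) × ι E ⊗ Σ< n (λ k → ind (P? (suc k))) ≼ ι l)
  sparse-last zero = 0 , z≤n , inj₁ refl , ≼-reflexive (⊗-zeroʳ (ι E))
  sparse-last (suc n) = step (P? (suc n)) (sparse-last n)
    where
    Σn : Q
    Σn = Σ< n (λ k → ind (P? (suc k)))
    step : (d : Dec (P (suc n))) → ∃[ l ] (l ≤ n × (l ≡ 0 ⊎ P l) × ι E ⊗ Σn ≼ ι l) →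
      ∃[ l ] (l ≤ suc n × (l ≡ 0 ⊎ P l) × ι E ⊗ (Σn ⊕ ind d) ≼ ι l)
    step (no _) (l , l≤n , Pl , le) = l , ℕₚ.m≤n⇒m≤1+n l≤n , Pl , ≼-trans (≼-reflexive (cong (ι E ⊗_) (⊕-idʳ Σn))) le
    step (yes p) (l , l≤n , Pl , le) = suc n , ℕₚ.≤-refl , inj₂ p , (begin
      ι E ⊗ (Σn ⊕ ι 1)  ≡⟨ trans (⊗-distribˡ _ _ _) (cong (ι E ⊗ Σn ⊕_) (⊗-idʳ _)) ⟩
      ι E ⊗ Σn ⊕ ι E  ≲⟨ ⊕-mono le (ι-mono (gap Pl)) ⟩
      ι l ⊕ ι d  ≡⟨ ι-+ l d ⟨
      ι (l + d)  ≡⟨ cong ι l+d ⟩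
      ι (suc n)  ∎)
      where
      open ≼-Reasoning
      d : ℕ
      d = suc n ∸ l
      l+d : l + d ≡ suc n
      l+d = ℕₚ.m+[n∸m]≡n (ℕₚ.m≤n⇒m≤1+n l≤n)
      Pd : l ≡ 0 ⊎ P l → P d
      Pd (inj₁ refl) = p
      Pd (inj₂ Pl) = diff l d Pl (subst P (sym l+d) p)
      gap : l ≡ 0 ⊎ P l → E ≤ d
      gap q with d ℕ.≤? E
      ... | no d≰E = ℕₚ.<⇒≤ (ℕₚ.≰⇒> d≰E)
      ... | yes d≤E = ⊥-elim (avoid d (ℕₚ.m<n⇒0<n∸m (s≤s l≤n)) d≤E (Pd q))

  sparse : ∀ n → ι E ⊗ Σ< n (λ k → ind (P? (suc k))) ≼ ι n
  sparse n with sparse-last n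
  ... | l , l≤n , _ , le = ≼-trans le (ι-mono l≤n)

-- From 2^(k+d) - 1 = (2^k - 1) + 2^k (2^d - 1), where r cannot divide 2^k since it divides 2^k - 1.
∣2^-1-diff : ∀ {r} → Prime r → ∀ k d → r ∣ 2 ^ k ∸ 1 → r ∣ 2 ^ (k + d) ∸ 1 → r ∣ 2 ^ d ∸ 1
∣2^-1-diff {r} pr k d rk rkd = case euclidsLemma (2 ^ k) (2 ^ d ∸ 1) pr (∣m+n∣m⇒∣n (subst (r ∣_) e rkd) rk) of λ
  { (inj₂ x) → x
  ; (inj₁ x) → ⊥-elim (prime∤1 pr (∣m+n∣m⇒∣n (subst (r ∣_) (sym (ℕₚ.m∸n+n≡m (2^n≥1 k))) x) rk)) }
  where
  e : 2 ^ (k + d) ∸ 1 ≡ (2 ^ k ∸ 1) + 2 ^ k * (2 ^ d ∸ 1)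
  e = trans (cong (_∸ 1) (ℕₚ.^-distribˡ-+-* 2 k d)) (go (2 ^ k) (2 ^ d) (2^n≥1 k) (2^n≥1 d))
    where
    go : ∀ a b → 1 ≤ a → 1 ≤ b → a * b ∸ 1 ≡ (a ∸ 1) + a * (b ∸ 1)
    go (suc a) (suc b) _ _ = trans (cong (_∸ 1) (ℕₚ.*-suc (suc a) b)) refl

-- A prime that does not divide `ΠK E` hits no k with 1 ≤ k ≤ E, so its hits are sparse. The
-- exceptional primes are few, because `ΠK E` is at most 2^(E (E+1)).
ΠK : ℕ → ℕ
ΠK zero = 1
ΠK (suc E) = ΠK E * K (suc E)

∤ΠK : ∀ {r} E → ¬ r ∣ ΠK E → ∀ k → 1 ≤ k → k ≤ E → ¬ r ∣ K k
∤ΠK zero h k 1≤k k≤0 = ⊥-elim (ℕₚ.<⇒≱ 1≤k k≤0)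
∤ΠK {r} (suc E) h k 1≤k k≤ with k ℕ.≟ suc E
... | yes refl = λ d → h (∣n⇒∣m*n (ΠK E) d)
... | no ne = ∤ΠK E (λ d → h (∣m⇒∣m*n (K (suc E)) d)) k 1≤k (ℕ.s≤s⁻¹ (ℕₚ.≤∧≢⇒< k≤ ne))

2^-1≥1 : ∀ k → 1 ≤ k → 1 ≤ 2 ^ k ∸ 1
2^-1≥1 k 1≤k = ℕₚ.∸-monoˡ-≤ 1 (ℕₚ.^-monoʳ-≤ 2 1≤k)

ΠK≥1 : ∀ E → 1 ≤ ΠK E
ΠK≥1 zero = s≤s z≤n
ΠK≥1 (suc E) = ℕₚ.*-mono-≤ (ΠK≥1 E) (ℕₚ.*-mono-≤ {1} {suc E} (s≤s z≤n) (2^-1≥1 (suc E) (s≤s z≤n)))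

n<2^n : ∀ n → n < 2 ^ n
n<2^n zero = s≤s z≤n
n<2^n (suc n) = ℕₚ.+-mono-≤ (2^n≥1 n) (ℕₚ.≤-trans (n<2^n n) (ℕₚ.m≤m+n _ 0))

ΠK≤ : ∀ E → ΠK E ≤ 2 ^ (E * suc E)
ΠK≤ zero = s≤s z≤n
ΠK≤ (suc E) = begin
  ΠK E * (suc E * (2 ^ suc E ∸ 1))  ≤⟨ ℕₚ.*-mono-≤ (ΠK≤ E) (ℕₚ.*-mono-≤ (ℕₚ.<⇒≤ (n<2^n (suc E))) (ℕₚ.m∸n≤m (2 ^ suc E) 1)) ⟩
  2 ^ (E * suc E) * (2 ^ suc E * 2 ^ suc E)  ≡⟨ cong (2 ^ (E * suc E) *_) (ℕₚ.^-distribˡ-+-* 2 (suc E) (suc E)) ⟨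
  2 ^ (E * suc E) * 2 ^ (suc E + suc E)  ≡⟨ ℕₚ.^-distribˡ-+-* 2 (E * suc E) (suc E + suc E) ⟨
  2 ^ (E * suc E + (suc E + suc E))  ≡⟨ cong (2 ^_) (e E) ⟩
  2 ^ (suc E * suc (suc E))  ∎
  where
  open ℕₚ.≤-Reasoning
  e : ∀ E → E * suc E + (suc E + suc E) ≡ suc E * suc (suc E)
  e = solve-∀

hits : ℕ → ℕ → Q
hits M r = Σ< M (λ k → ind (r ∣? K (suc k)))

-- For an unexceptional r apply `sparse` to the k with r | k and to those with r | 2^k - 1, each
-- contributing M/E. For an exceptional r the trivial bound M is used.
hits≼ : ∀ M E {r} → 1 ≤ E → Prime r → hits M r ≼ ι M ⊗ (ind (r ∣? ΠK E) ⊕ ι 2 ⊗ inv E)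
hits≼ M E {r} 1≤E pr = go (r ∣? ΠK E)
  where
  open ≼-Reasoning
  0≼2/E : ι 0 ≼ ι 2 ⊗ inv E
  0≼2/E = ⊗-nonneg (ι-nonneg 2) (inv-nonneg E)
  go : (d : Dec (r ∣ ΠK E)) → hits M r ≼ ι M ⊗ (ind d ⊕ ι 2 ⊗ inv E)
  go (yes _) = begin
    hits M r  ≲⟨ Σ-mono M (λ k _ → ind≼1 (r ∣? K (suc k))) ⟩
    Σ< M (λ _ → ι 1)  ≡⟨ Σ-const M (ι 1) ⟩
    ι M ⊗ ι 1  ≲⟨ ⊗-monoˡ (ι-nonneg M) (≼-by _ 0≼2/E refl) ⟩
    ι M ⊗ (ι 1 ⊕ ι 2 ⊗ inv E)  ∎
  go (no r∤) = begin
    hits M r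
      ≲⟨ Σ-mono M (λ k _ → split k) ⟩
    Σ< M (λ k → ind (r ∣? suc k) ⊕ ind (r ∣? (2 ^ suc k ∸ 1)))
      ≡⟨ Σ-⊕ M _ _ ⟩
    Σ< M (λ k → ind (r ∣? suc k)) ⊕ Σ< M (λ k → ind (r ∣? (2 ^ suc k ∸ 1)))
      ≲⟨ ⊕-mono
          (≼⇒≼inv⊗ 1≤E (sparse (r ∣?_) E (λ k d rk rkd → ∣m+n∣m⇒∣n rkd rk) (λ k 1≤k k≤E d → ∤ΠK E r∤ k 1≤k k≤E (∣m⇒∣m*n (2 ^ k ∸ 1) d)) M))
          (≼⇒≼inv⊗ 1≤E (sparse (λ k → r ∣? (2 ^ k ∸ 1)) E (∣2^-1-diff pr) (λ k 1≤k k≤E d → ∤ΠK E r∤ k 1≤k k≤E (∣n⇒∣m*n k d)) M)) ⟩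
    inv E ⊗ ι M ⊕ inv E ⊗ ι M
      ≡⟨ solve 2 (λ i m → i :* m :+ i :* m := m :* (# 0 :+ # 2 :* i)) refl (inv E) (ι M) ⟩
    ι M ⊗ (ι 0 ⊕ ι 2 ⊗ inv E) ∎
    where
    split : ∀ k → ind (r ∣? K (suc k)) ≼ ind (r ∣? suc k) ⊕ ind (r ∣? (2 ^ suc k ∸ 1))
    split k = ind-or (r ∣? K (suc k)) (r ∣? suc k) (r ∣? (2 ^ suc k ∸ 1)) (euclidsLemma (suc k) (2 ^ suc k ∸ 1) pr)

ΣΦ : ℕ → ℕ → Q
ΣΦ M z = Σ< M (λ k → Φ z (suc k))

ΣΦ-suc : ∀ M z → ΣΦ M (suc z) ≼ ΣΦ M z ⊕ β z ⊗ (ω (suc z) ⊗ hits M (suc z))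
ΣΦ-suc M z = begin
  ΣΦ M (suc z)  ≲⟨ Σ-mono M (λ k _ → Φ-suc z (suc k)) ⟩
  Σ< M (λ k → Φ z (suc k) ⊕ β z ⊗ (ω (suc z) ⊗ ind (suc z ∣? K (suc k))))  ≡⟨ Σ-⊕ M _ _ ⟩
  ΣΦ M z ⊕ Σ< M (λ k → β z ⊗ (ω (suc z) ⊗ ind (suc z ∣? K (suc k))))  ≡⟨ cong (ΣΦ M z ⊕_) (trans (Σ-⊗ˡ M (β z) _) (cong (β z ⊗_) (Σ-⊗ˡ M (ω (suc z)) _))) ⟩
  ΣΦ M z ⊕ β z ⊗ (ω (suc z) ⊗ hits M (suc z))  ∎
  where open ≼-Reasoning

β-mono : ∀ {z z'} → z ≤ z' → β z ≼ β z'
β-mono {z} z≤z' = go (ℕₚ.≤⇒≤′ z≤z')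
  where
  go : ∀ {z'} → z ℕ.≤′ z' → β z ≼ β z'
  go (ℕ.≤′-reflexive refl) = ≼-refl
  go (ℕ.≤′-step {n = n} h) = ≼-trans (go h) (β-suc n)

0≼hits : ∀ M r → ι 0 ≼ hits M r
0≼hits M r = Σ-nonneg M (λ k _ → ind-nonneg (r ∣? K (suc k)))

ΣΦ-block : ∀ M Z n → ΣΦ M (Z + n) ≼ ΣΦ M Z ⊕ β (Z + n) ⊗ Σ< n (λ j → ω (suc Z + j) ⊗ hits M (suc Z + j))
ΣΦ-block M Z zero = ≼-trans (≼-reflexive (cong (ΣΦ M) (ℕₚ.+-identityʳ Z))) (≼-by _ (≼-reflexive (sym (⊗-zeroʳ _))) refl)
ΣΦ-block M Z (suc n) = begin
  ΣΦ M (Z + suc n)  ≡⟨ cong (ΣΦ M) (ℕₚ.+-suc Z n) ⟩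
  ΣΦ M (suc (Z + n))  ≲⟨ ΣΦ-suc M (Z + n) ⟩
  ΣΦ M (Z + n) ⊕ β (Z + n) ⊗ x  ≲⟨ ⊕-mono (ΣΦ-block M Z n) ≼-refl ⟩
  ΣΦ M Z ⊕ β (Z + n) ⊗ s ⊕ β (Z + n) ⊗ x  ≡⟨ solve 4 (λ a b s x → a :+ b :* s :+ b :* x := a :+ b :* (s :+ x)) refl (ΣΦ M Z) (β (Z + n)) s x ⟩
  ΣΦ M Z ⊕ β (Z + n) ⊗ (s ⊕ x)  ≲⟨ ⊕-mono ≼-refl (⊗-monoʳ (⊕-nonneg (Σ-nonneg n (λ j _ → 0≼x j)) (0≼x n)) (β-mono (ℕₚ.+-monoʳ-≤ Z (ℕₚ.n≤1+n n)))) ⟩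
  ΣΦ M Z ⊕ β (Z + suc n) ⊗ (s ⊕ x)  ∎
  where
  open ≼-Reasoning
  s x : Q
  s = Σ< n (λ j → ω (suc Z + j) ⊗ hits M (suc Z + j))
  x = ω (suc Z + n) ⊗ hits M (suc Z + n)
  0≼x : ∀ j → ι 0 ≼ ω (suc Z + j) ⊗ hits M (suc Z + j)
  0≼x j = ⊗-nonneg (0≼ω (suc Z + j)) (0≼hits M (suc Z + j))

prime-divisor? : ∀ X r → Dec (Prime r × r ∣ X)
prime-divisor? X r = prime? r ×-dec r ∣? X

cnt-ΠK : ∀ E n → cnt (prime-divisor? (ΠK E)) n ≤ E * suc E
cnt-ΠK E n = 2^-cancel-≤ (ℕₚ.≤-trans (cnt-prime-divisors (prime-divisor? (ΠK E)) n (ΠK≥1 E) (λ r _ (p , d) → p , d , prime≥2 p)) (ΠK≤ E))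

-- For r in (Z, 16 Z] the weight is at most 15/Z, where Z = E^4. The at most 2E² exceptional primes
-- contribute 30/E², and the 15 Z numbers of the block, each with 2/E, contribute 450/E; so 480/E
-- suffices.
block-hits : ∀ M E → 1 ≤ E → let Z = E * E * (E * E) in
  Σ< (15 * Z) (λ j → ω (suc Z + j) ⊗ hits M (suc Z + j)) ≼ ι M ⊗ (ι 480 ⊗ inv E)
block-hits M E 1≤E = begin
  Σ< (15 * Z) (λ j → ω (suc Z + j) ⊗ hits M (suc Z + j))
    ≲⟨ Σ-mono (15 * Z) (λ j _ → each j (prime? (suc Z + j))) ⟩
  Σ< (15 * Z) (λ j → c ⊗ (pd j ⊕ ι 2 ⊗ inv E))
    ≡⟨ trans (Σ-⊗ˡ (15 * Z) c _) (cong (c ⊗_) (trans (Σ-⊕ (15 * Z) pd _) (cong (Σ< (15 * Z) pd ⊕_) (Σ-const (15 * Z) _)))) ⟩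
  c ⊗ (Σ< (15 * Z) pd ⊕ ι (15 * Z) ⊗ (ι 2 ⊗ inv E))
    ≲⟨ ⊗-monoˡ 0≼c (⊕-mono few ≼-refl) ⟩
  c ⊗ (ι (2 * (E * E)) ⊕ ι (15 * Z) ⊗ (ι 2 ⊗ inv E))
    ≡⟨ cong₂ (λ x y → c ⊗ (x ⊕ y ⊗ (ι 2 ⊗ inv E))) (trans (ι-* 2 (E * E)) (cong (ι 2 ⊗_) (ι-* E E))) (trans (ι-* 15 Z) (cong (ι 15 ⊗_) ιZ)) ⟩
  c ⊗ (ι 2 ⊗ (e ⊗ e) ⊕ ι 15 ⊗ (e ⊗ e ⊗ (e ⊗ e)) ⊗ (ι 2 ⊗ inv E))
    ≡⟨ cong (λ x → ι M ⊗ (ι 15 ⊗ x) ⊗ (ι 2 ⊗ (e ⊗ e) ⊕ ι 15 ⊗ (e ⊗ e ⊗ (e ⊗ e)) ⊗ (ι 2 ⊗ inv E))) invZ ⟩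
  ι M ⊗ (ι 15 ⊗ (v ⊗ v ⊗ (v ⊗ v))) ⊗ (ι 2 ⊗ (e ⊗ e) ⊕ ι 15 ⊗ (e ⊗ e ⊗ (e ⊗ e)) ⊗ (ι 2 ⊗ v))
    ≡⟨ solve 3 (λ m e v → m :* (# 15 :* (v :* v :* (v :* v))) :* (# 2 :* (e :* e) :+ # 15 :* (e :* e :* (e :* e)) :* (# 2 :* v))
        := m :* (# 30 :* ((e :* v) :* (e :* v)) :* (v :* v) :+ # 450 :* ((e :* v) :* (e :* v) :* ((e :* v) :* (e :* v))) :* v)) refl (ι M) e v ⟩
  ι M ⊗ (ι 30 ⊗ ((e ⊗ v) ⊗ (e ⊗ v)) ⊗ (v ⊗ v) ⊕ ι 450 ⊗ ((e ⊗ v) ⊗ (e ⊗ v) ⊗ ((e ⊗ v) ⊗ (e ⊗ v))) ⊗ v)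
    ≡⟨ cong (λ x → ι M ⊗ (ι 30 ⊗ (x ⊗ x) ⊗ (v ⊗ v) ⊕ ι 450 ⊗ (x ⊗ x ⊗ (x ⊗ x)) ⊗ v)) (ι⊗inv 1≤E) ⟩
  ι M ⊗ (ι 30 ⊗ (ι 1 ⊗ ι 1) ⊗ (v ⊗ v) ⊕ ι 450 ⊗ (ι 1 ⊗ ι 1 ⊗ (ι 1 ⊗ ι 1)) ⊗ v)
    ≲⟨ ⊗-monoˡ (ι-nonneg M) (≼-by (ι 30 ⊗ (v ⊗ (ι 1 ⊖ v))) (⊗-nonneg (ι-nonneg 30) (⊗-nonneg (inv-nonneg E) (⊖-nonneg (inv≼1 1≤E))))
        (solve 1 (λ v → # 30 :* (# 1 :* # 1) :* (v :* v) :+ # 450 :* (# 1 :* # 1 :* (# 1 :* # 1)) :* v :+ # 30 :* (v :* (# 1 :- v)) := # 480 :* v) refl v)) ⟩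
  ι M ⊗ (ι 480 ⊗ v) ∎
  where
  open ≼-Reasoning
  Z : ℕ
  Z = E * E * (E * E)
  e v c : Q
  e = ι E
  v = inv E
  c = ι M ⊗ (ι 15 ⊗ inv Z)
  1≤EE : 1 ≤ E * E
  1≤EE = ℕₚ.*-mono-≤ 1≤E 1≤E
  1≤Z : 1 ≤ Z
  1≤Z = ℕₚ.*-mono-≤ 1≤EE 1≤EE
  0≼c : ι 0 ≼ c
  0≼c = ⊗-nonneg (ι-nonneg M) (⊗-nonneg (ι-nonneg 15) (inv-nonneg Z))
  ιZ : ι Z ≡ e ⊗ e ⊗ (e ⊗ e)
  ιZ = trans (ι-* (E * E) (E * E)) (cong₂ _⊗_ (ι-* E E) (ι-* E E))
  invZ : inv Z ≡ v ⊗ v ⊗ (v ⊗ v)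
  invZ = trans (inv-* 1≤EE 1≤EE) (cong₂ _⊗_ (inv-* 1≤E 1≤E) (inv-* 1≤E 1≤E))
  pd : ℕ → Q
  pd j = ind (prime-divisor? (ΠK E) (suc Z + j))
  each : ∀ j (d : Dec (Prime (suc Z + j))) → ind d ⊗ (ι 15 ⊗ inv (Z + j)) ⊗ hits M (suc Z + j) ≼ c ⊗ (ind (d ×-dec suc Z + j ∣? ΠK E) ⊕ ι 2 ⊗ inv E)
  each j d@(no _) = ≼-trans (≼-reflexive (solve 2 (λ x y → # 0 :* x :* y := # 0) refl (ι 15 ⊗ inv (Z + j)) (hits M (suc Z + j))))
    (⊗-nonneg 0≼c (⊕-nonneg (ind-nonneg (d ×-dec suc Z + j ∣? ΠK E)) (⊗-nonneg (ι-nonneg 2) (inv-nonneg E))))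
  each j (yes pr) = begin
    ι 1 ⊗ (ι 15 ⊗ inv (Z + j)) ⊗ hits M (suc Z + j)
      ≲⟨ ⊗-mono (⊗-nonneg (ι-nonneg 1) (⊗-nonneg (ι-nonneg 15) (inv-nonneg (Z + j)))) (0≼hits M (suc Z + j))
          (⊗-monoˡ (ι-nonneg 1) (⊗-monoˡ (ι-nonneg 15) (inv-anti 1≤Z (ℕₚ.m≤m+n Z j)))) (hits≼ M E 1≤E pr) ⟩
    ι 1 ⊗ (ι 15 ⊗ inv Z) ⊗ (ι M ⊗ (ind (suc Z + j ∣? ΠK E) ⊕ ι 2 ⊗ inv E))
      ≡⟨ solve 4 (λ x m d y → # 1 :* x :* (m :* (d :+ y)) := m :* x :* (d :+ y)) refl (ι 15 ⊗ inv Z) (ι M) (ind (suc Z + j ∣? ΠK E)) (ι 2 ⊗ inv E) ⟩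
    c ⊗ (ind (suc Z + j ∣? ΠK E) ⊕ ι 2 ⊗ inv E)
      ≲⟨ ⊗-monoˡ 0≼c (⊕-mono (ind-mono (suc Z + j ∣? ΠK E) (yes pr ×-dec suc Z + j ∣? ΠK E) (pr ,_)) ≼-refl) ⟩
    c ⊗ (ind (yes pr ×-dec suc Z + j ∣? ΠK E) ⊕ ι 2 ⊗ inv E) ∎
  few : Σ< (15 * Z) pd ≼ ι (2 * (E * E))
  few = begin
    Σ< (15 * Z) pd  ≲⟨ ≼-by (Σ< (suc Z) f) (Σ-nonneg (suc Z) (λ r _ → ind-nonneg (prime-divisor? (ΠK E) r))) (trans (⊕-comm _ _) (sym (Σ-split (suc Z) (15 * Z) f))) ⟩
    Σ< (suc Z + 15 * Z) f  ≡⟨ ι-cnt (prime-divisor? (ΠK E)) (suc Z + 15 * Z) ⟨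
    ι (cnt (prime-divisor? (ΠK E)) (suc Z + 15 * Z))  ≲⟨ ι-mono (ℕₚ.≤-trans (cnt-ΠK E (suc Z + 15 * Z)) E≤) ⟩
    ι (2 * (E * E))  ∎
    where
    f : ℕ → Q
    f r = ind (prime-divisor? (ΠK E) r)
    E≤ : E * suc E ≤ 2 * (E * E)
    E≤ = ℕₚ.≤-trans (ℕₚ.≤-reflexive (ℕₚ.*-suc E E)) (ℕₚ.≤-trans (ℕₚ.+-monoˡ-≤ (E * E) (ℕₚ.m≤m*n E E {{ℕ.>-nonZero 1≤E}})) (ℕₚ.+-monoʳ-≤ (E * E) (ℕₚ.m≤m+n (E * E) 0)))

-- Π(1 + w) (1 - Σw) ≤ 1
β-block : ∀ Z n → β (Z + n) ⊗ (ι 1 ⊖ Σ< n (λ j → ω (suc Z + j))) ≼ β Z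
β-block Z zero = ≼-reflexive (trans (cong (λ z → β z ⊗ (ι 1 ⊖ ι 0)) (ℕₚ.+-identityʳ Z)) (solve 1 (λ b → b :* (# 1 :- # 0) := b) refl (β Z)))
β-block Z (suc n) = begin
  β (Z + suc n) ⊗ (ι 1 ⊖ (W ⊕ w))  ≡⟨ cong (λ z → β z ⊗ (ι 1 ⊖ (W ⊕ w))) (ℕₚ.+-suc Z n) ⟩
  β (Z + n) ⊗ (ι 1 ⊕ w) ⊗ (ι 1 ⊖ (W ⊕ w))  ≲⟨ ≼-by (β (Z + n) ⊗ (W ⊗ w ⊕ w ⊗ w)) (⊗-nonneg (0≼β (Z + n)) (⊕-nonneg (⊗-nonneg 0≼W (0≼ω (suc Z + n))) (sq-nonneg w)))
                                                           (solve 3 (λ b W w → b :* (# 1 :+ w) :* (# 1 :- (W :+ w)) :+ b :* (W :* w :+ w :* w) := b :* (# 1 :- W)) refl (β (Z + n)) W w) ⟩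
  β (Z + n) ⊗ (ι 1 ⊖ W)  ≲⟨ β-block Z n ⟩
  β Z  ∎
  where
  open ≼-Reasoning
  W w : Q
  W = Σ< n (λ j → ω (suc Z + j))
  w = ω (suc Z + n)
  0≼W : ι 0 ≼ W
  0≼W = Σ-nonneg n (λ j _ → 0≼ω (suc Z + j))

ω-dyadic : ∀ j → 2 ≤ j → ι j ⊗ Σ< (2 ^ j) (λ t → ω (suc (2 ^ j) + t)) ≼ ι 30
ω-dyadic j 2≤j = begin
  ι j ⊗ Σ< n (λ t → ω (suc n + t))  ≲⟨ ⊗-monoˡ (ι-nonneg j) (Σ-mono n (λ t _ → each t (prime? (suc n + t)))) ⟩
  ι j ⊗ Σ< n (λ t → ι 15 ⊗ inv n ⊗ f (suc n + t))  ≡⟨ cong (ι j ⊗_) (Σ-⊗ˡ n _ _) ⟩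
  ι j ⊗ (ι 15 ⊗ inv n ⊗ Σ< n (λ t → f (suc n + t)))  ≲⟨ ⊗-monoˡ (ι-nonneg j) (⊗-monoˡ (⊗-nonneg (ι-nonneg 15) (inv-nonneg n)) few) ⟩
  ι j ⊗ (ι 15 ⊗ inv n ⊗ ι (cnt (primeFrom? n) (2 ^ suc j)))  ≡⟨ solve 3 (λ j v c → j :* (# 15 :* v :* c) := # 15 :* v :* (j :* c)) refl (ι j) (inv n) _ ⟩
  ι 15 ⊗ inv n ⊗ (ι j ⊗ ι (cnt (primeFrom? n) (2 ^ suc j)))  ≡⟨ cong (ι 15 ⊗ inv n ⊗_) (ι-* j _) ⟨
  ι 15 ⊗ inv n ⊗ ι (j * cnt (primeFrom? n) (2 ^ suc j))  ≲⟨ ⊗-monoˡ (⊗-nonneg (ι-nonneg 15) (inv-nonneg n)) (ι-mono (chebyshev-upper j 2≤j)) ⟩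
  ι 15 ⊗ inv n ⊗ ι (2 * n)  ≡⟨ cong (ι 15 ⊗ inv n ⊗_) (ι-* 2 n) ⟩
  ι 15 ⊗ inv n ⊗ (ι 2 ⊗ ι n)  ≡⟨ solve 2 (λ v n → # 15 :* v :* (# 2 :* n) := # 30 :* (n :* v)) refl (inv n) (ι n) ⟩
  ι 30 ⊗ (ι n ⊗ inv n)  ≡⟨ trans (cong (ι 30 ⊗_) (ι⊗inv (2^n≥1 j))) (⊗-idʳ _) ⟩
  ι 30  ∎
  where
  open ≼-Reasoning
  n : ℕ
  n = 2 ^ j
  f : ℕ → Q
  f r = ind (primeFrom? n r)
  each : ∀ t (d : Dec (Prime (suc n + t))) → ind d ⊗ (ι 15 ⊗ inv (n + t)) ≼ ι 15 ⊗ inv n ⊗ ind ((n ℕ.≤? suc n + t) ×-dec d)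
  each t (no _) = ≼-trans (≼-reflexive (⊗-zeroˡ _)) (⊗-nonneg (⊗-nonneg (ι-nonneg 15) (inv-nonneg n)) (ind-nonneg ((n ℕ.≤? suc n + t) ×-dec no _)))
  each t (yes p) = ≼-trans (≼-reflexive (⊗-idˡ _)) (≼-trans (⊗-monoˡ (ι-nonneg 15) (inv-anti (2^n≥1 j) (ℕₚ.m≤m+n n t)))
    (≼-reflexive (sym (trans (cong (ι 15 ⊗ inv n ⊗_) (ind-yes ((n ℕ.≤? suc n + t) ×-dec yes p) (ℕₚ.≤-trans (ℕₚ.n≤1+n n) (ℕₚ.m≤m+n (suc n) t) , p))) (⊗-idʳ _)))))
  few : Σ< n (λ t → f (suc n + t)) ≼ ι (cnt (primeFrom? n) (2 ^ suc j))
  few = begin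
    Σ< n (λ t → f (suc n + t))  ≲⟨ ≼-by (Σ< (suc n) f) (Σ-nonneg (suc n) (λ r _ → ind-nonneg (primeFrom? n r))) (trans (⊕-comm _ _) (sym (Σ-split (suc n) n f))) ⟩
    Σ< (n + n) f ⊕ f (n + n)  ≡⟨ cong (λ m → Σ< m f ⊕ f m) (cong (n +_) (ℕₚ.+-identityʳ n)) ⟨
    Σ< (2 ^ suc j) f ⊕ f (2 ^ suc j)  ≡⟨ trans (cong (Σ< (2 ^ suc j) f ⊕_) (ind-no (primeFrom? n (2 ^ suc j)) (λ (_ , p) → 2^j-not-prime (ℕₚ.m≤n⇒m≤1+n 2≤j) p))) (⊕-idʳ _) ⟩
    Σ< (2 ^ suc j) f  ≡⟨ ι-cnt (primeFrom? n) (2 ^ suc j) ⟨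
    ι (cnt (primeFrom? n) (2 ^ suc j))  ∎

-- The sum W of the weights in the block is at most 30/j ≤ 1/11, and `β-block` then bounds the
-- growth by 1/(1 - 1/11) = 11/10.
β-dyadic : ∀ j → 330 ≤ j → ι 10 ⊗ β (2 ^ suc j) ≼ ι 11 ⊗ β (2 ^ j)
β-dyadic j 330≤j = begin
  ι 10 ⊗ b'  ≲⟨ ≼-by (b' ⊗ (ι 1 ⊖ ι 11 ⊗ W)) (⊗-nonneg (0≼β (2 ^ suc j)) (⊖-nonneg 11W≼1)) (solve 2 (λ b w → # 10 :* b :+ b :* (# 1 :- # 11 :* w) := # 11 :* (b :* (# 1 :- w))) refl b' W) ⟩
  ι 11 ⊗ (b' ⊗ (ι 1 ⊖ W))  ≡⟨ cong (λ m → ι 11 ⊗ (β (n + m) ⊗ (ι 1 ⊖ W))) (ℕₚ.+-identityʳ n) ⟩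
  ι 11 ⊗ (β (n + n) ⊗ (ι 1 ⊖ W)) ≲⟨ ⊗-monoˡ (ι-nonneg 11) (β-block n n) ⟩
  ι 11 ⊗ β n  ∎
  where
  open ≼-Reasoning
  n : ℕ
  n = 2 ^ j
  b' W : Q
  b' = β (2 ^ suc j)
  W = Σ< n (λ t → ω (suc n + t))
  11W≼1 : ι 11 ⊗ W ≼ ι 1
  11W≼1 = ⊗-cancel-ι {30} (s≤s z≤n) (begin
    ι 30 ⊗ (ι 11 ⊗ W)  ≡⟨ solve 1 (λ w → # 30 :* (# 11 :* w) := # 330 :* w) refl W ⟩
    ι 330 ⊗ W  ≲⟨ ⊗-monoʳ (Σ-nonneg n (λ t _ → 0≼ω (suc n + t))) (ι-mono 330≤j) ⟩
    ι j ⊗ W  ≲⟨ ω-dyadic j (ℕₚ.≤-trans (ℕₚ.m≤m+n 2 328) 330≤j) ⟩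
    ι 30  ≡⟨ ⊗-idʳ _ ⟨
    ι 30 ⊗ ι 1  ∎)

β-16 : ∀ j → 330 ≤ j → ι 2 ⊗ β (2 ^ (4 + j)) ≼ ι 3 ⊗ β (2 ^ j)
-- Four dyadic steps give the factor 11^4/10^4, and 14641 ≤ 15000. The integer 5000 clears the
-- denominators.
β-16 j h = ⊗-cancel-ι {5000} (s≤s z≤n) (begin
  ι 5000 ⊗ (ι 2 ⊗ b 4)  ≡⟨ solve 1 (λ b → # 5000 :* (# 2 :* b) := # 1000 :* (# 10 :* b)) refl (b 4) ⟩
  ι 1000 ⊗ (ι 10 ⊗ b 4)  ≲⟨ ⊗-monoˡ (ι-nonneg 1000) (β-dyadic (3 + j) (ℕₚ.≤-trans h (ℕₚ.m≤n+m j 3))) ⟩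
  ι 1000 ⊗ (ι 11 ⊗ b 3)  ≡⟨ solve 1 (λ b → # 1000 :* (# 11 :* b) := # 1100 :* (# 10 :* b)) refl (b 3) ⟩
  ι 1100 ⊗ (ι 10 ⊗ b 3)  ≲⟨ ⊗-monoˡ (ι-nonneg 1100) (β-dyadic (2 + j) (ℕₚ.≤-trans h (ℕₚ.m≤n+m j 2))) ⟩
  ι 1100 ⊗ (ι 11 ⊗ b 2)  ≡⟨ solve 1 (λ b → # 1100 :* (# 11 :* b) := # 1210 :* (# 10 :* b)) refl (b 2) ⟩
  ι 1210 ⊗ (ι 10 ⊗ b 2)  ≲⟨ ⊗-monoˡ (ι-nonneg 1210) (β-dyadic (1 + j) (ℕₚ.≤-trans h (ℕₚ.m≤n+m j 1))) ⟩
  ι 1210 ⊗ (ι 11 ⊗ b 1)  ≡⟨ solve 1 (λ b → # 1210 :* (# 11 :* b) := # 1331 :* (# 10 :* b)) refl (b 1) ⟩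
  ι 1331 ⊗ (ι 10 ⊗ b 1)  ≲⟨ ⊗-monoˡ (ι-nonneg 1331) (β-dyadic j h) ⟩
  ι 1331 ⊗ (ι 11 ⊗ b 0)  ≲⟨ ≼-by (ι 359 ⊗ b 0) (⊗-nonneg (ι-nonneg 359) (0≼β (2 ^ j))) (solve 1 (λ b → # 1331 :* (# 11 :* b) :+ # 359 :* b := # 5000 :* (# 3 :* b)) refl (b 0)) ⟩
  ι 5000 ⊗ (ι 3 ⊗ b 0)  ∎)
  where
  open ≼-Reasoning
  b : ℕ → Q
  b i = β (2 ^ (i + j))

2^4i : ∀ i → 2 ^ (4 * i) ≡ 2 ^ i * 2 ^ i * (2 ^ i * 2 ^ i)
2^4i i = trans (cong (2 ^_) (e i)) (trans (ℕₚ.^-distribˡ-+-* 2 (i + i) (i + i)) (cong₂ _*_ (ℕₚ.^-distribˡ-+-* 2 i i) (ℕₚ.^-distribˡ-+-* 2 i i)))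
  where
  e : ∀ i → 4 * i ≡ (i + i) + (i + i)
  e = solve-∀

-- Block t is (E^4, 16 E^4] with E = 2^(t + i₀). From one block to the next 1/E is halved while `β`
-- grows by at most 3/2, so the contributions decay like (3/4)^t; i₀ is taken large enough for
-- `β-dyadic` to apply.
module Blocks (M i₀ : ℕ) (330≤ : 330 ≤ 4 * i₀) where
  Z : ℕ → ℕ
  Z t = 2 ^ (4 * (t + i₀))

  ρ : ℕ → Q
  ρ zero = ι 1
  ρ (suc t) = ι 3 ⊗ inv 4 ⊗ ρ t

  0≼ρ : ∀ t → ι 0 ≼ ρ t
  0≼ρ zero = ι-nonneg 1
  0≼ρ (suc t) = ⊗-nonneg (⊗-nonneg (ι-nonneg 3) (inv-nonneg 4)) (0≼ρ t)

  4ρ : ∀ t → ι 4 ⊗ ρ (suc t) ≡ ι 3 ⊗ ρ t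
  4ρ t = trans (solve 2 (λ v r → # 4 :* (# 3 :* v :* r) := # 3 :* (# 4 :* v) :* r) refl (inv 4) (ρ t))
    (trans (cong (λ x → ι 3 ⊗ x ⊗ ρ t) (inv-suc 3)) (cong (_⊗ ρ t) (⊗-idʳ (ι 3))))

  Z-suc : ∀ t → Z (suc t) ≡ Z t + 15 * Z t
  Z-suc t = trans (cong (2 ^_) (e (t + i₀))) (f (2 ^ (4 * (t + i₀))))
    where
    e : ∀ i → 4 * suc i ≡ 4 + 4 * i
    e = solve-∀
    f : ∀ x → 2 * (2 * (2 * (2 * x))) ≡ x + 15 * x
    f = solve-∀

  β-step : ∀ t → ι 2 ⊗ β (Z (suc t)) ≼ ι 3 ⊗ β (Z t)
  β-step t = subst (λ n → ι 2 ⊗ β (2 ^ n) ≼ ι 3 ⊗ β (Z t)) (e (t + i₀)) (β-16 (4 * (t + i₀)) (ℕₚ.≤-trans 330≤ (ℕₚ.*-monoʳ-≤ 4 (ℕₚ.m≤n+m i₀ t))))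
    where
    e : ∀ i → 4 + 4 * i ≡ 4 * suc i
    e = solve-∀

  inv-2^-suc : ∀ n → ι 2 ⊗ inv (2 ^ suc n) ≡ inv (2 ^ n)
  inv-2^-suc n = trans (cong (ι 2 ⊗_) (inv-* {2} {2 ^ n} (s≤s z≤n) (2^n≥1 n))) (trans (sym (⊗-assoc (ι 2) (inv 2) (inv (2 ^ n)))) (trans (cong (_⊗ inv (2 ^ n)) (inv-suc 1)) (⊗-idˡ _)))

  β-decay : ∀ t → β (Z t) ⊗ inv (2 ^ (t + i₀)) ≼ ρ t ⊗ β (Z 0)
  β-decay zero = ≼-trans (⊗-monoˡ (0≼β (Z 0)) (inv≼1 (2^n≥1 i₀))) (≼-reflexive (⊗-comm (β (Z 0)) (ι 1)))
  β-decay (suc t) = ⊗-cancel-ι {4} (s≤s z≤n) (begin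
    ι 4 ⊗ (β (Z (suc t)) ⊗ inv (2 ^ suc n))  ≡⟨ solve 2 (λ b v → # 4 :* (b :* v) := (# 2 :* b) :* (# 2 :* v)) refl (β (Z (suc t))) (inv (2 ^ suc n)) ⟩
    (ι 2 ⊗ β (Z (suc t))) ⊗ (ι 2 ⊗ inv (2 ^ suc n))  ≡⟨ cong ((ι 2 ⊗ β (Z (suc t))) ⊗_) (inv-2^-suc n) ⟩
    (ι 2 ⊗ β (Z (suc t))) ⊗ inv (2 ^ n)  ≲⟨ ⊗-monoʳ (inv-nonneg (2 ^ n)) (β-step t) ⟩
    (ι 3 ⊗ β (Z t)) ⊗ inv (2 ^ n)  ≡⟨ ⊗-assoc _ _ _ ⟩
    ι 3 ⊗ (β (Z t) ⊗ inv (2 ^ n))  ≲⟨ ⊗-monoˡ (ι-nonneg 3) (β-decay t) ⟩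
    ι 3 ⊗ (ρ t ⊗ β (Z 0))  ≡⟨ ⊗-assoc _ _ _ ⟨
    (ι 3 ⊗ ρ t) ⊗ β (Z 0)  ≡⟨ cong (_⊗ β (Z 0)) (4ρ t) ⟨
    (ι 4 ⊗ ρ (suc t)) ⊗ β (Z 0)  ≡⟨ ⊗-assoc _ _ _ ⟩
    ι 4 ⊗ (ρ (suc t) ⊗ β (Z 0))  ∎)
    where
    open ≼-Reasoning
    n : ℕ
    n = t + i₀

  ΣΦ-step : ∀ t → ΣΦ M (Z (suc t)) ≼ ΣΦ M (Z t) ⊕ ι M ⊗ (ι 720 ⊗ (ρ t ⊗ β (Z 0)))
  ΣΦ-step t = begin
    ΣΦ M (Z (suc t))  ≡⟨ cong (ΣΦ M) (Z-suc t) ⟩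
    ΣΦ M (Z t + 15 * Z t)  ≲⟨ ΣΦ-block M (Z t) (15 * Z t) ⟩
    ΣΦ M (Z t) ⊕ β (Z t + 15 * Z t) ⊗ Σ< (15 * Z t) (λ j → ω (suc (Z t) + j) ⊗ hits M (suc (Z t) + j))
      ≡⟨ cong (λ z → ΣΦ M (Z t) ⊕ β z ⊗ Σ< (15 * Z t) (λ j → ω (suc (Z t) + j) ⊗ hits M (suc (Z t) + j))) (Z-suc t) ⟨
    ΣΦ M (Z t) ⊕ b' ⊗ Σ< (15 * Z t) (λ j → ω (suc (Z t) + j) ⊗ hits M (suc (Z t) + j))
      ≲⟨ ⊕-mono ≼-refl (⊗-monoˡ (0≼β (Z (suc t))) (subst (λ z → Σ< (15 * z) (λ j → ω (suc z + j) ⊗ hits M (suc z + j)) ≼ ι M ⊗ (ι 480 ⊗ inv E)) (sym (2^4i (t + i₀))) (block-hits M E (2^n≥1 (t + i₀))))) ⟩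
    ΣΦ M (Z t) ⊕ b' ⊗ (ι M ⊗ (ι 480 ⊗ inv E))
      ≡⟨ cong (ΣΦ M (Z t) ⊕_) (solve 3 (λ b m v → b :* (m :* (# 480 :* v)) := m :* (# 240 :* ((# 2 :* b) :* v))) refl b' (ι M) (inv E)) ⟩
    ΣΦ M (Z t) ⊕ ι M ⊗ (ι 240 ⊗ ((ι 2 ⊗ b') ⊗ inv E))
      ≲⟨ ⊕-mono ≼-refl (⊗-monoˡ (ι-nonneg M) (⊗-monoˡ (ι-nonneg 240) (⊗-monoʳ (inv-nonneg E) (β-step t)))) ⟩
    ΣΦ M (Z t) ⊕ ι M ⊗ (ι 240 ⊗ ((ι 3 ⊗ β (Z t)) ⊗ inv E))
      ≡⟨ cong (ΣΦ M (Z t) ⊕_) (solve 3 (λ b m v → m :* (# 240 :* ((# 3 :* b) :* v)) := m :* (# 720 :* (b :* v))) refl (β (Z t)) (ι M) (inv E)) ⟩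
    ΣΦ M (Z t) ⊕ ι M ⊗ (ι 720 ⊗ (β (Z t) ⊗ inv E))
      ≲⟨ ⊕-mono ≼-refl (⊗-monoˡ (ι-nonneg M) (⊗-monoˡ (ι-nonneg 720) (β-decay t))) ⟩
    ΣΦ M (Z t) ⊕ ι M ⊗ (ι 720 ⊗ (ρ t ⊗ β (Z 0))) ∎
    where
    open ≼-Reasoning
    E : ℕ
    E = 2 ^ (t + i₀)
    b' : Q
    b' = β (Z (suc t))

  -- Each block adds at most 720 (3/4)^t in units of M β(Z 0), where 720 = 480 · 3/2. The geometric
  -- series sums to 2880, and the primes up to `Z 0` account for the remaining 1.
  ΣΦ-bound : ∀ t → ΣΦ M (Z t) ≼ ι M ⊗ β (Z 0) ⊗ (ι 2881 ⊖ ι 2880 ⊗ ρ t)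
  ΣΦ-bound zero = begin
    ΣΦ M (Z 0)  ≲⟨ Σ-mono M (λ k _ → Φ≼β (Z 0) (suc k)) ⟩
    Σ< M (λ _ → β (Z 0))  ≡⟨ Σ-const M _ ⟩
    ι M ⊗ β (Z 0)  ≡⟨ solve 1 (λ x → x := x :* (# 2881 :- # 2880 :* # 1)) refl (ι M ⊗ β (Z 0)) ⟩
    ι M ⊗ β (Z 0) ⊗ (ι 2881 ⊖ ι 2880 ⊗ ι 1)  ∎
    where open ≼-Reasoning
  ΣΦ-bound (suc t) = begin
    ΣΦ M (Z (suc t))  ≲⟨ ΣΦ-step t ⟩
    ΣΦ M (Z t) ⊕ ι M ⊗ (ι 720 ⊗ (ρ t ⊗ b))  ≲⟨ ⊕-mono (ΣΦ-bound t) ≼-refl ⟩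
    ι M ⊗ b ⊗ (ι 2881 ⊖ ι 2880 ⊗ ρ t) ⊕ ι M ⊗ (ι 720 ⊗ (ρ t ⊗ b))
      ≡⟨ solve 3 (λ m b r → m :* b :* (# 2881 :- # 2880 :* r) :+ m :* (# 720 :* (r :* b)) := m :* b :* (# 2881 :- # 720 :* (# 3 :* r))) refl (ι M) b (ρ t) ⟩
    ι M ⊗ b ⊗ (ι 2881 ⊖ ι 720 ⊗ (ι 3 ⊗ ρ t))  ≡⟨ cong (λ x → ι M ⊗ b ⊗ (ι 2881 ⊖ ι 720 ⊗ x)) (4ρ t) ⟨
    ι M ⊗ b ⊗ (ι 2881 ⊖ ι 720 ⊗ (ι 4 ⊗ ρ (suc t)))  ≡⟨ solve 3 (λ m b r → m :* b :* (# 2881 :- # 720 :* (# 4 :* r)) := m :* b :* (# 2881 :- # 2880 :* r)) refl (ι M) b (ρ (suc t)) ⟩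
    ι M ⊗ b ⊗ (ι 2881 ⊖ ι 2880 ⊗ ρ (suc t))  ∎
    where
    open ≼-Reasoning
    b : Q
    b = β (Z 0)

β≤16^ : ∀ z → β z ≼ ι (16 ^ z)
β≤16^ zero = ≼-refl
β≤16^ (suc z) = begin
  β z ⊗ (ι 1 ⊕ ω (suc z))  ≲⟨ ⊗-mono (0≼β z) (0≼1⊕ω (suc z)) (β≤16^ z) (≼-trans (⊕-mono ≼-refl (bound z)) (≼-reflexive (sym (ι-+ 1 15)))) ⟩
  ι (16 ^ z) ⊗ ι 16  ≡⟨ trans (⊗-comm _ _) (sym (ι-* 16 (16 ^ z))) ⟩
  ι (16 ^ suc z)  ∎
  where
  open ≼-Reasoning
  bound : ∀ z → ω (suc z) ≼ ι 15
  bound zero = ≼-trans (≼-reflexive (trans (cong (_⊗ (ι 15 ⊗ inv 0)) (ind-no (prime? 1) ¬prime[1])) (⊗-zeroˡ _))) (ι-nonneg 15)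
  bound (suc z) = ≼-trans (⊗-mono (ind-nonneg (prime? (2 + z))) (⊗-nonneg (ι-nonneg 15) (inv-nonneg (suc z))) (ind≼1 (prime? (2 + z))) (⊗-monoˡ (ι-nonneg 15) (inv≼1 (s≤s z≤n))))
    (≼-reflexive (solve 0 (# 1 :* (# 15 :* # 1) := # 15) refl))

opaque
  -- C must not depend on z: the application has z = 2^B and M = 32 B, far beyond any sifting limit
  -- that is polynomial in M.
  romanoff : ∃[ C ] (∀ M z → Σ< M (λ k → pow4 (S (K (suc k)) z)) ≼ ι C ⊗ ι M)
  -- 4 · 83 = 332 is the first multiple of 4 beyond the threshold 330 of `β-dyadic`.
  romanoff = bound 83 (ℕₚ.m≤m+n 330 2)
    where
    bound : ∀ i₀ → 330 ≤ 4 * i₀ → ∃[ C ] (∀ M z → Σ< M (λ k → pow4 (S (K (suc k)) z)) ≼ ι C ⊗ ι M)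
    bound i₀ h = 16 ^ (2 ^ (4 * i₀)) * 2881 , λ M z → let module B = Blocks M i₀ h in begin
      Σ< M (λ k → pow4 (S (K (suc k)) z))  ≲⟨ Σ-mono M (λ k _ → pow4-mono (0≼S (K (suc k)) z) (S-mono (K (suc k)) (z≤ z))) ⟩
      ΣΦ M (B.Z z)  ≲⟨ B.ΣΦ-bound z ⟩
      ι M ⊗ β (B.Z 0) ⊗ (ι 2881 ⊖ ι 2880 ⊗ B.ρ z)  ≲⟨ ⊗-monoˡ (⊗-nonneg (ι-nonneg M) (0≼β (B.Z 0))) (≼-by (ι 2880 ⊗ B.ρ z) (⊗-nonneg (ι-nonneg 2880) (B.0≼ρ z)) (solve 1 (λ x → # 2881 :- x :+ x := # 2881) refl _)) ⟩
      ι M ⊗ β (B.Z 0) ⊗ ι 2881  ≲⟨ ⊗-monoʳ (ι-nonneg 2881) (⊗-monoˡ (ι-nonneg M) (β≤16^ (B.Z 0))) ⟩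
      ι M ⊗ ι (16 ^ B.Z 0) ⊗ ι 2881  ≡⟨ trans (solve 3 (λ m c d → m :* c :* d := (c :* d) :* m) refl (ι M) (ι (16 ^ B.Z 0)) (ι 2881)) (cong (_⊗ ι M) (sym (ι-* (16 ^ B.Z 0) 2881))) ⟩
      ι (16 ^ (2 ^ (4 * i₀)) * 2881) ⊗ ι M  ∎
      where
      open ≼-Reasoning
      z≤ : ∀ z → z ≤ 2 ^ (4 * (z + i₀))
      z≤ z = ℕₚ.≤-trans (ℕₚ.<⇒≤ (n<2^n z)) (ℕₚ.^-monoʳ-≤ 2 (ℕₚ.≤-trans (ℕₚ.m≤m+n z i₀) (ℕₚ.m≤n*m (z + i₀) 4)))

-- Dyadic sums over primes

harmonic-upper : ∀ ℓ → harmonic (2 ^ ℓ) ≼ ι (suc ℓ)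
harmonic-upper zero = ≼-reflexive (trans (⊕-idˡ (inv 1)) inv-1)
harmonic-upper (suc ℓ) = begin
  harmonic (2 ^ suc ℓ)  ≡⟨ cong (λ m → harmonic (n + m)) (ℕₚ.+-identityʳ n) ⟩
  harmonic (n + n)  ≡⟨ Σ-split n n _ ⟩
  harmonic n ⊕ Σ< n (λ k → inv (suc (n + k)))  ≲⟨ ⊕-mono (harmonic-upper ℓ) (Σ-mono n (λ k _ → inv-anti (2^n≥1 ℓ) (ℕₚ.≤-trans (ℕₚ.m≤m+n n k) (ℕₚ.n≤1+n _)))) ⟩
  ι (suc ℓ) ⊕ Σ< n (λ _ → inv n)  ≡⟨ cong (ι (suc ℓ) ⊕_) (trans (Σ-const n _) (ι⊗inv (2^n≥1 ℓ))) ⟩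
  ι (suc ℓ) ⊕ ι 1  ≡⟨ trans (⊕-comm _ _) (sym (ι-suc (suc ℓ))) ⟩
  ι (suc (suc ℓ))  ∎
  where
  open ≼-Reasoning
  n : ℕ
  n = 2 ^ ℓ

2^-cancel-< : ∀ {a b} → 2 ^ a < 2 ^ b → a < b
2^-cancel-< {a} {b} h with a ℕ.<? b
... | yes p = p
... | no ¬p = ⊥-elim (ℕₚ.<⇒≱ h (ℕₚ.^-monoʳ-≤ 2 (ℕₚ.≮⇒≥ ¬p)))

lg : ℕ → ℕ
lg q = proj₁ (floor-log 2 ℕₚ.≤-refl (ℕ.pred q))

lg-lower : ∀ {q} → 1 ≤ q → 2 ^ lg q ≤ q
lg-lower {suc q} _ = proj₁ (proj₂ (floor-log 2 ℕₚ.≤-refl q))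

lg-upper : ∀ {q} → 1 ≤ q → q < 2 ^ suc (lg q)
lg-upper {suc q} _ = proj₂ (proj₂ (floor-log 2 ℕₚ.≤-refl q))

lg-unique : ∀ {q j} → 2 ^ j ≤ q → q < 2 ^ suc j → lg q ≡ j
lg-unique {q} {j} lo hi = ℕₚ.≤-antisym
  (ℕ.s≤s⁻¹ (2^-cancel-< (ℕₚ.≤-<-trans (lg-lower 1≤q) hi)))
  (ℕ.s≤s⁻¹ (2^-cancel-< (ℕₚ.≤-<-trans lo (lg-upper 1≤q))))
  where
  1≤q : 1 ≤ q
  1≤q = ℕₚ.≤-trans (2^n≥1 j) lo

-- Primes q with 2^J ≤ q, weighted by the length κ q of the range left for the cofactor of q.
module Cofactors (J N : ℕ) (2≤J : 2 ≤ J) where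

  Cand : ℕ → Set
  Cand q = Prime q × 2 ^ J ≤ q

  Cand? : ∀ q → Dec (Cand q)
  Cand? q = prime? q ×-dec 2 ^ J ℕ.≤? q

  -- Within a factor of two of 2^N / q, but constant on dyadic blocks of q. When q < 2^N, every s <
  -- κ q satisfies q s < 2^N.
  κ : ℕ → ℕ
  κ q = 2 ^ (N ∸ suc (lg q))

  kq : ℕ → Q
  kq n = Σ< n (λ q → ind (Cand? q) ⊗ ι (κ q))

  Y : Q
  Y = ι (2 ^ (N ∸ 1))

  0≼Y : ι 0 ≼ Y
  0≼Y = ι-nonneg (2 ^ (N ∸ 1))

  2^-split : ∀ j → suc j ≤ N → ι (2 ^ (N ∸ suc j)) ≡ Y ⊗ inv (2 ^ j)
  2^-split j j<N = begin
    x  ≡⟨ ⊗-idʳ x ⟨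
    x ⊗ ι 1  ≡⟨ cong (x ⊗_) (ι⊗inv (2^n≥1 j)) ⟨
    x ⊗ (ι (2 ^ j) ⊗ inv (2 ^ j))  ≡⟨ ⊗-assoc _ _ _ ⟨
    x ⊗ ι (2 ^ j) ⊗ inv (2 ^ j)  ≡⟨ cong (_⊗ inv (2 ^ j)) (trans (sym (ι-* (2 ^ (N ∸ suc j)) (2 ^ j))) (cong ι (trans (sym (ℕₚ.^-distribˡ-+-* 2 (N ∸ suc j) j)) (cong (2 ^_) e)))) ⟩
    Y ⊗ inv (2 ^ j)  ∎
    where
    open ≡-Reasoning
    x : Q
    x = ι (2 ^ (N ∸ suc j))
    e : N ∸ suc j + j ≡ N ∸ 1
    e = trans (cong (_+ j) (sym (ℕₚ.∸-+-assoc N 1 j))) (ℕₚ.m∸n+n≡m (ℕₚ.∸-monoˡ-≤ 1 j<N))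

  block : ℕ → Q
  block j = Σ< (2 ^ j) (λ t → ind (prime? (2 ^ j + t)))

  kq-suc : ∀ j → J ≤ j → suc j ≤ N → kq (2 ^ suc j) ≡ kq (2 ^ j) ⊕ Y ⊗ inv (2 ^ j) ⊗ block j
  kq-suc j J≤j j<N = begin
    kq (n + (n + 0))  ≡⟨ cong (λ m → kq (n + m)) (ℕₚ.+-identityʳ n) ⟩
    kq (n + n)  ≡⟨ Σ-split n n _ ⟩
    kq n ⊕ Σ< n (λ t → ind (Cand? (n + t)) ⊗ ι (κ (n + t))) ≡⟨ cong (kq n ⊕_) (Σ-cong n each) ⟩
    kq n ⊕ Σ< n (λ t → Y ⊗ inv n ⊗ ind (prime? (n + t)))  ≡⟨ cong (kq n ⊕_) (Σ-⊗ˡ n _ _) ⟩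
    kq n ⊕ Y ⊗ inv n ⊗ block j  ∎
    where
    open ≡-Reasoning
    n : ℕ
    n = 2 ^ j
    each : ∀ t → t < n → ind (Cand? (n + t)) ⊗ ι (κ (n + t)) ≡ Y ⊗ inv n ⊗ ind (prime? (n + t))
    each t t<n = trans (cong₂ _⊗_
        (ind-cong (Cand? (n + t)) (prime? (n + t)) proj₁ (λ p → p , ℕₚ.≤-trans (ℕₚ.^-monoʳ-≤ 2 J≤j) (ℕₚ.m≤m+n n t)))
        (trans (cong (λ i → ι (2 ^ (N ∸ suc i))) (lg-unique (ℕₚ.m≤m+n n t) (ℕₚ.+-monoʳ-< n (ℕₚ.≤-trans t<n (ℕₚ.m≤m+n n 0))))) (2^-split j j<N)))
      (⊗-comm _ _)

  pc-suc : ∀ j → ι (pc (2 ^ suc j)) ≡ ι (pc (2 ^ j)) ⊕ block j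
  pc-suc j = begin
    ι (pc (n + (n + 0)))  ≡⟨ cong (λ m → ι (pc (n + m))) (ℕₚ.+-identityʳ n) ⟩
    ι (pc (n + n))  ≡⟨ ι-cnt prime? (n + n) ⟩
    Σ< (n + n) (λ k → ind (prime? k)) ≡⟨ Σ-split n n _ ⟩
    Σ< n (λ k → ind (prime? k)) ⊕ block j ≡⟨ cong (_⊕ block j) (ι-cnt prime? n) ⟨
    ι (pc n) ⊕ block j  ∎
    where
    open ≡-Reasoning
    n : ℕ
    n = 2 ^ j

  kq-start : kq (2 ^ J) ≡ ι 0
  kq-start = trans (Σ-cong (2 ^ J) (λ q q< → trans (cong (_⊗ ι (κ q)) (ind-no (Cand? q) (λ (_ , le) → ℕₚ.<⇒≱ q< le))) (⊗-zeroˡ _))) (Σ-zero (2 ^ J))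

  P : ℕ → Q
  P j = ι (pc (2 ^ j)) ⊗ inv (2 ^ j)

  -- Abel summation
  kq-exact : ∀ m → m + J ≤ N → kq (2 ^ (m + J)) ≡ Y ⊗ (P (m + J) ⊖ P J ⊕ Σ< m (λ i → P (suc (i + J))))
  kq-exact zero _ = trans kq-start (solve 2 (λ y p → # 0 := y :* (p :- p :+ # 0)) refl Y (P J))
  kq-exact (suc m) m<N = begin
    kq (2 ^ suc j)  ≡⟨ kq-suc j (ℕₚ.m≤n+m J m) m<N ⟩
    kq (2 ^ j) ⊕ Y ⊗ inv (2 ^ j) ⊗ block j  ≡⟨ cong₂ (λ a b → a ⊕ Y ⊗ inv (2 ^ j) ⊗ b) (kq-exact m (ℕₚ.<⇒≤ m<N)) block≡ ⟩
    Y ⊗ (P j ⊖ P J ⊕ s) ⊕ Y ⊗ inv (2 ^ j) ⊗ (c' ⊖ c)  ≡⟨ solve 6 (λ y v c c' p s → y :* (c :* v :- p :+ s) :+ y :* v :* (c' :- c) := y :* (c' :* v :- p :+ s)) refl Y (inv (2 ^ j)) c c' (P J) s ⟩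
    Y ⊗ (c' ⊗ inv (2 ^ j) ⊖ P J ⊕ s)  ≡⟨ cong (λ v → Y ⊗ (c' ⊗ v ⊖ P J ⊕ s)) inv2 ⟩
    Y ⊗ (c' ⊗ (ι 2 ⊗ inv (2 ^ suc j)) ⊖ P J ⊕ s)  ≡⟨ solve 5 (λ y v c' p s → y :* (c' :* (# 2 :* v) :- p :+ s) := y :* (c' :* v :- p :+ (s :+ c' :* v))) refl Y (inv (2 ^ suc j)) c' (P J) s ⟩
    Y ⊗ (P (suc j) ⊖ P J ⊕ (s ⊕ P (suc j)))  ∎
    where
    open ≡-Reasoning
    j : ℕ
    j = m + J
    s c c' : Q
    s = Σ< m (λ i → P (suc (i + J)))
    c = ι (pc (2 ^ j))
    c' = ι (pc (2 ^ suc j))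
    block≡ : block j ≡ c' ⊖ c
    block≡ = trans (solve 2 (λ b c → b := (c :+ b) :- c) refl (block j) c) (cong (_⊖ c) (sym (pc-suc j)))
    inv2 : inv (2 ^ j) ≡ ι 2 ⊗ inv (2 ^ suc j)
    inv2 = sym (trans (cong (ι 2 ⊗_) (inv-* {2} {2 ^ j} (s≤s z≤n) (2^n≥1 j))) (trans (sym (⊗-assoc (ι 2) (inv 2) (inv (2 ^ j)))) (trans (cong (_⊗ inv (2 ^ j)) (inv-suc 1)) (⊗-idˡ _))))

  pc≤ : ∀ n → pc n ≤ n
  pc≤ zero = z≤n
  pc≤ (suc n) with prime? n
  ... | yes _ = s≤s (pc≤ n)
  ... | no _ = ℕₚ.m≤n⇒m≤1+n (pc≤ n)

  P≼1 : ∀ j → P j ≼ ι 1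
  P≼1 j = ≼-trans (⊗-monoʳ (inv-nonneg (2 ^ j)) (ι-mono (pc≤ (2 ^ j)))) (≼-reflexive (ι⊗inv (2^n≥1 j)))

  0≼P : ∀ j → ι 0 ≼ P j
  0≼P j = ⊗-nonneg (ι-nonneg (pc (2 ^ j))) (inv-nonneg (2 ^ j))

  inv≼2P : ∀ j → 2 ≤ j → inv j ≼ ι 2 ⊗ P j
  inv≼2P j 2≤j = ⊗-cancel-ι {j * 2 ^ j} (ℕₚ.*-mono-≤ 1≤j (2^n≥1 j)) (begin
    ι (j * n) ⊗ inv j  ≡⟨ trans (cong (_⊗ inv j) (ι-* j n)) (solve 3 (λ j n v → j :* n :* v := n :* (j :* v)) refl (ι j) (ι n) (inv j)) ⟩
    ι n ⊗ (ι j ⊗ inv j)  ≡⟨ trans (cong (ι n ⊗_) (ι⊗inv 1≤j)) (⊗-idʳ _) ⟩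
    ι n  ≲⟨ ι-mono n≤ ⟩
    ι (2 * (j * pc n))  ≡⟨ trans (ι-* 2 (j * pc n)) (cong (ι 2 ⊗_) (ι-* j (pc n))) ⟩
    ι 2 ⊗ (ι j ⊗ ι (pc n))  ≡⟨ trans (sym (⊗-idʳ _)) (cong (ι 2 ⊗ (ι j ⊗ ι (pc n)) ⊗_) (sym (ι⊗inv (2^n≥1 j)))) ⟩
    ι 2 ⊗ (ι j ⊗ ι (pc n)) ⊗ (ι n ⊗ inv n)  ≡⟨ solve 4 (λ j c n v → # 2 :* (j :* c) :* (n :* v) := j :* n :* (# 2 :* (c :* v))) refl (ι j) (ι (pc n)) (ι n) (inv n) ⟩
    ι j ⊗ ι n ⊗ (ι 2 ⊗ P j)  ≡⟨ cong (_⊗ (ι 2 ⊗ P j)) (ι-* j n) ⟨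
    ι (j * n) ⊗ (ι 2 ⊗ P j)  ∎)
    where
    open ≼-Reasoning
    n : ℕ
    n = 2 ^ j
    1≤j : 1 ≤ j
    1≤j = ℕₚ.<⇒≤ 2≤j
    4≤n : 4 ≤ n
    4≤n = ℕₚ.^-monoʳ-≤ 2 2≤j
    n≤ : n ≤ 2 * (j * pc n)
    n≤ = ℕₚ.+-cancelˡ-≤ n _ _ (ℕₚ.≤-trans (ℕₚ.≤-trans (ℕₚ.≤-reflexive (cong (n +_) (sym (ℕₚ.+-identityʳ n)))) (ℕₚ.*-monoʳ-≤ 2 (chebyshev-lower j)))
      (ℕₚ.≤-trans (ℕₚ.≤-reflexive (e (j * pc n))) (ℕₚ.+-monoˡ-≤ (2 * (j * pc n)) 4≤n)))
      where
      e : ∀ x → 2 * (x + 2) ≡ 4 + 2 * x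
      e = solve-∀

  tail : ℕ → Q
  tail m = Σ< m (λ i → inv (suc (i + J)))

  -- Chebyshev's bound P j ≥ 1/(2j) turns the sum in `kq-exact` into a harmonic tail. The boundary
  -- term -P J is at least -1, which explains the added Y.
  kq-lower : ∀ m → m + J ≤ N → Y ⊗ tail m ≼ ι 2 ⊗ (kq (2 ^ (m + J)) ⊕ Y)
  kq-lower m h = begin
    Y ⊗ tail m  ≲⟨ ⊗-monoˡ 0≼Y (Σ-mono m (λ i _ → inv≼2P (suc (i + J)) (ℕₚ.≤-trans 2≤J (ℕₚ.≤-trans (ℕₚ.m≤n+m J i) (ℕₚ.n≤1+n _))))) ⟩
    Y ⊗ Σ< m (λ i → ι 2 ⊗ P (suc (i + J)))  ≡⟨ cong (Y ⊗_) (Σ-⊗ˡ m (ι 2) _) ⟩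
    Y ⊗ (ι 2 ⊗ s)  ≲⟨ ≼-by (ι 2 ⊗ (Y ⊗ (P (m + J) ⊕ (ι 1 ⊖ P J)))) (⊗-nonneg (ι-nonneg 2) (⊗-nonneg 0≼Y (⊕-nonneg (0≼P (m + J)) (⊖-nonneg (P≼1 J)))))
                                                          (solve 4 (λ y s p q → y :* (# 2 :* s) :+ # 2 :* (y :* (p :+ (# 1 :- q))) := # 2 :* (y :* (p :- q :+ s) :+ y)) refl Y s (P (m + J)) (P J)) ⟩
    ι 2 ⊗ (Y ⊗ (P (m + J) ⊖ P J ⊕ s) ⊕ Y)  ≡⟨ cong (λ x → ι 2 ⊗ (x ⊕ Y)) (kq-exact m h) ⟨
    ι 2 ⊗ (kq (2 ^ (m + J)) ⊕ Y)  ∎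
    where
    open ≼-Reasoning
    s : Q
    s = Σ< m (λ i → P (suc (i + J)))

  block-upper : ∀ j → 2 ≤ j → inv (2 ^ j) ⊗ block j ≼ ι 2 ⊗ inv j
  block-upper j 2≤j = ⊗-cancel-ι {j} (ℕₚ.<⇒≤ 2≤j) (begin
    ι j ⊗ (inv n ⊗ block j)  ≲⟨ ⊗-monoˡ (ι-nonneg j) (⊗-monoˡ (inv-nonneg n) block≼) ⟩
    ι j ⊗ (inv n ⊗ ι c)  ≡⟨ trans (solve 3 (λ j v c → j :* (v :* c) := v :* (j :* c)) refl (ι j) (inv n) (ι c)) (cong (inv n ⊗_) (sym (ι-* j c))) ⟩
    inv n ⊗ ι (j * c)  ≲⟨ ⊗-monoˡ (inv-nonneg n) (ι-mono (chebyshev-upper j 2≤j)) ⟩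
    inv n ⊗ ι (2 * n)  ≡⟨ trans (cong (inv n ⊗_) (ι-* 2 n)) (solve 2 (λ v n → v :* (# 2 :* n) := # 2 :* (n :* v)) refl (inv n) (ι n)) ⟩
    ι 2 ⊗ (ι n ⊗ inv n)  ≡⟨ cong (ι 2 ⊗_) (trans (ι⊗inv (2^n≥1 j)) (sym (ι⊗inv (ℕₚ.<⇒≤ 2≤j)))) ⟩
    ι 2 ⊗ (ι j ⊗ inv j)  ≡⟨ solve 2 (λ j v → # 2 :* (j :* v) := j :* (# 2 :* v)) refl (ι j) (inv j) ⟩
    ι j ⊗ (ι 2 ⊗ inv j)  ∎)
    where
    open ≼-Reasoning
    n c : ℕ
    n = 2 ^ j
    c = cnt (primeFrom? n) (2 ^ suc j)
    f : ℕ → Q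
    f r = ind (primeFrom? n r)
    block≼ : block j ≼ ι c
    block≼ = begin
      block j  ≲⟨ Σ-mono n (λ t _ → ind-mono (prime? (n + t)) (primeFrom? n (n + t)) (λ p → ℕₚ.m≤m+n n t , p)) ⟩
      Σ< n (λ t → f (n + t))  ≲⟨ ≼-by (Σ< n f) (Σ-nonneg n (λ r _ → ind-nonneg (primeFrom? n r))) (trans (⊕-comm _ _) (sym (Σ-split n n f))) ⟩
      Σ< (n + n) f  ≡⟨ cong (λ m → Σ< (n + m) f) (ℕₚ.+-identityʳ n) ⟨
      Σ< (2 ^ suc j) f  ≡⟨ ι-cnt (primeFrom? n) (2 ^ suc j) ⟨
      ι c  ∎

  kq-upper : ∀ m → m + J ≤ N → kq (2 ^ (m + J)) ≼ Y ⊗ (ι 2 ⊗ Σ< m (λ i → inv (i + J)))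
  kq-upper zero _ = ≼-reflexive (trans kq-start (solve 1 (λ y → # 0 := y :* (# 2 :* # 0)) refl Y))
  kq-upper (suc m) m<N = begin
    kq (2 ^ suc j)  ≡⟨ kq-suc j (ℕₚ.m≤n+m J m) m<N ⟩
    kq (2 ^ j) ⊕ Y ⊗ inv (2 ^ j) ⊗ block j  ≲⟨ ⊕-mono (kq-upper m (ℕₚ.<⇒≤ m<N)) (≼-trans (≼-reflexive (⊗-assoc _ _ _)) (⊗-monoˡ 0≼Y (block-upper j (ℕₚ.≤-trans 2≤J (ℕₚ.m≤n+m J m))))) ⟩
    Y ⊗ (ι 2 ⊗ s) ⊕ Y ⊗ (ι 2 ⊗ inv j)  ≡⟨ solve 3 (λ y s v → y :* (# 2 :* s) :+ y :* (# 2 :* v) := y :* (# 2 :* (s :+ v))) refl Y s (inv j) ⟩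
    Y ⊗ (ι 2 ⊗ (s ⊕ inv j))  ∎
    where
    open ≼-Reasoning
    j : ℕ
    j = m + J
    s : Q
    s = Σ< m (λ i → inv (i + J))

  0≼kq : ∀ n → ι 0 ≼ kq n
  0≼kq n = Σ-nonneg n (λ q _ → ⊗-nonneg (ind-nonneg (Cand? q)) (ι-nonneg (κ q)))

-- Pairs of primes with a given difference

S-6 : ∀ z → S 6 z ≼ ι 4
S-6 z = begin
  S 6 z  ≲⟨ S-* 2 3 z ⟩
  S 2 z ⊗ S 3 z  ≲⟨ ⊗-mono (0≼S 2 z) (0≼S 3 z) (S-prime prime[2] z) (S-prime (from-yes (prime? 3)) z) ⟩
  ι 2 ⊗ ι 2  ≡⟨ ι-* 2 2 ⟨
  ι 4  ∎
  where open ≼-Reasoning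

large-prime : ∀ {r p z} → Prime r → Prime p → r ≤ z → z < p → ¬ r ∣ p
large-prime pr pp r≤z z<p d = ℕₚ.<⇒≢ (ℕₚ.≤-<-trans r≤z z<p) (prime∣prime pr pp d)

LargePrime? : ∀ z p → Dec (Prime p × z < p)
LargePrime? z p = prime? p ×-dec z ℕ.<? p

-- The forms t and t + k + 1 have a common zero only modulo primes dividing k + 1, so H = 6 (k + 1)
-- is admissible. Primes up to z would be sifted out themselves, hence `LargePrime?`. The constant
-- is 4 · 2 · 4².
prime-pairs : ∀ ℓ → 1 ≤ ℓ → ∀ M → 2 ^ (18 * ℓ) ≤ M → ∀ k → let z = 2 ^ ℓ in
  Σ< M (λ p → ind (LargePrime? z p) ⊗ ind (LargePrime? z (suc k + p))) ⊗ ι (ℓ * ℓ)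
    ≼ ι 128 ⊗ ι M ⊗ (S (suc k) z ⊗ S (suc k) z)
prime-pairs ℓ 1≤ℓ M D≤M k = begin
  Σ< M f ⊗ ι (ℓ * ℓ)
    ≲⟨ sieve-bound ℓ 1≤ℓ M f (λ t _ → ⊗-nonneg (ind-nonneg (LargePrime? z t)) (ind-nonneg (LargePrime? z (suc k + t)))) (λ t _ → good t (LargePrime? z t) (LargePrime? z (suc k + t))) ⟩
  ι 4 ⊗ (ι M ⊕ ι (2 ^ (18 * ℓ))) ⊗ (S H z ⊗ S H z)
    ≲⟨ ⊗-mono (⊗-nonneg (ι-nonneg 4) (⊕-nonneg (ι-nonneg M) (ι-nonneg (2 ^ (18 * ℓ))))) (sq-nonneg (S H z))
         (⊗-monoˡ (ι-nonneg 4) (⊕-mono ≼-refl (ι-mono D≤M))) (⊗-mono (0≼S H z) (0≼S H z) SH≼ SH≼) ⟩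
  ι 4 ⊗ (ι M ⊕ ι M) ⊗ (ι 4 ⊗ s ⊗ (ι 4 ⊗ s))
    ≡⟨ solve 2 (λ m s → # 4 :* (m :+ m) :* (# 4 :* s :* (# 4 :* s)) := # 128 :* m :* (s :* s)) refl (ι M) s ⟩
  ι 128 ⊗ ι M ⊗ (s ⊗ s) ∎
  where
  open ≼-Reasoning
  z H : ℕ
  z = 2 ^ ℓ
  H = 6 * suc k
  s : Q
  s = S (suc k) z
  f : ℕ → Q
  f p = ind (LargePrime? z p) ⊗ ind (LargePrime? z (suc k + p))
  open LinearForms H (m∣m*n (suc k)) 0 1 (suc k) 1
    (λ r pr r∤H → prime∤1 pr , prime∤1 pr , λ t d d' → r∤H (∣n⇒∣m*n 6 (∣m+n∣m⇒∣n (subst (r ∣_) (ℕₚ.+-comm (suc k) (1 * t)) d') d)))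
  SH≼ : S H z ≼ ι 4 ⊗ s
  SH≼ = ≼-trans (S-* 6 (suc k) z) (⊗-monoʳ (0≼S (suc k) z) (S-6 z))
  good : ∀ t (d : Dec (Prime t × z < t)) (e : Dec (Prime (suc k + t) × z < suc k + t)) →
    ind d ⊗ ind e ≼ ι 0 ⊎ (ind d ⊗ ind e ≼ ι 1 × (∀ r → r ≤ z → Prime r → ¬ r ∣ 0 + 1 * t × ¬ r ∣ suc k + 1 * t))
  good t (no _) e = inj₁ (≼-reflexive (⊗-zeroˡ _))
  good t (yes _) (no _) = inj₁ (≼-reflexive (⊗-zeroʳ _))
  good t (yes (pt , z<t)) (yes (pt' , z<t')) = inj₂ (≼-reflexive (⊗-idˡ (ι 1)) , λ r r≤z pr →
    (λ d → large-prime pr pt r≤z z<t (subst (r ∣_) (ℕₚ.*-identityˡ t) d)) ,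
    (λ d → large-prime pr pt' r≤z z<t' (subst (λ x → r ∣ suc k + x) (ℕₚ.*-identityˡ t) d)))

prime∣2^ : ∀ {r} → Prime r → ∀ n → r ∣ 2 ^ n → r ∣ 2
prime∣2^ pr zero d = ⊥-elim (prime∤1 pr d)
prime∣2^ pr (suc n) d with euclidsLemma 2 (2 ^ n) pr d
... | inj₁ d' = d'
... | inj₂ d' = prime∣2^ pr n d'

-- Representations of n as 2^p + q s

module Representations (J N B : ℕ) (2≤J : 2 ≤ J) where
  open Cofactors J N 2≤J public

  -- The condition s > 2^B has two uses: such a prime survives sifting up to 2^B, and it exceeds q,
  -- so that q can be recovered from the product q s.
  Cofactor : ℕ → ℕ → ℕ → ℕ → Set
  Cofactor p q n s = Prime s × 2 ^ B < s × n ≡ 2 ^ p + q * s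

  Rep : ℕ → ℕ → ℕ → Set
  Rep p q n = Cand q × ∃ λ s → s < κ q × Cofactor p q n s

  Rep? : ∀ p q n → Dec (Rep p q n)
  Rep? p q n = Cand? q ×-dec ℕₚ.anyUpTo? (λ s → prime? s ×-dec 2 ^ B ℕ.<? s ×-dec n ℕ.≟ 2 ^ p + q * s) (κ q)

  -- Two exponents with difference k + 1, so that h = 2^p - 2^p'. Its odd part D depends on k alone,
  -- which makes the sieve bound uniform in p'.
  module Pair (p' k q q' : ℕ) where
    p h D : ℕ
    p = p' + suc k
    D = 2 ^ suc k ∸ 1
    h = 2 ^ p' * D

    2^p≡ : 2 ^ p ≡ 2 ^ p' + h
    2^p≡ = begin
      2 ^ (p' + suc k)  ≡⟨ ℕₚ.^-distribˡ-+-* 2 p' (suc k) ⟩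
      2 ^ p' * 2 ^ suc k  ≡⟨ cong (2 ^ p' *_) (ℕₚ.m+[n∸m]≡n (2^n≥1 (suc k))) ⟨
      2 ^ p' * suc D  ≡⟨ ℕₚ.*-suc (2 ^ p') D ⟩
      2 ^ p' + h  ∎
      where open ≡-Reasoning

    relation : ∀ {n s s'} → n ≡ 2 ^ p + q * s → n ≡ 2 ^ p' + q' * s' → h + q * s ≡ q' * s'
    relation {n} {s} {s'} e e' = ℕₚ.+-cancelˡ-≡ (2 ^ p') _ _ (trans (sym (ℕₚ.+-assoc (2 ^ p') h (q * s))) (trans (cong (_+ q * s) (sym 2^p≡)) (trans (sym e) e')))

    both : ℕ → Q
    both n = ind (Rep? p q (suc n)) ⊗ ind (Rep? p' q' (suc n))

    -- Either the product of the indicators vanishes, or both representations exist and it is at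
    -- most 1. The motive R accommodates the different conclusions drawn from this.
    both-cases : ∀ (R : ℕ → Q → Set) n → (∀ x → x ≼ ι 0 → R n x) → (Rep p q (suc n) → Rep p' q' (suc n) → ∀ x → x ≼ ι 1 → R n x) → R n (both n)
    both-cases R n f g = go (Rep? p q (suc n)) (Rep? p' q' (suc n))
      where
      go : ∀ (d : Dec (Rep p q (suc n))) (e : Dec (Rep p' q' (suc n))) → R n (ind d ⊗ ind e)
      go (no _) e = f _ (≼-reflexive (⊗-zeroˡ _))
      go (yes _) (no _) = f _ (≼-reflexive (⊗-zeroʳ _))
      go (yes a) (yes b) = g a b _ (≼-reflexive (⊗-idˡ (ι 1)))

    module Distinct (pq : Prime q) (pq' : Prime q') (q≢q' : ¬ q ≡ q') (1≤B : 1 ≤ B)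
      (lg≤ : 18 * B ≤ N ∸ suc (lg q) ∸ lg q') where

      -- Excluded from the sieve are q and q', the leading coefficients of the two forms, and the
      -- divisors of D, modulo which the forms may vanish together. T is κ q divided by 2^(lg q'),
      -- the range left for t in s = c + q' t.
      H T : ℕ
      H = 6 * (q * (q' * D))
      T = 2 ^ (N ∸ suc (lg q) ∸ lg q')

      q'∤q : ¬ q' ∣ q
      q'∤q d = q≢q' (sym (prime∣prime pq' pq d))

      root : ∃[ c ] (c < q' × q' ∣ h + q * c)
      root = root-exists pq' q'∤q h

      c a' : ℕ
      c = proj₁ root
      a' = quotient (proj₂ (proj₂ root))

      a'-eq : h + q * c ≡ a' * q'
      a'-eq = m∣n⇒n≡quotient*m (proj₂ (proj₂ root))

      forms : ∀ t → q' * (a' + q * t) ≡ h + q * (c + q' * t)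
      forms t = trans (e₁ q' a' q t) (trans (cong (_+ q' * (q * t)) (sym a'-eq)) (e₂ h q c q' t))
        where
        e₁ : ∀ q' a' q t → q' * (a' + q * t) ≡ a' * q' + q' * (q * t)
        e₁ = solve-∀
        e₂ : ∀ h q c q' t → h + q * c + q' * (q * t) ≡ h + q * (c + q' * t)
        e₂ = solve-∀

      admissible : ∀ r → Prime r → ¬ r ∣ H → ¬ r ∣ q' × ¬ r ∣ q × (∀ t → r ∣ c + q' * t → ¬ r ∣ a' + q * t)
      admissible r pr r∤H = (λ d → r∤H (∣n⇒∣m*n 6 (∣n⇒∣m*n q (∣m⇒∣m*n D d)))) , (λ d → r∤H (∣n⇒∣m*n 6 (∣m⇒∣m*n (q' * D) d))) , disjoint
        where
        disjoint : ∀ t → r ∣ c + q' * t → ¬ r ∣ a' + q * t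
        disjoint t d d' = case euclidsLemma (2 ^ p') D pr
            (∣m+n∣m⇒∣n (subst (r ∣_) (trans (forms t) (ℕₚ.+-comm h _)) (∣n⇒∣m*n q' d')) (∣n⇒∣m*n q d)) of λ
          { (inj₁ x) → r∤H (∣m⇒∣m*n (q * (q' * D)) (∣-trans (prime∣2^ pr p' x) (divides 3 refl)))
          ; (inj₂ x) → r∤H (∣n⇒∣m*n 6 (∣n⇒∣m*n q (∣n⇒∣m*n q' x))) }

      open LinearForms H (m∣m*n (q * (q' * D))) c q' a' q admissible using (sieve-bound)

      f : ℕ → Q
      f t = ind (LargePrime? (2 ^ B) (c + q' * t) ×-dec LargePrime? (2 ^ B) (a' + q * t))

      good : ∀ t (d : Dec ((Prime (c + q' * t) × 2 ^ B < c + q' * t) × (Prime (a' + q * t) × 2 ^ B < a' + q * t))) →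
        ind d ≼ ι 0 ⊎ (ind d ≼ ι 1 × (∀ r → r ≤ 2 ^ B → Prime r → ¬ r ∣ c + q' * t × ¬ r ∣ a' + q * t))
      good t (no _) = inj₁ ≼-refl
      good t (yes ((pu , z<u) , (pv , z<v))) = inj₂ (≼-refl , λ r r≤z pr → large-prime pr pu r≤z z<u , large-prime pr pv r≤z z<v)

      instance
        nonZero-q' : NonZero q'
        nonZero-q' = prime⇒nonZero pq'

      -- The relation h + q s = q' s' fixes s mod q', as the root c. Then s = c + q' t, and
      -- cancelling q' determines s'.
      parametrize : ∀ {n s s'} → s < κ q → n ≡ 2 ^ p + q * s → n ≡ 2 ^ p' + q' * s' →
        ∃[ t ] (t < T × s ≡ c + q' * t × s' ≡ a' + q * t)
      parametrize {n} {s} {s'} s<κ e e' = t , t<T , s≡ , s'≡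
        where
        t : ℕ
        t = s / q'
        split : s ≡ s % q' + t * q'
        split = m≡m%n+[m/n]*n s q'
        d : q' ∣ h + q * s
        d = subst (q' ∣_) (sym (relation e e')) (m∣m*n s')
        e₁ : ∀ h q x t q' → h + q * (x + t * q') ≡ q * t * q' + (h + q * x)
        e₁ = solve-∀
        c≡ : s % q' ≡ c
        c≡ = root-unique pq' q'∤q h (m%n<n s q') (proj₁ (proj₂ root))
          (∣m+n∣m⇒∣n (subst (q' ∣_) (trans (cong (λ s → h + q * s) split) (e₁ h q (s % q') t q')) d) (n∣m*n (q * t))) (proj₂ (proj₂ root))
        s≡ : s ≡ c + q' * t
        s≡ = trans split (cong₂ _+_ c≡ (ℕₚ.*-comm t q'))
        s'≡ : s' ≡ a' + q * t
        s'≡ = ℕₚ.*-cancelˡ-≡ s' (a' + q * t) q' (trans (sym (relation e e')) (trans (cong (λ s → h + q * s) s≡) (sym (forms t))))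
        exp : lg q' + (N ∸ suc (lg q) ∸ lg q') ≡ N ∸ suc (lg q)
        exp = ℕₚ.m+[n∸m]≡n {lg q'} (ℕₚ.<⇒≤ (ℕₚ.≰⇒> (λ x → ℕₚ.<⇒≱ (ℕₚ.*-mono-≤ {1} {18} (s≤s z≤n) 1≤B) (ℕₚ.≤-trans lg≤ (ℕₚ.≤-reflexive (ℕₚ.m≤n⇒m∸n≡0 x))))))
        t<T : t < T
        t<T = ℕₚ.*-cancelˡ-< (2 ^ lg q') t T (ℕₚ.≤-<-trans
          (ℕₚ.≤-trans (ℕₚ.*-monoˡ-≤ t (lg-lower (prime≥1 pq'))) (ℕₚ.≤-trans (ℕₚ.m≤n+m (q' * t) c) (ℕₚ.≤-reflexive (sym s≡))))
          (ℕₚ.<-≤-trans s<κ (ℕₚ.≤-reflexive (trans (cong (2 ^_) (sym exp)) (ℕₚ.^-distribˡ-+-* 2 (lg q') _)))))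

      reindexed : ∀ X → Σ< X both ≼ Σ< T f
      reindexed X = Σ-reindex X T both f (λ t → ℕ.pred (2 ^ p + q * (c + q' * t)))
        (λ t _ → ind-nonneg (LargePrime? (2 ^ B) (c + q' * t) ×-dec LargePrime? (2 ^ B) (a' + q * t)))
        (λ n _ → both-cases (λ n x → (∃[ t ] (t < T × n ≡ ℕ.pred (2 ^ p + q * (c + q' * t)) × x ≼ f t)) ⊎ x ≼ ι 0) n (λ x → inj₂) (hit n))
        where
        hit : ∀ n → Rep p q (suc n) → Rep p' q' (suc n) → ∀ x → x ≼ ι 1 →
          (∃[ t ] (t < T × n ≡ ℕ.pred (2 ^ p + q * (c + q' * t)) × x ≼ f t)) ⊎ x ≼ ι 0
        hit n (_ , s , s<κ , ps , B<s , e) (_ , s' , _ , ps' , B<s' , e') x x≼1 = inj₁ (found (parametrize s<κ e e'))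
          where
          found : ∃[ t ] (t < T × s ≡ c + q' * t × s' ≡ a' + q * t) → ∃[ t ] (t < T × n ≡ ℕ.pred (2 ^ p + q * (c + q' * t)) × x ≼ f t)
          found (t , t<T , s≡ , s'≡) = t , t<T , cong ℕ.pred (trans e (cong (λ s → 2 ^ p + q * s) s≡)) ,
            ≼-trans x≼1 (≼-reflexive (sym (ind-yes (LargePrime? (2 ^ B) (c + q' * t) ×-dec LargePrime? (2 ^ B) (a' + q * t))
              ((subst Prime s≡ ps , subst (2 ^ B <_) s≡ B<s) , (subst Prime s'≡ ps' , subst (2 ^ B <_) s'≡ B<s')))))

      -- S H is at most S 6 · S q · S q' · S D ≤ 16 S D. By the hypothesis on N the sieve error does
      -- not exceed T, which gives 4 · 2 · 16² = 2048.
      distinct-bound : ∀ X → Σ< X both ⊗ ι (B * B) ≼ ι 2048 ⊗ ι T ⊗ (S D (2 ^ B) ⊗ S D (2 ^ B))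
      distinct-bound X = begin
        Σ< X both ⊗ ι (B * B)
          ≲⟨ ⊗-monoʳ (ι-nonneg (B * B)) (reindexed X) ⟩
        Σ< T f ⊗ ι (B * B)
          ≲⟨ sieve-bound B 1≤B T f (λ t _ → ind-nonneg (LargePrime? (2 ^ B) (c + q' * t) ×-dec LargePrime? (2 ^ B) (a' + q * t)))
               (λ t _ → good t (LargePrime? (2 ^ B) (c + q' * t) ×-dec LargePrime? (2 ^ B) (a' + q * t))) ⟩
        ι 4 ⊗ (ι T ⊕ ι (2 ^ (18 * B))) ⊗ (S H z ⊗ S H z)
          ≲⟨ ⊗-mono (⊗-nonneg (ι-nonneg 4) (⊕-nonneg (ι-nonneg T) (ι-nonneg (2 ^ (18 * B))))) (sq-nonneg (S H z))
               (⊗-monoˡ (ι-nonneg 4) (⊕-mono ≼-refl (ι-mono (ℕₚ.^-monoʳ-≤ 2 lg≤)))) (⊗-mono (0≼S H z) (0≼S H z) SH≼ SH≼) ⟩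
        ι 4 ⊗ (ι T ⊕ ι T) ⊗ (ι 4 ⊗ (ι 2 ⊗ (ι 2 ⊗ s)) ⊗ (ι 4 ⊗ (ι 2 ⊗ (ι 2 ⊗ s))))
          ≡⟨ solve 2 (λ t s → # 4 :* (t :+ t) :* (# 4 :* (# 2 :* (# 2 :* s)) :* (# 4 :* (# 2 :* (# 2 :* s)))) := # 2048 :* t :* (s :* s)) refl (ι T) s ⟩
        ι 2048 ⊗ ι T ⊗ (s ⊗ s) ∎
        where
        open ≼-Reasoning
        z : ℕ
        z = 2 ^ B
        s : Q
        s = S D z
        SH≼ : S H z ≼ ι 4 ⊗ (ι 2 ⊗ (ι 2 ⊗ s))
        SH≼ = ≼-trans (S-* 6 (q * (q' * D)) z) (⊗-mono (0≼S 6 z) (0≼S (q * (q' * D)) z) (S-6 z)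
          (≼-trans (S-* q (q' * D) z) (⊗-mono (0≼S q z) (0≼S (q' * D) z) (S-prime pq z)
            (≼-trans (S-* q' D z) (⊗-monoʳ (0≼S D z) (S-prime pq' z))))))

-- Correlation of the representation counts of two exponents

Σ-⊗Σ : ∀ m n (f g : ℕ → Q) → Σ< m f ⊗ Σ< n g ≡ Σ< m (λ i → Σ< n (λ j → f i ⊗ g j))
Σ-⊗Σ m n f g = trans (sym (Σ-⊗ʳ m (Σ< n g) f)) (Σ-cong m (λ i _ → sym (Σ-⊗ˡ n (f i) g)))

ind-unique : ∀ {P : ℕ → Set} (P? : ∀ n → Dec (P n)) n → (∀ i j → i < n → j < n → P i → P j → i ≡ j) → Σ< n (λ i → ind (P? i)) ≼ ι 1
ind-unique {P} P? n uniq = go (ℕₚ.anyUpTo? P? n)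
  where
  go : Dec (∃ λ i → i < n × P i) → Σ< n (λ i → ind (P? i)) ≼ ι 1
  go (yes (i , i<n , pi)) = Σ-single n _ i (ι 1) (ι-nonneg 1) (λ j j<n → each j j<n (j ℕ.≟ i))
    where
    each : ∀ j → j < n → Dec (j ≡ i) → (j ≡ i × ind (P? j) ≼ ι 1) ⊎ ind (P? j) ≼ ι 0
    each j j<n (yes e) = inj₁ (e , ind≼1 (P? j))
    each j j<n (no ne) = inj₂ (≼-reflexive (ind-no (P? j) (λ pj → ne (uniq j i j<n i<n pj pi))))
  go (no none) = ≼-trans (≼-reflexive (trans (Σ-cong n (λ i i<n → ind-no (P? i) (λ pi → none (i , i<n , pi)))) (Σ-zero n))) (ι-nonneg 1)

-- Since q, q' < 2^B, the condition 20 B ≤ N leaves a range of at least 2^(18 B) for t, the size of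
-- the sieve error at the limit 2^B.
module Moments (J N B : ℕ) (2≤J : 2 ≤ J) (1≤B : 1 ≤ B) (20B≤N : 20 * B ≤ N) where
  open Representations J N B 2≤J public

  lg<B : ∀ {q} → Prime q → q < 2 ^ B → lg q < B
  lg<B pq q< = 2^-cancel-< (ℕₚ.≤-<-trans (lg-lower (prime≥1 pq)) q<)

  Cand≥4 : ∀ {q} → Cand q → 4 ≤ q
  Cand≥4 (_ , le) = ℕₚ.≤-trans (ℕₚ.^-monoʳ-≤ 2 2≤J) le

  module _ (p' k : ℕ) where
    D : ℕ
    D = 2 ^ suc k ∸ 1

    -- If q = q', then q divides 2^p' D, hence D, as q ≥ 4 is an odd prime. And q ≥ 2^J leaves fewer
    -- than 2^(N - J - 1) + 1 choices of s.
    equal-bound : ∀ q X → Σ< X (Pair.both p' k q q) ≼ ind (prime-divisor? D q) ⊗ ι (2 ^ (N ∸ suc J))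
    equal-bound q X = go (prime-divisor? D q)
      where
      open Pair p' k q q using (both; both-cases; relation)
      divides-D : ∀ n → Rep (p' + suc k) q (suc n) → Rep p' q (suc n) → Prime q × q ∣ D
      divides-D n (cq@(pq , _) , s , _ , _ , _ , e) (_ , s' , _ , _ , _ , e') = pq ,
        (case euclidsLemma (2 ^ p') D pq (∣m+n∣m⇒∣n (subst (q ∣_) (trans (sym (relation e e')) (ℕₚ.+-comm _ (q * s))) (m∣m*n s')) (m∣m*n s)) of λ
          { (inj₂ x) → x
          ; (inj₁ x) → ⊥-elim (ℕₚ.<⇒≱ (ℕₚ.≤-trans (s≤s (s≤s (s≤s z≤n))) (Cand≥4 cq)) (∣⇒≤ (prime∣2^ pq p' x))) })
      go : ∀ (d : Dec (Prime q × q ∣ D)) → Σ< X both ≼ ind d ⊗ ι (2 ^ (N ∸ suc J))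
      go (no ¬d) = ≼-trans (Σ-mono X (λ n _ → both-cases (λ _ x → x ≼ ι 0) n (λ _ le → le) (λ a b _ _ → ⊥-elim (¬d (divides-D n a b)))))
        (≼-reflexive (trans (Σ-zero X) (sym (⊗-zeroˡ _))))
      go (yes _) = begin
        Σ< X both  ≲⟨ Σ-reindex X (2 ^ (N ∸ suc J)) both (λ _ → ι 1) (λ s → ℕ.pred (2 ^ (p' + suc k) + q * s)) (λ _ _ → ι-nonneg 1)
                                                      (λ n _ → both-cases (λ n x → (∃[ s ] (s < 2 ^ (N ∸ suc J) × n ≡ ℕ.pred (2 ^ (p' + suc k) + q * s) × x ≼ ι 1)) ⊎ x ≼ ι 0) n (λ _ → inj₂) (hit n)) ⟩
        Σ< (2 ^ (N ∸ suc J)) (λ _ → ι 1)  ≡⟨ Σ-const (2 ^ (N ∸ suc J)) (ι 1) ⟩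
        ι (2 ^ (N ∸ suc J)) ⊗ ι 1  ≡⟨ ⊗-comm _ _ ⟩
        ι 1 ⊗ ι (2 ^ (N ∸ suc J))  ∎
        where
        open ≼-Reasoning
        hit : ∀ n → Rep (p' + suc k) q (suc n) → Rep p' q (suc n) → ∀ x → x ≼ ι 1 →
          (∃[ s ] (s < 2 ^ (N ∸ suc J) × n ≡ ℕ.pred (2 ^ (p' + suc k) + q * s) × x ≼ ι 1)) ⊎ x ≼ ι 0
        hit n ((pq , le) , s , s<κ , _ , _ , e) _ x x≼1 = inj₁ (s , ℕₚ.<-≤-trans s<κ (ℕₚ.^-monoʳ-≤ 2 (ℕₚ.∸-monoʳ-≤ N J<lg)) , cong ℕ.pred e , x≼1)
          where
          J<lg : J < suc (lg q)
          J<lg = 2^-cancel-< (ℕₚ.≤-<-trans le (lg-upper (prime≥1 pq)))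

    -- The coefficient c is chosen so that the bound for q ≠ q' reads κ q · κ q' · c: by `κ-product`
    -- the range T equals κ q κ q' / 2^(N - 1). This form lets the double sum over q and q' factor.
    s² c : Q
    s² = S D (2 ^ B) ⊗ S D (2 ^ B)
    c = ι 2048 ⊗ s² ⊗ inv (B * B) ⊗ inv (2 ^ (N ∸ 1))

    0≼c : ι 0 ≼ c
    0≼c = ⊗-nonneg (⊗-nonneg (⊗-nonneg (ι-nonneg 2048) (sq-nonneg (S D (2 ^ B)))) (inv-nonneg (B * B))) (inv-nonneg (2 ^ (N ∸ 1)))

    w : ℕ → Q
    w q = ind (Cand? q) ⊗ ι (κ q)

    0≼w : ∀ q → ι 0 ≼ w q
    0≼w q = ⊗-nonneg (ind-nonneg (Cand? q)) (ι-nonneg (κ q))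

    18B≤ : ∀ {g g'} → g < B → g' < B → 18 * B ≤ N ∸ suc g ∸ g'
    18B≤ {g} {g'} g<B g'<B = subst (18 * B ≤_) (sym (ℕₚ.∸-+-assoc N (suc g) g')) (ℕₚ.m+n≤o⇒m≤o∸n (18 * B)
      (ℕₚ.≤-trans (ℕₚ.+-monoʳ-≤ (18 * B) (ℕₚ.+-mono-≤ g<B (ℕₚ.<⇒≤ g'<B))) (ℕₚ.≤-trans (ℕₚ.≤-reflexive (e B)) 20B≤N)))
      where
      e : ∀ B → 18 * B + (B + B) ≡ 20 * B
      e = solve-∀

    κ-product : ∀ {g g'} → g < B → g' < B → 2 ^ (N ∸ suc g ∸ g') * 2 ^ (N ∸ 1) ≡ 2 ^ (N ∸ suc g) * 2 ^ (N ∸ suc g')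
    κ-product {g} {g'} g<B g'<B = trans (sym (ℕₚ.^-distribˡ-+-* 2 (N ∸ suc g ∸ g') (N ∸ 1))) (trans (cong (2 ^_) exp) (ℕₚ.^-distribˡ-+-* 2 (N ∸ suc g) (N ∸ suc g')))
      where
      B≤N : B ≤ N
      B≤N = ℕₚ.≤-trans (ℕₚ.m≤n*m B 20) 20B≤N
      B+B≤N : B + B ≤ N
      B+B≤N = ℕₚ.≤-trans (ℕₚ.≤-reflexive (cong (B +_) (sym (ℕₚ.+-identityʳ B)))) (ℕₚ.≤-trans (ℕₚ.*-monoˡ-≤ B {2} {20} (s≤s (s≤s z≤n))) 20B≤N)
      e₁ : N ∸ 1 ≡ g' + (N ∸ suc g')
      e₁ = sym (trans (cong (g' +_) (sym (ℕₚ.∸-+-assoc N 1 g'))) (ℕₚ.m+[n∸m]≡n {g'} {N ∸ 1} (ℕₚ.∸-monoˡ-≤ 1 (ℕₚ.≤-trans g'<B B≤N))))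
      g'≤ : g' ≤ N ∸ suc g
      g'≤ = ℕₚ.m+n≤o⇒m≤o∸n g' (ℕₚ.≤-trans (ℕₚ.+-mono-≤ (ℕₚ.<⇒≤ g'<B) g<B) B+B≤N)
      exp : N ∸ suc g ∸ g' + (N ∸ 1) ≡ (N ∸ suc g) + (N ∸ suc g')
      exp = trans (cong (N ∸ suc g ∸ g' +_) e₁) (trans (sym (ℕₚ.+-assoc (N ∸ suc g ∸ g') g' (N ∸ suc g'))) (cong (_+ (N ∸ suc g')) (ℕₚ.m∸n+n≡m g'≤)))

    distinct : ∀ q q' X → q < 2 ^ B → q' < 2 ^ B → ¬ q ≡ q' → Σ< X (Pair.both p' k q q') ≼ w q ⊗ w q' ⊗ c
    distinct q q' X q< q'< q≢q' = go (Cand? q) (Cand? q')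
      where
      open Pair p' k q q' using (both; both-cases)
      open ≼-Reasoning
      none : (∀ n → Rep (p' + suc k) q (suc n) → Rep p' q' (suc n) → ⊥) → ∀ x → ι 0 ≼ x → Σ< X both ≼ x
      none h x 0≼x = ≼-trans (Σ-mono X (λ n _ → both-cases (λ _ x → x ≼ ι 0) n (λ _ le → le) (λ a b _ _ → ⊥-elim (h n a b)))) (≼-trans (≼-reflexive (Σ-zero X)) 0≼x)
      go : ∀ (d : Dec (Cand q)) (e : Dec (Cand q')) → Σ< X both ≼ (ind d ⊗ ι (κ q)) ⊗ (ind e ⊗ ι (κ q')) ⊗ c
      go (no ¬c) e = none (λ n a _ → ¬c (proj₁ a)) _ (⊗-nonneg (⊗-nonneg (⊗-nonneg ≼-refl (ι-nonneg (κ q))) (⊗-nonneg (ind-nonneg e) (ι-nonneg (κ q')))) 0≼c)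
      go (yes _) (no ¬c) = none (λ n _ b → ¬c (proj₁ b)) _ (⊗-nonneg (⊗-nonneg (⊗-nonneg (ι-nonneg 1) (ι-nonneg (κ q))) (⊗-nonneg ≼-refl (ι-nonneg (κ q')))) 0≼c)
      go (yes (pq , _)) (yes (pq' , _)) = begin
        Σ< X both
          ≲⟨ ≼⇒≼inv⊗ (ℕₚ.*-mono-≤ 1≤B 1≤B) (≼-trans (≼-reflexive (⊗-comm _ _)) (Di.distinct-bound X)) ⟩
        inv (B * B) ⊗ (ι 2048 ⊗ ι T ⊗ s²)
          ≡⟨ cong (λ t → inv (B * B) ⊗ (ι 2048 ⊗ t ⊗ s²)) T≡ ⟩
        inv (B * B) ⊗ (ι 2048 ⊗ (ι (κ q) ⊗ ι (κ q') ⊗ inv (2 ^ (N ∸ 1))) ⊗ s²)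
          ≡⟨ solve 5 (λ b s i x y → b :* (# 2048 :* (x :* y :* i) :* s) := (# 1 :* x) :* (# 1 :* y) :* (# 2048 :* s :* b :* i)) refl (inv (B * B)) s² (inv (2 ^ (N ∸ 1))) (ι (κ q)) (ι (κ q')) ⟩
        (ι 1 ⊗ ι (κ q)) ⊗ (ι 1 ⊗ ι (κ q')) ⊗ c ∎
        where
        module Di = Pair.Distinct p' k q q' pq pq' q≢q' 1≤B (18B≤ (lg<B pq q<) (lg<B pq' q'<))
        T : ℕ
        T = 2 ^ (N ∸ suc (lg q) ∸ lg q')
        T≡ : ι T ≡ ι (κ q) ⊗ ι (κ q') ⊗ inv (2 ^ (N ∸ 1))
        T≡ = trans (sym (⊗-idʳ (ι T))) (trans (cong (ι T ⊗_) (sym (ι⊗inv (2^n≥1 (N ∸ 1))))) (trans (sym (⊗-assoc _ _ _))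
          (cong (_⊗ inv (2 ^ (N ∸ 1))) (trans (sym (ι-* T (2 ^ (N ∸ 1)))) (trans (cong ι (κ-product (lg<B pq q<) (lg<B pq' q'<))) (ι-* (κ q) (κ q')))))))

    few-divisors : Σ< (2 ^ B) (λ q → ind (prime-divisor? D q)) ≼ ι (suc k)
    few-divisors = ≼-trans (≼-reflexive (sym (ι-cnt (prime-divisor? D) (2 ^ B)))) (ι-mono (2^-cancel-≤ (ℕₚ.≤-trans
      (cnt-prime-divisors (prime-divisor? D) (2 ^ B) (2^-1≥1 (suc k) (s≤s z≤n)) (λ r _ (p , d) → p , d , prime≥2 p)) (ℕₚ.m∸n≤m (2 ^ suc k) 1))))

  r : ℕ → ℕ → Q
  r p n = Σ< (2 ^ B) (λ q → ind (Rep? p q (suc n)))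

  0≼r : ∀ p n → ι 0 ≼ r p n
  0≼r p n = Σ-nonneg (2 ^ B) (λ q _ → ind-nonneg (Rep? p q (suc n)))

  -- Since q < 2^B < s, the number q is the smaller prime factor of n + 1 - 2^p, hence determined by
  -- p and n.
  r≼1 : ∀ p n → r p n ≼ ι 1
  r≼1 p n = ind-unique (λ q → Rep? p q (suc n)) (2 ^ B) uniq
    where
    uniq : ∀ q q' → q < 2 ^ B → q' < 2 ^ B → Rep p q (suc n) → Rep p q' (suc n) → q ≡ q'
    uniq q q' q< q'< ((pq , _) , s , _ , _ , _ , e) ((pq' , _) , s' , _ , ps' , B<s' , e') =
      case euclidsLemma q' s' pq (subst (q ∣_) (ℕₚ.+-cancelˡ-≡ (2 ^ p) _ _ (trans (sym e) e')) (m∣m*n s)) of λ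
        { (inj₁ d) → prime∣prime pq pq' d
        ; (inj₂ d) → ⊥-elim (ℕₚ.<⇒≱ (ℕₚ.<-trans q< B<s') (ℕₚ.≤-reflexive (sym (prime∣prime pq ps' d)))) }

  -- The first term collects the pairs q = q', where q is one of at most k + 1 prime divisors of
  -- 2^(k+1) - 1. The pairs q ≠ q' factor into the square of `kq`.
  correlation : ∀ p' k X → Σ< X (λ n → r (p' + suc k) n ⊗ r p' n)
    ≼ ι (suc k) ⊗ ι (2 ^ (N ∸ suc J)) ⊕ kq (2 ^ B) ⊗ kq (2 ^ B) ⊗ c p' k
  correlation p' k X = begin
    Σ< X (λ n → r p n ⊗ r p' n)
      ≡⟨ Σ-cong X (λ n _ → Σ-⊗Σ Z Z _ _) ⟩
    Σ< X (λ n → Σ< Z (λ q → Σ< Z (λ q' → both q q' n)))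
      ≡⟨ Σ-swap X Z _ ⟩
    Σ< Z (λ q → Σ< X (λ n → Σ< Z (λ q' → both q q' n)))
      ≡⟨ Σ-cong Z (λ q _ → Σ-swap X Z _) ⟩
    Σ< Z (λ q → Σ< Z (λ q' → Σ< X (both q q')))
      ≲⟨ Σ-mono Z (λ q q< → Σ-mono Z (λ q' q'< → each q q' q< q'< (q ℕ.≟ q'))) ⟩
    Σ< Z (λ q → Σ< Z (λ q' → ind (q ℕ.≟ q') ⊗ x q ⊕ w′ q ⊗ w′ q' ⊗ c′))
      ≡⟨ trans (Σ-cong Z (λ q _ → Σ-⊕ Z _ _)) (Σ-⊕ Z _ _) ⟩
    Σ< Z (λ q → Σ< Z (λ q' → ind (q ℕ.≟ q') ⊗ x q)) ⊕ Σ< Z (λ q → Σ< Z (λ q' → w′ q ⊗ w′ q' ⊗ c′))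
      ≲⟨ ⊕-mono (Σ-mono Z (λ q _ → Σ-single Z _ q (x q) (0≼x q) (λ q' _ → diag q q' (q ℕ.≟ q')))) (≼-reflexive prod) ⟩
    Σ< Z x ⊕ kq Z ⊗ kq Z ⊗ c′
      ≲⟨ ⊕-mono (≼-trans (≼-reflexive (Σ-⊗ʳ Z y _)) (⊗-monoʳ (ι-nonneg (2 ^ (N ∸ suc J))) (few-divisors p' k))) ≼-refl ⟩
    ι (suc k) ⊗ y ⊕ kq Z ⊗ kq Z ⊗ c′ ∎
    where
    open ≼-Reasoning
    p Z : ℕ
    p = p' + suc k
    Z = 2 ^ B
    y c′ : Q
    y = ι (2 ^ (N ∸ suc J))
    c′ = c p' k
    w′ : ℕ → Q
    w′ = w p' k
    both : ℕ → ℕ → ℕ → Q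
    both q q' = Pair.both p' k q q'
    x : ℕ → Q
    x q = ind (prime-divisor? (D p' k) q) ⊗ y
    0≼x : ∀ q → ι 0 ≼ x q
    0≼x q = ⊗-nonneg (ind-nonneg (prime-divisor? (D p' k) q)) (ι-nonneg (2 ^ (N ∸ suc J)))
    0≼wwc : ∀ q q' → ι 0 ≼ w′ q ⊗ w′ q' ⊗ c′
    0≼wwc q q' = ⊗-nonneg (⊗-nonneg (0≼w p' k q) (0≼w p' k q')) (0≼c p' k)
    each : ∀ q q' → q < Z → q' < Z → (d : Dec (q ≡ q')) → Σ< X (both q q') ≼ ind d ⊗ x q ⊕ w′ q ⊗ w′ q' ⊗ c′
    each q q' q< q'< (yes refl) = ≼-trans (equal-bound p' k q X) (≼-by _ (0≼wwc q q) (cong (_⊕ w′ q ⊗ w′ q ⊗ c′) (sym (⊗-idˡ (x q)))))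
    each q q' q< q'< (no ne) = ≼-trans (distinct p' k q q' X q< q'< ne) (≼-by (ι 0 ⊗ x q) (≼-reflexive (sym (⊗-zeroˡ _))) (⊕-comm _ _))
    diag : ∀ q q' (d : Dec (q ≡ q')) → (q' ≡ q × ind d ⊗ x q ≼ x q) ⊎ ind d ⊗ x q ≼ ι 0
    diag q q' (yes e) = inj₁ (sym e , ≼-reflexive (⊗-idˡ _))
    diag q q' (no _) = inj₂ (≼-reflexive (⊗-zeroˡ _))
    prod : Σ< Z (λ q → Σ< Z (λ q' → w′ q ⊗ w′ q' ⊗ c′)) ≡ kq Z ⊗ kq Z ⊗ c′
    prod = trans (Σ-cong Z (λ q _ → Σ-⊗ʳ Z c′ _)) (trans (Σ-⊗ʳ Z c′ _) (cong (_⊗ c′) (sym (Σ-⊗Σ Z Z w′ w′))))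

-- The second moment of the number of representations

Σ-square : ∀ n (f : ℕ → Q) → Σ< n f ⊗ Σ< n f ≡ Σ< n (λ i → f i ⊗ f i) ⊕ ι 2 ⊗ Σ< n (λ i → Σ< i (λ j → f i ⊗ f j))
Σ-square zero f = solve 0 (# 0 :* # 0 := # 0 :+ # 2 :* # 0) refl
Σ-square (suc n) f = begin
  (s ⊕ x) ⊗ (s ⊕ x)  ≡⟨ solve 2 (λ s x → (s :+ x) :* (s :+ x) := s :* s :+ (x :* x :+ # 2 :* (x :* s))) refl s x ⟩
  s ⊗ s ⊕ (x ⊗ x ⊕ ι 2 ⊗ (x ⊗ s))  ≡⟨ cong₂ (λ a b → a ⊕ (x ⊗ x ⊕ ι 2 ⊗ b)) (Σ-square n f) (sym (Σ-⊗ˡ n x f)) ⟩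
  d ⊕ ι 2 ⊗ o ⊕ (x ⊗ x ⊕ ι 2 ⊗ t)  ≡⟨ solve 4 (λ d o x t → d :+ # 2 :* o :+ (x :+ # 2 :* t) := d :+ x :+ # 2 :* (o :+ t)) refl d o (x ⊗ x) t ⟩
  d ⊕ x ⊗ x ⊕ ι 2 ⊗ (o ⊕ t)  ∎
  where
  open ≡-Reasoning
  s x d o t : Q
  s = Σ< n f
  x = f n
  d = Σ< n (λ i → f i ⊗ f i)
  o = Σ< n (λ i → Σ< i (λ j → f i ⊗ f j))
  t = Σ< n (λ j → f n ⊗ f j)

-- Grouping pairs j < i by the difference i - j = k + 1 isolates the variable on which the local
-- factors depend. Letting j run up to M only adds non-negative terms.
Σ-triangle : ∀ M (h : ℕ → ℕ → Q) → (∀ i j → ι 0 ≼ h i j) →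
  Σ< M (λ i → Σ< i (h i)) ≼ Σ< M (λ k → Σ< M (λ j → h (j + suc k) j))
Σ-triangle M h 0≼h = begin
  Σ< M (λ i → Σ< i (h i))  ≡⟨ Σ-cong M (λ i i<M → sym (Σ-ind< M i (ℕₚ.<⇒≤ i<M) (h i))) ⟩
  Σ< M (λ i → Σ< M (λ j → ind (j ℕ.<? i) ⊗ h i j))  ≡⟨ Σ-swap M M _ ⟩
  Σ< M (λ j → Σ< M (λ i → ind (j ℕ.<? i) ⊗ h i j))  ≲⟨ Σ-mono M (λ j _ → Σ-reindex M M _ _ (λ k → j + suc k) (λ k _ → 0≼h (j + suc k) j) (λ i i<M → each i j i<M (j ℕ.<? i))) ⟩
  Σ< M (λ j → Σ< M (λ k → h (j + suc k) j))  ≡⟨ Σ-swap M M _ ⟩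
  Σ< M (λ k → Σ< M (λ j → h (j + suc k) j))  ∎
  where
  open ≼-Reasoning
  each : ∀ i j → i < M → (d : Dec (j < i)) → (∃[ k ] (k < M × i ≡ j + suc k × ind d ⊗ h i j ≼ h (j + suc k) j)) ⊎ ind d ⊗ h i j ≼ ι 0
  each i j i<M (no _) = inj₂ (≼-reflexive (⊗-zeroˡ _))
  each i j i<M (yes j<i) = inj₁ (i ∸ suc j , ℕₚ.≤-<-trans (ℕₚ.m∸n≤m i (suc j)) i<M , e , ≼-reflexive (trans (⊗-idˡ _) (cong (λ i → h i j) e)))
    where
    e : i ≡ j + suc (i ∸ suc j)
    e = sym (trans (ℕₚ.+-suc j (i ∸ suc j)) (ℕₚ.m+[n∸m]≡n j<i))

pc-large : ∀ z n → ι (pc n) ≼ Σ< n (λ p → ind (LargePrime? z p)) ⊕ ι (suc z)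
pc-large z n = begin
  ι (pc n)  ≡⟨ ι-cnt prime? n ⟩
  Σ< n (λ p → ind (prime? p))  ≲⟨ Σ-mono n (λ p _ → ind-or (prime? p) (LargePrime? z p) (p ℕ.<? suc z) (λ pp → split p pp (z ℕ.<? p))) ⟩
  Σ< n (λ p → ind (LargePrime? z p) ⊕ ind (p ℕ.<? suc z))  ≡⟨ Σ-⊕ n _ _ ⟩
  Σ< n (λ p → ind (LargePrime? z p)) ⊕ Σ< n (λ p → ind (p ℕ.<? suc z))  ≲⟨ ⊕-mono ≼-refl (Σ-reindex n (suc z) _ (λ _ → ι 1) (λ k → k) (λ _ _ → ι-nonneg 1) (λ p _ → small p (p ℕ.<? suc z))) ⟩
  Σ< n (λ p → ind (LargePrime? z p)) ⊕ Σ< (suc z) (λ _ → ι 1)  ≡⟨ cong (Σ< n (λ p → ind (LargePrime? z p)) ⊕_) (trans (Σ-const (suc z) (ι 1)) (⊗-idʳ _)) ⟩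
  Σ< n (λ p → ind (LargePrime? z p)) ⊕ ι (suc z)  ∎
  where
  open ≼-Reasoning
  split : ∀ p → Prime p → Dec (z < p) → (Prime p × z < p) ⊎ p < suc z
  split p pp (yes z<p) = inj₁ (pp , z<p)
  split p pp (no ¬z<p) = inj₂ (s≤s (ℕₚ.≮⇒≥ ¬z<p))
  small : ∀ p (d : Dec (p < suc z)) → (∃[ k ] (k < suc z × p ≡ k × ind d ≼ ι 1)) ⊎ ind d ≼ ι 0
  small p (yes h) = inj₁ (p , h , refl , ≼-refl)
  small p (no _) = inj₂ ≼-refl

module SecondMoment (ℓ B J M N : ℕ) (10≤ℓ : 10 ≤ ℓ) (J≡ : J ≡ 2 ^ ℓ) (B≡ : B ≡ 2 ^ (18 * ℓ)) (M≡ : M ≡ 32 * B) (M≤N : M ≤ N) where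

  1≤ℓ : 1 ≤ ℓ
  1≤ℓ = ℕₚ.≤-trans (s≤s z≤n) 10≤ℓ

  1≤B : 1 ≤ B
  1≤B = subst (1 ≤_) (sym B≡) (2^n≥1 (18 * ℓ))

  2≤J : 2 ≤ J
  2≤J = subst (2 ≤_) (sym J≡) (ℕₚ.^-monoʳ-≤ 2 1≤ℓ)

  20B≤N : 20 * B ≤ N
  20B≤N = ℕₚ.≤-trans (ℕₚ.*-monoˡ-≤ B {20} {32} (ℕₚ.m≤m+n 20 12)) (subst (_≤ N) M≡ M≤N)

  open Moments J N B 2≤J 1≤B 20B≤N public

  -- Exponents p ≤ J are discarded because `prime-pairs`, sifting up to J = 2^ℓ, controls only
  -- larger primes. Their cost is estimated in `small-primes`.
  a : ℕ → Q
  a p = ind (LargePrime? J p)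

  0≼a : ∀ p → ι 0 ≼ a p
  0≼a p = ind-nonneg (LargePrime? J p)

  x : ℕ → ℕ → Q
  x n p = a p ⊗ r p n

  0≼x : ∀ n p → ι 0 ≼ x n p
  0≼x n p = ⊗-nonneg (0≼a p) (0≼r p n)

  x≼1 : ∀ n p → x n p ≼ ι 1
  x≼1 n p = ≼-trans (⊗-mono (0≼a p) (0≼r p n) (ind≼1 (LargePrime? J p)) (r≼1 p n)) (≼-reflexive (⊗-idˡ (ι 1)))

  R : ℕ → Q
  R n = Σ< M (x n)

  0≼R : ∀ n → ι 0 ≼ R n
  0≼R n = Σ-nonneg M (λ p _ → 0≼x n p)

  J+B : ∃[ m ] m + J ≡ B
  J+B = B ∸ J , ℕₚ.m∸n+n≡m (subst₂ _≤_ (sym J≡) (sym B≡) (ℕₚ.^-monoʳ-≤ 2 (ℕₚ.m≤n*m ℓ 18)))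

  B≤N : B ≤ N
  B≤N = ℕₚ.≤-trans (ℕₚ.m≤n*m B 20) 20B≤N

  inv-ℓ² : inv (ℓ * ℓ) ⊗ (ι ℓ ⊗ ι ℓ) ≡ ι 1
  inv-ℓ² = trans (cong (inv (ℓ * ℓ) ⊗_) (sym (ι-* ℓ ℓ))) (trans (⊗-comm _ _) (ι⊗inv (ℕₚ.*-mono-≤ 1≤ℓ 1≤ℓ)))

  -- The sum of 1/i over J ≤ i < B is at most the harmonic sum up to 2^(18ℓ), hence at most 18ℓ + 1
  -- ≤ 19ℓ; `kq-upper` doubles it.
  kq≼ : kq (2 ^ B) ≼ ι 38 ⊗ ι ℓ ⊗ Y
  kq≼ = begin
    kq (2 ^ B)  ≡⟨ cong (λ b → kq (2 ^ b)) (proj₂ J+B) ⟨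
    kq (2 ^ (m + J))  ≲⟨ kq-upper m (ℕₚ.≤-trans (ℕₚ.≤-reflexive (proj₂ J+B)) B≤N) ⟩
    Y ⊗ (ι 2 ⊗ Σ< m (λ i → inv (i + J)))  ≲⟨ ⊗-monoˡ 0≼Y (⊗-monoˡ (ι-nonneg 2) sum≼) ⟩
    Y ⊗ (ι 2 ⊗ (ι 19 ⊗ ι ℓ))  ≡⟨ solve 2 (λ y l → y :* (# 2 :* (# 19 :* l)) := # 38 :* l :* y) refl Y (ι ℓ) ⟩
    ι 38 ⊗ ι ℓ ⊗ Y  ∎
    where
    open ≼-Reasoning
    m : ℕ
    m = proj₁ J+B
    pred-J : ∀ i → i + J ≡ suc (ℕ.pred J + i)
    pred-J i = trans (ℕₚ.+-comm i J) (cong (_+ i) (sym (ℕₚ.suc-pred J {{ℕ.>-nonZero (ℕₚ.<⇒≤ 2≤J)}})))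
    pred≤ : ℕ.pred J + m ≤ B
    pred≤ = ℕₚ.≤-trans (ℕₚ.+-monoˡ-≤ m (ℕₚ.pred[n]≤n {J})) (ℕₚ.≤-reflexive (trans (ℕₚ.+-comm J m) (proj₂ J+B)))
    sum≼ : Σ< m (λ i → inv (i + J)) ≼ ι 19 ⊗ ι ℓ
    sum≼ = begin
      Σ< m (λ i → inv (i + J))  ≡⟨ Σ-cong m (λ i _ → cong inv (pred-J i)) ⟩
      Σ< m (λ i → inv (suc (ℕ.pred J + i)))  ≲⟨ ≼-by (harmonic (ℕ.pred J)) (Σ-nonneg (ℕ.pred J) (λ k _ → inv-nonneg (suc k))) (trans (⊕-comm _ _) (sym (Σ-split (ℕ.pred J) m _))) ⟩
      harmonic (ℕ.pred J + m)  ≲⟨ Σ-extend pred≤ (λ k → inv-nonneg (suc k)) ⟩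
      harmonic B  ≡⟨ cong harmonic B≡ ⟩
      harmonic (2 ^ (18 * ℓ))  ≲⟨ harmonic-upper (18 * ℓ) ⟩
      ι (suc (18 * ℓ))  ≲⟨ ι-mono (ℕₚ.+-monoˡ-≤ (18 * ℓ) 1≤ℓ) ⟩
      ι (ℓ + 18 * ℓ)  ≡⟨ ι-* 19 ℓ ⟩
      ι 19 ⊗ ι ℓ  ∎

  pairs : ℕ → Q
  pairs k = Σ< M (λ p → a (p + suc k) ⊗ a p)

  0≼pairs : ∀ k → ι 0 ≼ pairs k
  0≼pairs k = Σ-nonneg M (λ p _ → ⊗-nonneg (0≼a (p + suc k)) (0≼a p))

  pairs≼M : ∀ k → pairs k ≼ ι M
  pairs≼M k = ≼-trans (Σ-mono M (λ p _ → ≼-trans (⊗-mono (0≼a (p + suc k)) (0≼a p) (ind≼1 (LargePrime? J (p + suc k))) (ind≼1 (LargePrime? J p))) (≼-reflexive (⊗-idˡ (ι 1)))))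
    (≼-reflexive (trans (Σ-const M (ι 1)) (⊗-idʳ _)))

  pairs≼ : ∀ k → pairs k ≼ inv (ℓ * ℓ) ⊗ (ι 128 ⊗ ι M ⊗ (S (suc k) J ⊗ S (suc k) J))
  pairs≼ k = ≼⇒≼inv⊗ (ℕₚ.*-mono-≤ 1≤ℓ 1≤ℓ) (≼-trans (≼-reflexive (trans (⊗-comm _ _) (cong (_⊗ ι (ℓ * ℓ))
      (Σ-cong M (λ p _ → trans (⊗-comm _ _) (cong (λ n → a p ⊗ a n) (ℕₚ.+-comm p (suc k))))))))
    (subst (λ z → Σ< M (λ p → ind (LargePrime? z p) ⊗ ind (LargePrime? z (suc k + p))) ⊗ ι (ℓ * ℓ) ≼ ι 128 ⊗ ι M ⊗ (S (suc k) z ⊗ S (suc k) z))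
      (sym J≡) (prime-pairs ℓ 1≤ℓ M D≤M k)))
    where
    D≤M : 2 ^ (18 * ℓ) ≤ M
    D≤M = subst₂ _≤_ B≡ (sym M≡) (ℕₚ.m≤n*m B 32)

  J≤2^B : J ≤ 2 ^ B
  J≤2^B = ℕₚ.≤-trans (ℕₚ.m≤n+m J (proj₁ J+B)) (ℕₚ.≤-trans (ℕₚ.≤-reflexive (proj₂ J+B)) (ℕₚ.<⇒≤ (n<2^n B)))

  -- Both k + 1 and 2^(k+1) - 1 divide K (k + 1), and the smaller sifting limit J may be raised to
  -- 2^B.
  local-factors : ∀ k → s² 0 k ⊗ (S (suc k) J ⊗ S (suc k) J) ≼ pow4 (S (K (suc k)) (2 ^ B))
  local-factors k = ⊗-mono (sq-nonneg (S (2 ^ suc k ∸ 1) (2 ^ B))) (sq-nonneg (S (suc k) J))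
    (⊗-mono (0≼S (2 ^ suc k ∸ 1) (2 ^ B)) (0≼S (2 ^ suc k ∸ 1) (2 ^ B)) s≼ s≼) (⊗-mono (0≼S (suc k) J) (0≼S (suc k) J) t≼ t≼)
    where
    s≼ : S (2 ^ suc k ∸ 1) (2 ^ B) ≼ S (K (suc k)) (2 ^ B)
    s≼ = S-∣ (n∣m*n (suc k)) (2 ^ B)
    t≼ : S (suc k) J ≼ S (K (suc k)) (2 ^ B)
    t≼ = ≼-trans (S-mono (suc k) J≤2^B) (S-∣ (m∣m*n (2 ^ suc k ∸ 1)) (2 ^ B))

  off-diagonal : ℕ → Q
  off-diagonal X = Σ< X (λ n → Σ< M (λ p → Σ< p (λ p' → x n p ⊗ x n p')))

  off-diagonal-split : ∀ X → off-diagonal X ≼ Σ< M (λ k → pairs k ⊗ (ι M ⊗ ι (2 ^ (N ∸ suc J)))) ⊕ Σ< M (λ k → pairs k ⊗ (kq (2 ^ B) ⊗ kq (2 ^ B) ⊗ c 0 k))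
  off-diagonal-split X = begin
    off-diagonal X
      ≲⟨ Σ-mono X (λ n _ → Σ-triangle M (λ p p' → x n p ⊗ x n p') (λ p p' → ⊗-nonneg (0≼x n p) (0≼x n p'))) ⟩
    Σ< X (λ n → Σ< M (λ k → Σ< M (λ p' → x n (p' + suc k) ⊗ x n p')))
      ≡⟨ trans (Σ-swap X M _) (Σ-cong M (λ k _ → Σ-swap X M _)) ⟩
    Σ< M (λ k → Σ< M (λ p' → Σ< X (λ n → x n (p' + suc k) ⊗ x n p')))
      ≲⟨ Σ-mono M (λ k k<M → Σ-mono M (λ p' _ → each k k<M p')) ⟩
    Σ< M (λ k → Σ< M (λ p' → a (p' + suc k) ⊗ a p' ⊗ β′ k))
      ≡⟨ Σ-cong M (λ k _ → trans (Σ-⊗ʳ M (β′ k) _) (⊗-distribˡ _ _ _)) ⟩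
    Σ< M (λ k → pairs k ⊗ (ι M ⊗ y) ⊕ pairs k ⊗ (kq (2 ^ B) ⊗ kq (2 ^ B) ⊗ c 0 k))
      ≡⟨ Σ-⊕ M _ _ ⟩
    Σ< M (λ k → pairs k ⊗ (ι M ⊗ y)) ⊕ Σ< M (λ k → pairs k ⊗ (kq (2 ^ B) ⊗ kq (2 ^ B) ⊗ c 0 k)) ∎
    where
    open ≼-Reasoning
    y : Q
    y = ι (2 ^ (N ∸ suc J))
    β′ : ℕ → Q
    β′ k = ι M ⊗ y ⊕ kq (2 ^ B) ⊗ kq (2 ^ B) ⊗ c 0 k
    each : ∀ k → k < M → ∀ p' → Σ< X (λ n → x n (p' + suc k) ⊗ x n p') ≼ a (p' + suc k) ⊗ a p' ⊗ β′ k
    each k k<M p' = begin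
      Σ< X (λ n → x n p ⊗ x n p')  ≡⟨ Σ-cong X (λ n _ → solve 4 (λ a b c d → a :* b :* (c :* d) := a :* c :* (b :* d)) refl (a p) (r p n) (a p') (r p' n)) ⟩
      Σ< X (λ n → a p ⊗ a p' ⊗ (r p n ⊗ r p' n))  ≡⟨ Σ-⊗ˡ X (a p ⊗ a p') _ ⟩
      a p ⊗ a p' ⊗ Σ< X (λ n → r p n ⊗ r p' n)  ≲⟨ ⊗-monoˡ (⊗-nonneg (0≼a p) (0≼a p')) (≼-trans (correlation p' k X) (⊕-mono (⊗-monoʳ (ι-nonneg (2 ^ (N ∸ suc J))) (ι-mono k<M)) ≼-refl)) ⟩
      a p ⊗ a p' ⊗ β′ k  ∎
      where
      p : ℕ
      p = p' + suc k

  M≡2^ : M ≡ 2 ^ (5 + 18 * ℓ)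
  M≡2^ = trans M≡ (trans (cong (32 *_) B≡) (sym (ℕₚ.^-distribˡ-+-* 2 5 (18 * ℓ))))

  -- The left side is the exponent of M³, as M = 2^(5 + 18ℓ). The induction starts at ℓ = 10 with
  -- 555 ≤ 1024.
  54ℓ+15≤J : 15 + 54 * ℓ ≤ J
  54ℓ+15≤J = subst (15 + 54 * ℓ ≤_) (sym J≡) (go (ℕₚ.≤⇒≤′ 10≤ℓ))
    where
    step : ∀ n x → 1 ≤ n → 15 + 54 * n ≤ x → 15 + 54 * suc n ≤ 2 * x
    step n x 1≤n h = begin
      15 + 54 * suc n  ≡⟨ e n ⟩
      15 + 54 * n + 54  ≤⟨ ℕₚ.+-mono-≤ h (ℕₚ.≤-trans (ℕₚ.*-monoʳ-≤ 54 1≤n) (ℕₚ.≤-trans (ℕₚ.m≤n+m (54 * n) 15) h)) ⟩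
      x + x  ≡⟨ cong (x +_) (ℕₚ.+-identityʳ x) ⟨
      2 * x  ∎
      where
      open ℕₚ.≤-Reasoning
      e : ∀ n → 15 + 54 * suc n ≡ 15 + 54 * n + 54
      e = solve-∀
    go : ∀ {n} → 10 ℕ.≤′ n → 15 + 54 * n ≤ 2 ^ n
    go (ℕ.≤′-reflexive refl) = ℕₚ.m≤m+n 555 469
    go (ℕ.≤′-step {n = n} h) = step n (2 ^ n) (ℕₚ.≤-trans (s≤s z≤n) (ℕₚ.≤′⇒≤ h)) (go h)

  M³≤ : M * (M * M) ≤ 2 ^ J
  M³≤ = begin
    M * (M * M)  ≡⟨ cong (λ m → m * (m * m)) M≡2^ ⟩
    2 ^ m * (2 ^ m * 2 ^ m)  ≡⟨ cong (2 ^ m *_) (ℕₚ.^-distribˡ-+-* 2 m m) ⟨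
    2 ^ m * 2 ^ (m + m)  ≡⟨ ℕₚ.^-distribˡ-+-* 2 m (m + m) ⟨
    2 ^ (m + (m + m))  ≤⟨ ℕₚ.^-monoʳ-≤ 2 (ℕₚ.≤-trans (ℕₚ.≤-reflexive (e ℓ)) 54ℓ+15≤J) ⟩
    2 ^ J  ∎
    where
    open ℕₚ.≤-Reasoning
    m : ℕ
    m = 5 + 18 * ℓ
    e : ∀ ℓ → 5 + 18 * ℓ + (5 + 18 * ℓ + (5 + 18 * ℓ)) ≡ 15 + 54 * ℓ
    e = solve-∀

  J<N : suc J ≤ N
  J<N = ℕₚ.≤-trans (ℕₚ.+-mono-≤ 1≤B (ℕₚ.≤-trans (ℕₚ.m≤n+m J (proj₁ J+B)) (ℕₚ.≤-reflexive (proj₂ J+B))))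
    (ℕₚ.≤-trans (ℕₚ.≤-reflexive (cong (B +_) (sym (ℕₚ.+-identityʳ B)))) (ℕₚ.≤-trans (ℕₚ.*-monoˡ-≤ B {2} {20} (s≤s (s≤s z≤n))) 20B≤N))

  -- Trivial bounds suffice: M differences, at most M pairs for each, and at most M primes q
  -- dividing 2^(k+1) - 1 cost M³ ≤ 2^J, the factor by which q ≥ 2^J shortens the range of s.
  equal-part : Σ< M (λ k → pairs k ⊗ (ι M ⊗ ι (2 ^ (N ∸ suc J)))) ≼ Y
  equal-part = begin
    Σ< M (λ k → pairs k ⊗ (ι M ⊗ y))  ≲⟨ Σ-mono M (λ k _ → ⊗-monoʳ (⊗-nonneg (ι-nonneg M) (ι-nonneg (2 ^ (N ∸ suc J)))) (pairs≼M k)) ⟩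
    Σ< M (λ _ → ι M ⊗ (ι M ⊗ y))  ≡⟨ Σ-const M _ ⟩
    ι M ⊗ (ι M ⊗ (ι M ⊗ y))  ≡⟨ solve 2 (λ m y → m :* (m :* (m :* y)) := (m :* (m :* m)) :* y) refl (ι M) y ⟩
    (ι M ⊗ (ι M ⊗ ι M)) ⊗ y  ≡⟨ cong₂ _⊗_ (trans (cong (ι M ⊗_) (sym (ι-* M M))) (sym (ι-* M (M * M)))) (2^-split J J<N) ⟩
    ι (M * (M * M)) ⊗ (Y ⊗ inv (2 ^ J))  ≲⟨ ⊗-monoʳ (⊗-nonneg 0≼Y (inv-nonneg (2 ^ J))) (ι-mono M³≤) ⟩
    ι (2 ^ J) ⊗ (Y ⊗ inv (2 ^ J))  ≡⟨ solve 3 (λ j y v → j :* (y :* v) := (j :* v) :* y) refl (ι (2 ^ J)) Y (inv (2 ^ J)) ⟩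
    (ι (2 ^ J) ⊗ inv (2 ^ J)) ⊗ Y  ≡⟨ trans (cong (_⊗ Y) (ι⊗inv (2^n≥1 J))) (⊗-idˡ Y) ⟩
    Y  ∎
    where
    open ≼-Reasoning
    y : Q
    y = ι (2 ^ (N ∸ suc J))

  -- All parameters cancel: M/ℓ² from the pairs of exponents, (38ℓY)² from q and q', 1/(B² Y) from
  -- the sieve and C M from the average, with M = 32 B. What remains is 38² = 1444, 128 · 2048 =
  -- 262144 and 32² = 1024.
  distinct-part : ∀ C → (∀ M z → Σ< M (λ k → pow4 (S (K (suc k)) z)) ≼ ι C ⊗ ι M) →
    Σ< M (λ k → pairs k ⊗ (kq (2 ^ B) ⊗ kq (2 ^ B) ⊗ c 0 k)) ≼ ι 1444 ⊗ ι 262144 ⊗ ι 1024 ⊗ ι C ⊗ Y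
  distinct-part C hC = begin
    Σ< M (λ k → pairs k ⊗ (k′ ⊗ k′ ⊗ c 0 k))
      ≲⟨ Σ-mono M (λ k _ → each k) ⟩
    Σ< M (λ k → E ⊗ pow4 (S (K (suc k)) (2 ^ B)))
      ≡⟨ Σ-⊗ˡ M E _ ⟩
    E ⊗ Σ< M (λ k → pow4 (S (K (suc k)) (2 ^ B)))
      ≲⟨ ⊗-monoˡ 0≼E (hC M (2 ^ B)) ⟩
    iℓ ⊗ (ι 128 ⊗ ι M) ⊗ (k″ ⊗ k″ ⊗ (ι 2048 ⊗ iB ⊗ iY)) ⊗ (ι C ⊗ ι M)
      ≡⟨ cong (λ m → iℓ ⊗ (ι 128 ⊗ m) ⊗ (k″ ⊗ k″ ⊗ (ι 2048 ⊗ iB ⊗ iY)) ⊗ (ι C ⊗ m)) (trans (cong ι M≡) (ι-* 32 B)) ⟩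
    iℓ ⊗ (ι 128 ⊗ (ι 32 ⊗ ι B)) ⊗ (k″ ⊗ k″ ⊗ (ι 2048 ⊗ iB ⊗ iY)) ⊗ (ι C ⊗ (ι 32 ⊗ ι B))
      ≡⟨ solve 7 (λ il b l y ib iy c → il :* (# 128 :* (# 32 :* b)) :* ((# 38 :* l :* y) :* (# 38 :* l :* y) :* (# 2048 :* ib :* iy)) :* (c :* (# 32 :* b))
           := # 1444 :* # 262144 :* # 1024 :* c :* ((il :* (l :* l)) :* (ib :* (b :* b)) :* (iy :* y) :* y)) refl iℓ (ι B) (ι ℓ) Y iB iY (ι C) ⟩
    ι 1444 ⊗ ι 262144 ⊗ ι 1024 ⊗ ι C ⊗ ((iℓ ⊗ (ι ℓ ⊗ ι ℓ)) ⊗ (iB ⊗ (ι B ⊗ ι B)) ⊗ (iY ⊗ Y) ⊗ Y)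
      ≡⟨ cong (ι 1444 ⊗ ι 262144 ⊗ ι 1024 ⊗ ι C ⊗_) (trans (cong₂ (λ u v → u ⊗ v ⊗ (iY ⊗ Y) ⊗ Y) inv-ℓ² inv-B²) (trans (cong (λ u → ι 1 ⊗ ι 1 ⊗ u ⊗ Y) (trans (⊗-comm _ _) (ι⊗inv (2^n≥1 (N ∸ 1)))))
           (solve 1 (λ y → # 1 :* # 1 :* # 1 :* y := y) refl Y))) ⟩
    ι 1444 ⊗ ι 262144 ⊗ ι 1024 ⊗ ι C ⊗ Y ∎
    where
    open ≼-Reasoning
    k′ k″ iℓ iB iY E : Q
    k′ = kq (2 ^ B)
    k″ = ι 38 ⊗ ι ℓ ⊗ Y
    iℓ = inv (ℓ * ℓ)
    iB = inv (B * B)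
    iY = inv (2 ^ (N ∸ 1))
    E = iℓ ⊗ (ι 128 ⊗ ι M) ⊗ (k″ ⊗ k″ ⊗ (ι 2048 ⊗ iB ⊗ iY))
    0≼F : ι 0 ≼ ι 2048 ⊗ iB ⊗ iY
    0≼F = ⊗-nonneg (⊗-nonneg (ι-nonneg 2048) (inv-nonneg (B * B))) (inv-nonneg (2 ^ (N ∸ 1)))
    0≼E : ι 0 ≼ E
    0≼E = ⊗-nonneg (⊗-nonneg (inv-nonneg (ℓ * ℓ)) (⊗-nonneg (ι-nonneg 128) (ι-nonneg M))) (⊗-nonneg (sq-nonneg k″) 0≼F)
    inv-B² : iB ⊗ (ι B ⊗ ι B) ≡ ι 1
    inv-B² = trans (cong (iB ⊗_) (sym (ι-* B B))) (trans (⊗-comm _ _) (ι⊗inv (ℕₚ.*-mono-≤ 1≤B 1≤B)))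
    each : ∀ k → pairs k ⊗ (k′ ⊗ k′ ⊗ c 0 k) ≼ E ⊗ pow4 (S (K (suc k)) (2 ^ B))
    each k = begin
      pairs k ⊗ (k′ ⊗ k′ ⊗ c 0 k)
        ≲⟨ ⊗-mono (0≼pairs k) (⊗-nonneg (sq-nonneg k′) (0≼c 0 k)) (pairs≼ k) (⊗-monoʳ (0≼c 0 k) (⊗-mono (0≼kq (2 ^ B)) (0≼kq (2 ^ B)) kq≼ kq≼)) ⟩
      iℓ ⊗ (ι 128 ⊗ ι M ⊗ (t ⊗ t)) ⊗ (k″ ⊗ k″ ⊗ (ι 2048 ⊗ s² 0 k ⊗ iB ⊗ iY))
        ≡⟨ solve 7 (λ il m t kk s ib iy → il :* (# 128 :* m :* t) :* (kk :* (# 2048 :* s :* ib :* iy)) := il :* (# 128 :* m) :* (kk :* (# 2048 :* ib :* iy)) :* (s :* t)) refl iℓ (ι M) (t ⊗ t) (k″ ⊗ k″) (s² 0 k) iB iY ⟩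
      E ⊗ (s² 0 k ⊗ (t ⊗ t))
        ≲⟨ ⊗-monoˡ 0≼E (local-factors k) ⟩
      E ⊗ pow4 (S (K (suc k)) (2 ^ B)) ∎
      where
      t : Q
      t = S (suc k) J

  -- The diagonal p = p' gives back the first moment, because 0 ≤ x ≤ 1 implies x² ≤ x.
  second-moment-bound : ∀ C → (∀ M z → Σ< M (λ k → pow4 (S (K (suc k)) z)) ≼ ι C ⊗ ι M) → ∀ X →
    Σ< X (λ n → R n ⊗ R n) ≼ Σ< X R ⊕ ι 2 ⊗ (Y ⊕ ι 1444 ⊗ ι 262144 ⊗ ι 1024 ⊗ ι C ⊗ Y)
  second-moment-bound C hC X = begin
    Σ< X (λ n → R n ⊗ R n)
      ≡⟨ trans (Σ-cong X (λ n _ → Σ-square M (x n))) (trans (Σ-⊕ X _ _) (cong (Σ< X (λ n → Σ< M (λ p → x n p ⊗ x n p)) ⊕_) (Σ-⊗ˡ X (ι 2) _))) ⟩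
    Σ< X (λ n → Σ< M (λ p → x n p ⊗ x n p)) ⊕ ι 2 ⊗ off-diagonal X
      ≲⟨ ⊕-mono (Σ-mono X (λ n _ → Σ-mono M (λ p _ → ≼-trans (⊗-monoˡ (0≼x n p) (x≼1 n p)) (≼-reflexive (⊗-idʳ _)))))
           (⊗-monoˡ (ι-nonneg 2) (≼-trans (off-diagonal-split X) (⊕-mono equal-part (distinct-part C hC)))) ⟩
    Σ< X R ⊕ ι 2 ⊗ (Y ⊕ ι 1444 ⊗ ι 262144 ⊗ ι 1024 ⊗ ι C ⊗ Y) ∎
    where open ≼-Reasoning

-- The first moment

tail-bound : ∀ B N e u → N ≤ 2 ^ (u + B) → 2 + (u + B + (1 + B)) ≤ e → 4 + 2 * N * suc (2 ^ B) ≤ 2 ^ e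
tail-bound B N e u N≤ h = begin
  4 + 2 * N * suc (2 ^ B)  ≤⟨ ℕₚ.+-mono-≤ (ℕₚ.*-monoʳ-≤ 2 (ℕₚ.≤-trans (ℕₚ.*-monoʳ-≤ 2 (2^n≥1 B)) y≤)) (ℕₚ.*-mono-≤ (ℕₚ.*-monoʳ-≤ 2 N≤) 1+x≤) ⟩
  2 * (y * (2 * x)) + 2 * y * (2 * x)  ≡⟨ e₁ y x ⟩
  2 * (2 * (y * (2 * x)))  ≡⟨ cong (λ z → 2 * (2 * z)) (ℕₚ.^-distribˡ-+-* 2 (u + B) (1 + B)) ⟨
  2 ^ (2 + (u + B + (1 + B)))  ≤⟨ ℕₚ.^-monoʳ-≤ 2 h ⟩
  2 ^ e  ∎
  where
  open ℕₚ.≤-Reasoning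
  x y : ℕ
  x = 2 ^ B
  y = 2 ^ (u + B)
  y≤ : 2 * x ≤ y * (2 * x)
  y≤ = ℕₚ.m≤n*m (2 * x) y {{ℕ.>-nonZero (2^n≥1 (u + B))}}
  1+x≤ : suc x ≤ 2 * x
  1+x≤ = ℕₚ.+-mono-≤ (2^n≥1 B) (ℕₚ.≤-reflexive (sym (ℕₚ.+-identityʳ x)))
  e₁ : ∀ y x → 2 * (y * (2 * x)) + 2 * y * (2 * x) ≡ 2 * (2 * (y * (2 * x)))
  e₁ = solve-∀

module FirstMoment (ℓ B J M N : ℕ) (10≤ℓ : 10 ≤ ℓ) (J≡ : J ≡ 2 ^ ℓ) (B≡ : B ≡ 2 ^ (18 * ℓ)) (M≡ : M ≡ 32 * B) (M≤N : M ≤ N)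
  (G u : ℕ) (N≤GM : N ≤ G * M) (u≤26 : u ≤ 26) (N≤2^ : N ≤ 2 ^ (u + B)) where

  open SecondMoment ℓ B J M N 10≤ℓ J≡ B≡ M≡ M≤N public

  X : ℕ
  X = 2 ^ suc N

  lg-suc≤N : ∀ {q} → Prime q → q < 2 ^ B → suc (lg q) ≤ N
  lg-suc≤N pq q< = ℕₚ.≤-trans (lg<B pq q<) B≤N

  -- Chebyshev gives 2κ ≤ 2N π(κ) + 4. Discarding the primes up to 2^B costs at most κ by
  -- `tail-bound`; the doubling makes room for this.
  cofactor-count : ∀ q → Cand q → q < 2 ^ B → ι (κ q) ≼ ι (2 * N) ⊗ Σ< (κ q) (λ s → ind (LargePrime? (2 ^ B) s))
  cofactor-count q (pq , _) q< = ≼-by (ι (2 * N) ⊗ L ⊕ ι n ⊖ ι 2 ⊗ ι n) (⊖-nonneg two) (solve 2 (λ n l → n :+ (l :+ n :- # 2 :* n) := l) refl (ι n) (ι (2 * N) ⊗ L))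
    where
    open ≼-Reasoning
    e n : ℕ
    e = N ∸ suc (lg q)
    n = κ q
    L : Q
    L = Σ< n (λ s → ind (LargePrime? (2 ^ B) s))
    -- Here the factor 32 in M is used: the exponent of κ q is at least 31 B, while `tail-bound`
    -- asks for 3 + u + 2B ≤ 29 + 2B.
    31B≤ : 31 * B ≤ N ∸ B
    31B≤ = ℕₚ.m+n≤o⇒m≤o∸n (31 * B) (ℕₚ.≤-trans (ℕₚ.≤-reflexive (ℕₚ.+-comm (31 * B) B)) (subst (_≤ N) M≡ M≤N))
    exp : 2 + (u + B + (1 + B)) ≤ e
    exp = ℕₚ.≤-trans (ℕₚ.≤-trans (ℕₚ.≤-reflexive (e₁ u B)) (ℕₚ.≤-trans (ℕₚ.+-monoˡ-≤ (B + B) (ℕₚ.+-monoʳ-≤ 3 u≤26))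
        (ℕₚ.≤-trans (ℕₚ.+-monoˡ-≤ (B + B) (ℕₚ.*-monoʳ-≤ 29 1≤B)) (ℕₚ.≤-reflexive (e₂ B)))))
      (ℕₚ.≤-trans 31B≤ (ℕₚ.∸-monoʳ-≤ N (lg<B pq q<)))
      where
      e₁ : ∀ u B → 2 + (u + B + (1 + B)) ≡ 3 + u + (B + B)
      e₁ = solve-∀
      e₂ : ∀ B → 29 * B + (B + B) ≡ 31 * B
      e₂ = solve-∀
    cheb : 2 * n ≤ 2 * N * pc n + 4
    cheb = ℕₚ.≤-trans (ℕₚ.*-monoʳ-≤ 2 (ℕₚ.≤-trans (chebyshev-lower e) (ℕₚ.+-monoˡ-≤ 2 (ℕₚ.*-monoˡ-≤ (pc n) (ℕₚ.m∸n≤m N (suc (lg q)))))))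
      (ℕₚ.≤-reflexive (e₃ N (pc n)))
      where
      e₃ : ∀ N c → 2 * (N * c + 2) ≡ 2 * N * c + 4
      e₃ = solve-∀
    two : ι 2 ⊗ ι n ≼ ι (2 * N) ⊗ L ⊕ ι n
    two = begin
      ι 2 ⊗ ι n  ≡⟨ ι-* 2 n ⟨
      ι (2 * n)  ≲⟨ ι-mono cheb ⟩
      ι (2 * N * pc n + 4)  ≡⟨ trans (ι-+ (2 * N * pc n) 4) (cong (_⊕ ι 4) (ι-* (2 * N) (pc n))) ⟩
      ι (2 * N) ⊗ ι (pc n) ⊕ ι 4  ≲⟨ ⊕-mono (⊗-monoˡ (ι-nonneg (2 * N)) (pc-large (2 ^ B) n)) ≼-refl ⟩
      ι (2 * N) ⊗ (L ⊕ ι (suc (2 ^ B))) ⊕ ι 4  ≡⟨ trans (solve 4 (λ n l b f → n :* (l :+ b) :+ f := n :* l :+ (f :+ n :* b)) refl (ι (2 * N)) L (ι (suc (2 ^ B))) (ι 4))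
                                                               (cong (ι (2 * N) ⊗ L ⊕_) (trans (cong (ι 4 ⊕_) (sym (ι-* (2 * N) (suc (2 ^ B))))) (sym (ι-+ 4 (2 * N * suc (2 ^ B)))))) ⟩
      ι (2 * N) ⊗ L ⊕ ι (4 + 2 * N * suc (2 ^ B))  ≲⟨ ⊕-mono ≼-refl (ι-mono (tail-bound B N e u N≤2^ exp)) ⟩
      ι (2 * N) ⊗ L ⊕ ι n  ∎

  -- Both 2^p and q s are at most 2^N, so the represented numbers do not exceed X = 2^(N+1).
  -- Dividing n + 1 - 2^p by q recovers s, so distinct s give distinct n.
  representation-count : ∀ p q → p < M → q < 2 ^ B → ind (Cand? q) ⊗ ι (κ q) ≼ ι (2 * N) ⊗ Σ< X (λ n → ind (Rep? p q (suc n)))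
  representation-count p q p<M q< = go (Cand? q)
    where
    open ≼-Reasoning
    go : (d : Dec (Cand q)) → ind d ⊗ ι (κ q) ≼ ι (2 * N) ⊗ Σ< X (λ n → ind (Rep? p q (suc n)))
    go (no _) = ≼-trans (≼-reflexive (⊗-zeroˡ _)) (⊗-nonneg (ι-nonneg (2 * N)) (Σ-nonneg X (λ n _ → ind-nonneg (Rep? p q (suc n)))))
    go (yes cq@(pq , _)) = begin
      ι 1 ⊗ ι (κ q)  ≡⟨ ⊗-idˡ _ ⟩
      ι (κ q)  ≲⟨ cofactor-count q cq q< ⟩
      ι (2 * N) ⊗ Σ< (κ q) (λ s → ind (LargePrime? (2 ^ B) s))  ≲⟨ ⊗-monoˡ (ι-nonneg (2 * N)) (Σ-reindex (κ q) X _ _ (λ n → (suc n ∸ 2 ^ p) / q) (λ n _ → ind-nonneg (Rep? p q (suc n))) (λ s s<κ → each s s<κ (LargePrime? (2 ^ B) s))) ⟩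
      ι (2 * N) ⊗ Σ< X (λ n → ind (Rep? p q (suc n)))  ∎
      where
      instance
        _ : NonZero q
        _ = prime⇒nonZero pq
      suc-pred : ∀ {m} → 1 ≤ m → suc (ℕ.pred m) ≡ m
      suc-pred {suc m} _ = refl
      each : ∀ s → s < κ q → (d : Dec (Prime s × 2 ^ B < s)) →
        (∃[ n ] (n < X × s ≡ (suc n ∸ 2 ^ p) / q × ind d ≼ ind (Rep? p q (suc n)))) ⊎ ind d ≼ ι 0
      each s s<κ (no _) = inj₂ ≼-refl
      each s s<κ (yes (ps , B<s)) = inj₁ (ℕ.pred m , subst (_≤ X) (sym e) m≤X , s≡ , ≼-reflexive (sym (ind-yes (Rep? p q (suc (ℕ.pred m))) (cq , s , s<κ , ps , B<s , e))))
        where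
        m : ℕ
        m = 2 ^ p + q * s
        e : suc (ℕ.pred m) ≡ m
        e = suc-pred (ℕₚ.≤-trans (2^n≥1 p) (ℕₚ.m≤m+n (2 ^ p) (q * s)))
        s≡ : s ≡ (suc (ℕ.pred m) ∸ 2 ^ p) / q
        s≡ = sym (trans (cong (λ m → (m ∸ 2 ^ p) / q) e) (trans (cong (_/ q) (trans (ℕₚ.m+n∸m≡n (2 ^ p) (q * s)) (ℕₚ.*-comm q s))) (m*n/n≡m s q)))
        qs≤ : q * s ≤ 2 ^ N
        qs≤ = ℕₚ.≤-trans (ℕₚ.*-mono-≤ (ℕₚ.<⇒≤ (lg-upper (prime≥1 pq))) (ℕₚ.<⇒≤ s<κ))
          (ℕₚ.≤-reflexive (trans (sym (ℕₚ.^-distribˡ-+-* 2 (suc (lg q)) (N ∸ suc (lg q)))) (cong (2 ^_) (ℕₚ.m+[n∸m]≡n (lg-suc≤N pq q<)))))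
        m≤X : m ≤ X
        m≤X = ℕₚ.≤-trans (ℕₚ.+-mono-≤ (ℕₚ.^-monoʳ-≤ 2 (ℕₚ.≤-trans (ℕₚ.<⇒≤ p<M) M≤N)) qs≤) (ℕₚ.≤-reflexive (cong (2 ^ N +_) (sym (ℕₚ.+-identityʳ (2 ^ N)))))

  first-moment : Σ< M a ⊗ kq (2 ^ B) ≼ ι (2 * N) ⊗ Σ< X R
  first-moment = begin
    Σ< M a ⊗ kq (2 ^ B)  ≡⟨ Σ-⊗ʳ M _ a ⟨
    Σ< M (λ p → a p ⊗ kq (2 ^ B))  ≲⟨ Σ-mono M (λ p p<M → ⊗-monoˡ (0≼a p) (≼-trans (Σ-mono (2 ^ B) (λ q q< → representation-count p q p<M q<)) (≼-reflexive (Σ-⊗ˡ (2 ^ B) (ι (2 * N)) _)))) ⟩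
    Σ< M (λ p → a p ⊗ (ι (2 * N) ⊗ Σ< (2 ^ B) (λ q → Σ< X (λ n → ind (Rep? p q (suc n))))))
      ≡⟨ Σ-cong M (λ p _ → trans (solve 3 (λ a n s → a :* (n :* s) := n :* (a :* s)) refl (a p) (ι (2 * N)) _) (cong (ι (2 * N) ⊗_) (trans (cong (a p ⊗_) (Σ-swap (2 ^ B) X _)) (sym (Σ-⊗ˡ X (a p) _))))) ⟩
    Σ< M (λ p → ι (2 * N) ⊗ Σ< X (λ n → x n p))  ≡⟨ trans (Σ-⊗ˡ M (ι (2 * N)) _) (cong (ι (2 * N) ⊗_) (Σ-swap M X _)) ⟩
    ι (2 * N) ⊗ Σ< X R  ∎
    where open ≼-Reasoning

  4JJ≤B : 4 * (J * J) ≤ B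
  4JJ≤B = subst₂ (λ J B → 4 * (J * J) ≤ B) (sym J≡) (sym B≡) (begin
    4 * (2 ^ ℓ * 2 ^ ℓ)  ≡⟨ cong (4 *_) (ℕₚ.^-distribˡ-+-* 2 ℓ ℓ) ⟨
    4 * 2 ^ (ℓ + ℓ)  ≡⟨ ℕₚ.^-distribˡ-+-* 2 2 (ℓ + ℓ) ⟨
    2 ^ (2 + (ℓ + ℓ))  ≤⟨ ℕₚ.^-monoʳ-≤ 2 (ℕₚ.≤-trans (ℕₚ.+-monoˡ-≤ (ℓ + ℓ) (ℕₚ.≤-trans (ℕₚ.m≤m+n 2 14) (ℕₚ.*-monoʳ-≤ 16 1≤ℓ))) (ℕₚ.≤-reflexive (e ℓ))) ⟩
    2 ^ (18 * ℓ)  ∎)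
    where
    open ℕₚ.≤-Reasoning
    e : ∀ ℓ → 16 * ℓ + (ℓ + ℓ) ≡ 18 * ℓ
    e = solve-∀

  small-primes : 46 * ℓ * suc J + 4 ≤ M
  small-primes = begin
    46 * ℓ * suc J + 4  ≤⟨ ℕₚ.+-mono-≤ (ℕₚ.*-mono-≤ (ℕₚ.*-monoʳ-≤ 46 ℓ≤J) 1+J≤) (ℕₚ.*-monoʳ-≤ 4 (ℕₚ.*-mono-≤ 1≤J 1≤J)) ⟩
    46 * J * (2 * J) + 4 * (J * J)  ≡⟨ e₁ J ⟩
    24 * (4 * (J * J))  ≤⟨ ℕₚ.*-mono-≤ {24} {32} (ℕₚ.m≤m+n 24 8) 4JJ≤B ⟩
    32 * B  ≡⟨ M≡ ⟨
    M  ∎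
    where
    open ℕₚ.≤-Reasoning
    ℓ≤J : ℓ ≤ J
    ℓ≤J = subst (ℓ ≤_) (sym J≡) (ℕₚ.<⇒≤ (n<2^n ℓ))
    1≤J : 1 ≤ J
    1≤J = ℕₚ.<⇒≤ 2≤J
    1+J≤ : suc J ≤ 2 * J
    1+J≤ = ℕₚ.+-mono-≤ 1≤J (ℕₚ.≤-reflexive (sym (ℕₚ.+-identityʳ J)))
    e₁ : ∀ J → 46 * J * (2 * J) + 4 * (J * J) ≡ 24 * (4 * (J * J))
    e₁ = solve-∀

  -- As M = 2^(5 + 18ℓ) and 5 + 18ℓ ≤ 23ℓ, Chebyshev gives M ≤ 23ℓ π(M) + 2. Doubling pays for the
  -- discarded exponents p ≤ J.
  exponents-count : ι M ≼ ι (46 * ℓ) ⊗ Σ< M a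
  exponents-count = ≼-by (ι (46 * ℓ) ⊗ Σ< M a ⊕ ι M ⊖ ι 2 ⊗ ι M) (⊖-nonneg two) (solve 2 (λ n l → n :+ (l :+ n :- # 2 :* n) := l) refl (ι M) (ι (46 * ℓ) ⊗ Σ< M a))
    where
    open ≼-Reasoning
    chebyshev : ∀ m {M} → M ≡ 2 ^ m → M ≤ m * pc M + 2
    chebyshev m refl = chebyshev-lower m
    cheb : 2 * M ≤ 46 * ℓ * pc M + 4
    cheb = ℕₚ.≤-trans (ℕₚ.*-monoʳ-≤ 2 (ℕₚ.≤-trans (chebyshev (5 + 18 * ℓ) M≡2^) (ℕₚ.+-monoˡ-≤ 2 (ℕₚ.*-monoˡ-≤ (pc M)
        (ℕₚ.≤-trans (ℕₚ.+-monoˡ-≤ (18 * ℓ) (ℕₚ.*-monoʳ-≤ 5 1≤ℓ)) (ℕₚ.≤-reflexive (e₂ ℓ))))))) (ℕₚ.≤-reflexive (e₁ ℓ (pc M)))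
      where
      e₁ : ∀ ℓ c → 2 * (23 * ℓ * c + 2) ≡ 46 * ℓ * c + 4
      e₁ = solve-∀
      e₂ : ∀ ℓ → 5 * ℓ + 18 * ℓ ≡ 23 * ℓ
      e₂ = solve-∀
    two : ι 2 ⊗ ι M ≼ ι (46 * ℓ) ⊗ Σ< M a ⊕ ι M
    two = begin
      ι 2 ⊗ ι M  ≡⟨ ι-* 2 M ⟨
      ι (2 * M)  ≲⟨ ι-mono cheb ⟩
      ι (46 * ℓ * pc M + 4)  ≡⟨ trans (ι-+ (46 * ℓ * pc M) 4) (cong (_⊕ ι 4) (ι-* (46 * ℓ) (pc M))) ⟩
      ι (46 * ℓ) ⊗ ι (pc M) ⊕ ι 4  ≲⟨ ⊕-mono (⊗-monoˡ (ι-nonneg (46 * ℓ)) (pc-large J M)) ≼-refl ⟩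
      ι (46 * ℓ) ⊗ (Σ< M a ⊕ ι (suc J)) ⊕ ι 4  ≡⟨ trans (solve 4 (λ n l b f → n :* (l :+ b) :+ f := n :* l :+ (n :* b :+ f)) refl (ι (46 * ℓ)) (Σ< M a) (ι (suc J)) (ι 4))
                                                              (cong (ι (46 * ℓ) ⊗ Σ< M a ⊕_) (trans (cong (_⊕ ι 4) (sym (ι-* (46 * ℓ) (suc J)))) (sym (ι-+ (46 * ℓ * suc J) 4)))) ⟩
      ι (46 * ℓ) ⊗ Σ< M a ⊕ ι (46 * ℓ * suc J + 4)  ≲⟨ ⊕-mono ≼-refl (ι-mono small-primes) ⟩
      ι (46 * ℓ) ⊗ Σ< M a ⊕ ι M  ∎

  -- Between J = 2^ℓ and B = 2^(18ℓ) twice the harmonic sum grows by at least 17ℓ, so `kq-lower`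
  -- yields 4 kq ≥ (17ℓ - 4) Y ≥ 4ℓ Y.
  cofactor-mass : ι ℓ ⊗ Y ≼ kq (2 ^ B)
  cofactor-mass = ⊗-cancel-ι {4} (s≤s z≤n) (begin
    ι 4 ⊗ (ι ℓ ⊗ Y)  ≲⟨ ≼-by ((ι 9 ⊗ ι ℓ ⊕ ι 4 ⊗ (ι ℓ ⊖ ι 1)) ⊗ Y) (⊗-nonneg (⊕-nonneg (⊗-nonneg (ι-nonneg 9) (ι-nonneg ℓ)) (⊗-nonneg (ι-nonneg 4) (⊖-nonneg (ι-mono 1≤ℓ)))) 0≼Y)
                                                               (solve 2 (λ l y → # 4 :* (l :* y) :+ (# 9 :* l :+ # 4 :* (l :- # 1)) :* y := # 17 :* l :* y :- # 4 :* y) refl (ι ℓ) Y) ⟩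
    ι 17 ⊗ ι ℓ ⊗ Y ⊖ ι 4 ⊗ Y  ≲⟨ ⊕-mono (⊗-monoʳ 0≼Y harm) ≼-refl ⟩
    ι 2 ⊗ t ⊗ Y ⊖ ι 4 ⊗ Y  ≡⟨ solve 2 (λ t y → # 2 :* t :* y :- # 4 :* y := # 2 :* (y :* t) :- # 4 :* y) refl t Y ⟩
    ι 2 ⊗ (Y ⊗ t) ⊖ ι 4 ⊗ Y  ≲⟨ ⊕-mono (⊗-monoˡ (ι-nonneg 2) (kq-lower m (ℕₚ.≤-trans (ℕₚ.≤-reflexive m+J) B≤N))) ≼-refl ⟩
    ι 2 ⊗ (ι 2 ⊗ (kq (2 ^ (m + J)) ⊕ Y)) ⊖ ι 4 ⊗ Y  ≡⟨ solve 2 (λ k y → # 2 :* (# 2 :* (k :+ y)) :- # 4 :* y := # 4 :* k) refl (kq (2 ^ (m + J))) Y ⟩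
    ι 4 ⊗ kq (2 ^ (m + J))  ≡⟨ cong (λ b → ι 4 ⊗ kq (2 ^ b)) m+J ⟩
    ι 4 ⊗ kq (2 ^ B)  ∎)
    where
    open ≼-Reasoning
    m : ℕ
    m = proj₁ J+B
    m+J : m + J ≡ B
    m+J = proj₂ J+B
    t : Q
    t = tail m
    split : harmonic B ≡ harmonic J ⊕ t
    split = trans (cong harmonic (trans (sym m+J) (ℕₚ.+-comm m J))) (trans (Σ-split J m _) (cong (harmonic J ⊕_) (Σ-cong m (λ i _ → cong (λ n → inv (suc n)) (ℕₚ.+-comm J i)))))
    harm : ι 17 ⊗ ι ℓ ≼ ι 2 ⊗ t
    harm = begin
      ι 17 ⊗ ι ℓ  ≡⟨ trans (sym (ι-* 17 ℓ)) (solve 2 (λ s h → s := h :+ s :- h) refl (ι (17 * ℓ)) (ι 2 ⊗ harmonic J)) ⟩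
      ι 2 ⊗ harmonic J ⊕ ι (17 * ℓ) ⊖ ι 2 ⊗ harmonic J  ≲⟨ ⊕-mono (subst₂ (λ j b → ι 2 ⊗ harmonic j ⊕ ι (17 * ℓ) ≼ ι 2 ⊗ harmonic b) (sym J≡) (trans (cong (2 ^_) (e ℓ)) (sym B≡)) (harmonic-grow ℓ (17 * ℓ))) ≼-refl ⟩
      ι 2 ⊗ harmonic B ⊖ ι 2 ⊗ harmonic J  ≡⟨ cong (λ h → ι 2 ⊗ h ⊖ ι 2 ⊗ harmonic J) split ⟩
      ι 2 ⊗ (harmonic J ⊕ t) ⊖ ι 2 ⊗ harmonic J  ≡⟨ solve 2 (λ h t → # 2 :* (h :+ t) :- # 2 :* h := # 2 :* t) refl (harmonic J) t ⟩
      ι 2 ⊗ t  ∎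
      where
      e : ∀ ℓ → 17 * ℓ + ℓ ≡ 18 * ℓ
      e = solve-∀

  1≤M : 1 ≤ M
  1≤M = subst (1 ≤_) (sym M≡) (ℕₚ.*-mono-≤ {1} {32} (s≤s z≤n) 1≤B)

  -- The factor ℓ lost to the density of prime exponents is regained from the mass of the cofactors,
  -- and N ≤ G M weighs the density 1/N of the primes s against the M exponents. The constant is 46
  -- · 2.
  first-moment-bound : Y ≼ ι (92 * G) ⊗ Σ< X R
  first-moment-bound = ⊗-cancel-ι {M * ℓ} (ℕₚ.*-mono-≤ 1≤M 1≤ℓ) (begin
    ι (M * ℓ) ⊗ Y  ≡⟨ trans (cong (_⊗ Y) (ι-* M ℓ)) (⊗-assoc _ _ _) ⟩
    ι M ⊗ (ι ℓ ⊗ Y)  ≲⟨ ⊗-mono (ι-nonneg M) (⊗-nonneg (ι-nonneg ℓ) 0≼Y) exponents-count cofactor-mass ⟩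
    ι (46 * ℓ) ⊗ Σ< M a ⊗ kq (2 ^ B)  ≡⟨ ⊗-assoc _ _ _ ⟩
    ι (46 * ℓ) ⊗ (Σ< M a ⊗ kq (2 ^ B))  ≲⟨ ⊗-monoˡ (ι-nonneg (46 * ℓ)) first-moment ⟩
    ι (46 * ℓ) ⊗ (ι (2 * N) ⊗ R₁)  ≡⟨ cong₂ (λ u v → u ⊗ (v ⊗ R₁)) (ι-* 46 ℓ) (ι-* 2 N) ⟩
    ι 46 ⊗ ι ℓ ⊗ (ι 2 ⊗ ι N ⊗ R₁)  ≲⟨ ⊗-monoˡ (⊗-nonneg (ι-nonneg 46) (ι-nonneg ℓ)) (⊗-monoʳ (Σ-nonneg X (λ n _ → 0≼R n)) (⊗-monoˡ (ι-nonneg 2) (≼-trans (ι-mono N≤GM) (≼-reflexive (ι-* G M))))) ⟩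
    ι 46 ⊗ ι ℓ ⊗ (ι 2 ⊗ (ι G ⊗ ι M) ⊗ R₁)  ≡⟨ solve 4 (λ l g m r → # 46 :* l :* (# 2 :* (g :* m) :* r) := m :* l :* (# 92 :* g :* r)) refl (ι ℓ) (ι G) (ι M) R₁ ⟩
    ι M ⊗ ι ℓ ⊗ (ι 92 ⊗ ι G ⊗ R₁)  ≡⟨ cong₂ (λ u v → u ⊗ (v ⊗ R₁)) (ι-* M ℓ) (ι-* 92 G) ⟨
    ι (M * ℓ) ⊗ (ι (92 * G) ⊗ R₁)  ∎)
    where
    open ≼-Reasoning
    R₁ : Q
    R₁ = Σ< X R

-- Counting the sumset

-- The index n stands for the integer n + 1, in keeping with `count`, which starts at 1.
represented : ℕ → Q
represented n = ind (InSumset? (suc n))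

ι-count : ∀ x → ι (count x) ≡ Σ< x represented
ι-count zero = refl
ι-count (suc x) with InSumset? (suc x)
... | yes _ = trans (ι-suc (count x)) (trans (⊕-comm _ _) (cong (_⊕ ι 1) (ι-count x)))
... | no _ = trans (ι-count x) (sym (⊕-idʳ _))

-- A linear form of the Cauchy–Schwarz inequality, from (A - R n)² ≥ 0.
moments⇒support : ∀ X (R E : ℕ → Q) Y D W → 1 ≤ D → (∀ n → ι 0 ≼ R n) →
  (∀ n A → ι 2 ⊗ A ⊗ R n ≼ A ⊗ A ⊗ E n ⊕ R n ⊗ R n) →
  Y ≼ ι D ⊗ Σ< X R → Σ< X (λ n → R n ⊗ R n) ≼ Σ< X R ⊕ ι W ⊗ Y →
  Y ≼ ι (D * suc W * (D * suc W)) ⊗ Σ< X E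
moments⇒support X R E Y D W 1≤D 0≼R pointwise first second = begin
  Y  ≲⟨ ≼-by ((ι (suc W) ⊗ (ι D ⊗ R₁ ⊖ Y)) ⊕ (A ⊖ ι 1) ⊗ R₁) (⊕-nonneg (⊗-nonneg (ι-nonneg (suc W)) (⊖-nonneg first)) (⊗-nonneg (⊖-nonneg 1≼A) (Σ-nonneg X (λ n _ → 0≼R n))))
                                                                  (trans (cong₂ (λ w a → Y ⊕ ((w ⊗ (ι D ⊗ R₁ ⊖ Y)) ⊕ (a ⊖ ι 1) ⊗ R₁)) (ι-suc W) A≡)
                                                                   (trans (solve 4 (λ y d w r → y :+ (((# 1 :+ w) :* (d :* r :- y)) :+ (d :* (# 1 :+ w) :- # 1) :* r) := # 2 :* (d :* (# 1 :+ w)) :* r :- (r :+ w :* y)) refl Y (ι D) (ι W) R₁)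
                                                                   (cong (λ a → ι 2 ⊗ a ⊗ R₁ ⊖ (R₁ ⊕ ι W ⊗ Y)) (sym A≡)))) ⟩
  ι 2 ⊗ A ⊗ R₁ ⊖ (R₁ ⊕ ι W ⊗ Y)  ≲⟨ ⊕-mono sum ≼-refl ⟩
  A ⊗ A ⊗ Σ< X E ⊕ R₂ ⊖ (R₁ ⊕ ι W ⊗ Y)  ≲⟨ ≼-by (R₁ ⊕ ι W ⊗ Y ⊖ R₂) (⊖-nonneg second) (solve 3 (λ e r s → e :+ r :- s :+ (s :- r) := e) refl (A ⊗ A ⊗ Σ< X E) R₂ (R₁ ⊕ ι W ⊗ Y)) ⟩
  A ⊗ A ⊗ Σ< X E  ≡⟨ cong (_⊗ Σ< X E) (ι-* (D * suc W) (D * suc W)) ⟨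
  ι (D * suc W * (D * suc W)) ⊗ Σ< X E  ∎
  where
  open ≼-Reasoning
  A R₁ R₂ : Q
  -- By `first` this A satisfies A R₁ ≥ (1 + W) Y, and A ≥ 1 gives A R₁ ≥ R₁. Together, 2 A R₁ - (R₁
  -- + W Y) ≥ Y.
  A = ι (D * suc W)
  R₁ = Σ< X R
  R₂ = Σ< X (λ n → R n ⊗ R n)
  1≼A : ι 1 ≼ A
  1≼A = ι-mono (ℕₚ.*-mono-≤ {1} {D} {1} {suc W} 1≤D (s≤s z≤n))
  A≡ : A ≡ ι D ⊗ (ι 1 ⊕ ι W)
  A≡ = trans (ι-* D (suc W)) (cong (ι D ⊗_) (ι-suc W))
  sum : ι 2 ⊗ A ⊗ R₁ ≼ A ⊗ A ⊗ Σ< X E ⊕ R₂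
  sum = ≼-trans (≼-reflexive (sym (Σ-⊗ˡ X (ι 2 ⊗ A) R))) (≼-trans (Σ-mono X (λ n _ → pointwise n A))
    (≼-reflexive (trans (Σ-⊕ X _ _) (cong (_⊕ R₂) (Σ-⊗ˡ X (A ⊗ A) E)))))

count-mono : ∀ {x y} → x ≤ y → count x ≤ count y
count-mono {x} {y} x≤y = ι-reflect (subst₂ _≼_ (sym (ι-count x)) (sym (ι-count y)) (Σ-extend x≤y (λ n → ind-nonneg (InSumset? (suc n)))))

module Count (ℓ B J M N : ℕ) (10≤ℓ : 10 ≤ ℓ) (J≡ : J ≡ 2 ^ ℓ) (B≡ : B ≡ 2 ^ (18 * ℓ)) (M≡ : M ≡ 32 * B) (M≤N : M ≤ N)
  (G u : ℕ) (1≤G : 1 ≤ G) (N≤GM : N ≤ G * M) (u≤26 : u ≤ 26) (N≤2^ : N ≤ 2 ^ (u + B)) where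

  open FirstMoment ℓ B J M N 10≤ℓ J≡ B≡ M≡ M≤N G u N≤GM u≤26 N≤2^

  rep⇒sum : ∀ {p q n} → Prime p → Rep p q n → InSumset n
  rep⇒sum {p} {q} pp ((pq , _) , s , _ , ps , _ , e) = p , q * s , pp , inj₂ (q , s , pq , ps , refl) , e

  R-support : ∀ n → ¬ InSumset (suc n) → R n ≼ ι 0
  R-support n none = ≼-trans (Σ-mono M (λ p _ → each p (LargePrime? J p))) (≼-reflexive (Σ-zero M))
    where
    each : ∀ p (d : Dec (Prime p × J < p)) → ind d ⊗ r p n ≼ ι 0
    each p (no _) = ≼-reflexive (⊗-zeroˡ _)
    each p (yes (pp , _)) = ≼-reflexive (trans (⊗-idˡ _) (trans (Σ-cong (2 ^ B) (λ q _ → ind-no (Rep? p q (suc n)) (λ rep → none (rep⇒sum pp rep)))) (Σ-zero (2 ^ B))))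

  pointwise : ∀ n A → ι 2 ⊗ A ⊗ R n ≼ A ⊗ A ⊗ represented n ⊕ R n ⊗ R n
  pointwise n A = go (InSumset? (suc n))
    where
    go : (d : Dec (InSumset (suc n))) → ι 2 ⊗ A ⊗ R n ≼ A ⊗ A ⊗ ind d ⊕ R n ⊗ R n
    go (yes _) = ≼-by ((A ⊖ R n) ⊗ (A ⊖ R n)) (sq-nonneg _) (solve 2 (λ a r → # 2 :* a :* r :+ (a :- r) :* (a :- r) := a :* a :* # 1 :+ r :* r) refl A (R n))
    go (no none) = ≼-reflexive (trans (cong (ι 2 ⊗ A ⊗_) R≡0) (trans (solve 1 (λ a → # 2 :* a :* # 0 := a :* a :* # 0 :+ # 0 :* # 0) refl A) (cong (λ r → A ⊗ A ⊗ ι 0 ⊕ r ⊗ r) (sym R≡0))))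
      where
      R≡0 : R n ≡ ι 0
      R≡0 = ≼-antisym (R-support n none) (0≼R n)

  count-bound : ∀ W → (∀ X → Σ< X (λ n → R n ⊗ R n) ≼ Σ< X R ⊕ ι W ⊗ Y) →
    2 ^ (N ∸ 1) ≤ 92 * G * suc W * (92 * G * suc W) * count (2 ^ suc N)
  count-bound W second = ι-reflect (≼-trans
    (moments⇒support X R represented Y (92 * G) W (ℕₚ.*-mono-≤ {1} {92} (s≤s z≤n) 1≤G) 0≼R pointwise first-moment-bound (second X))
    (≼-reflexive (trans (cong (ι (92 * G * suc W * (92 * G * suc W)) ⊗_) (sym (ι-count X))) (sym (ι-* (92 * G * suc W * (92 * G * suc W)) (count X))))))

-- With e the integer part of the binary logarithm of N, ℓ is the quotient of e - 5 by 18. Hence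
-- 2^(5 + 18ℓ), the future M, satisfies M ≤ N ≤ 2^18 M, and 185 = 5 + 18 · 10 gives ℓ ≥ 10.
scale : ∀ {λ₀} N → 185 ≤ λ₀ → 2 ^ λ₀ ≤ N → ∃[ ℓ ] ∃[ e ] (10 ≤ ℓ × 5 + 18 * ℓ ≤ e × suc e ≤ 23 + 18 * ℓ × 2 ^ e ≤ N × N ≤ 2 ^ suc e)
scale {λ₀} zero _ h = ⊥-elim (ℕₚ.<⇒≱ (2^n≥1 λ₀) h)
scale {λ₀} (suc n) 185≤ h = (e ∸ 5) / 18 , e , ≤/ 18 180≤ , lower , upper , proj₁ (proj₂ log) , ℕₚ.<⇒≤ (proj₂ (proj₂ log))
  where
  log : ∃[ e ] (2 ^ e ≤ suc n × suc n < 2 ^ suc e)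
  log = floor-log 2 ℕₚ.≤-refl n
  e : ℕ
  e = proj₁ log
  185≤e : 185 ≤ e
  185≤e = ℕₚ.≤-trans 185≤ (ℕ.s≤s⁻¹ (2^-cancel-< {λ₀} {suc e} (ℕₚ.≤-<-trans h (proj₂ (proj₂ log)))))
  180≤ : 180 ≤ e ∸ 5
  180≤ = ℕₚ.m+n≤o⇒m≤o∸n 180 185≤e
  5≤e : 5 ≤ e
  5≤e = ℕₚ.≤-trans (ℕₚ.m≤m+n 5 180) 185≤e
  lower : 5 + 18 * ((e ∸ 5) / 18) ≤ e
  lower = ℕₚ.≤-trans (ℕₚ.+-monoʳ-≤ 5 (ℕₚ.≤-trans (ℕₚ.≤-reflexive (ℕₚ.*-comm 18 ((e ∸ 5) / 18))) (m/n*n≤m (e ∸ 5) 18))) (ℕₚ.≤-reflexive (ℕₚ.m+[n∸m]≡n 5≤e))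
  upper : suc e ≤ 23 + 18 * ((e ∸ 5) / 18)
  upper = begin
    suc e  ≡⟨ cong suc (ℕₚ.m+[n∸m]≡n 5≤e) ⟨
    6 + (e ∸ 5)  ≡⟨ cong (6 +_) (m≡m%n+[m/n]*n (e ∸ 5) 18) ⟩
    6 + ((e ∸ 5) % 18 + (e ∸ 5) / 18 * 18)  ≤⟨ ℕₚ.+-monoʳ-≤ 6 (ℕₚ.+-mono-≤ (ℕ.s≤s⁻¹ (m%n<n (e ∸ 5) 18)) (ℕₚ.≤-reflexive (ℕₚ.*-comm ((e ∸ 5) / 18) 18))) ⟩
    6 + (17 + 18 * ((e ∸ 5) / 18))  ≡⟨ ℕₚ.+-assoc 6 17 (18 * ((e ∸ 5) / 18)) ⟨
    23 + 18 * ((e ∸ 5) / 18)  ∎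
    where open ℕₚ.≤-Reasoning

-- All numerical constants are variables here, so that no large power is ever evaluated.
density : ∀ g λ₀ k C → g ≡ 18 → 185 ≤ λ₀ → ι k ≡ ι 1444 ⊗ ι 262144 ⊗ ι 1024 →
  (∀ M z → Σ< M (λ i → pow4 (S (K (suc i)) z)) ≼ ι C ⊗ ι M) →
  ∃[ a ] ∃[ b ] (0 < a × 0 < b × ∃[ X ] (∀ x → x ≥ X → a * x < b * count x))
density g λ₀ k C g≡ 185≤ k≡ average = 1 , 8 * (A * A) , s≤s z≤n , ℕₚ.*-mono-≤ {1} {8} (s≤s z≤n) (ℕₚ.*-mono-≤ 1≤A 1≤A) , 2 ^ suc (2 ^ λ₀) , bound
  where
  W A : ℕ
  W = 2 * suc (k * C)
  A = 92 * 2 ^ g * suc W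
  1≤A : 1 ≤ A
  1≤A = ℕₚ.*-mono-≤ {1} {92 * 2 ^ g} {1} {suc W} (ℕₚ.*-mono-≤ {1} {92} (s≤s z≤n) (2^n≥1 g)) (s≤s z≤n)
  W≡ : ∀ y → ι 2 ⊗ (y ⊕ ι 1444 ⊗ ι 262144 ⊗ ι 1024 ⊗ ι C ⊗ y) ≡ ι W ⊗ y
  W≡ y = begin
    ι 2 ⊗ (y ⊕ ι 1444 ⊗ ι 262144 ⊗ ι 1024 ⊗ ι C ⊗ y)  ≡⟨ cong (λ u → ι 2 ⊗ (y ⊕ u ⊗ ι C ⊗ y)) k≡ ⟨
    ι 2 ⊗ (y ⊕ ι k ⊗ ι C ⊗ y)  ≡⟨ solve 3 (λ y k c → # 2 :* (y :+ k :* c :* y) := # 2 :* (# 1 :+ k :* c) :* y) refl y (ι k) (ι C) ⟩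
    ι 2 ⊗ (ι 1 ⊕ ι k ⊗ ι C) ⊗ y  ≡⟨ cong (λ u → ι 2 ⊗ (ι 1 ⊕ u) ⊗ y) (ι-* k C) ⟨
    ι 2 ⊗ (ι 1 ⊕ ι (k * C)) ⊗ y  ≡⟨ cong (λ u → ι 2 ⊗ u ⊗ y) (ι-suc (k * C)) ⟨
    ι 2 ⊗ ι (suc (k * C)) ⊗ y  ≡⟨ cong (_⊗ y) (ι-* 2 (suc (k * C))) ⟨
    ι W ⊗ y  ∎
    where open ≡-Reasoning
  at-scale : ∀ N ℓ e → 10 ≤ ℓ → 5 + 18 * ℓ ≤ e → suc e ≤ 23 + 18 * ℓ → 2 ^ e ≤ N → N ≤ 2 ^ suc e → 2 ^ (N ∸ 1) ≤ A * A * count (2 ^ suc N)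
  at-scale N ℓ e 10≤ℓ e≥ e≤ lo hi = Count.count-bound ℓ B (2 ^ ℓ) (32 * B) N 10≤ℓ refl refl refl M≤N (2 ^ g) (5 + g) (2^n≥1 g) N≤GM u≤26 N≤2^ W
      (λ X → ≼-trans (SecondMoment.second-moment-bound ℓ B (2 ^ ℓ) (32 * B) N 10≤ℓ refl refl refl M≤N C average X) (⊕-mono ≼-refl (≼-reflexive (W≡ (ι (2 ^ (N ∸ 1)))))))
    where
    B : ℕ
    B = 2 ^ (18 * ℓ)
    32B≡ : 2 ^ (5 + 18 * ℓ) ≡ 32 * B
    32B≡ = ℕₚ.^-distribˡ-+-* 2 5 (18 * ℓ)
    M≤N : 32 * B ≤ N
    M≤N = subst (_≤ N) 32B≡ (ℕₚ.≤-trans (ℕₚ.^-monoʳ-≤ 2 {5 + 18 * ℓ} {e} e≥) lo)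
    hi′ : N ≤ 2 ^ (g + (5 + 18 * ℓ))
    hi′ = ℕₚ.≤-trans hi (ℕₚ.^-monoʳ-≤ 2 {suc e} {g + (5 + 18 * ℓ)} (subst (λ g → suc e ≤ g + (5 + 18 * ℓ)) (sym g≡) e≤))
    N≤GM : N ≤ 2 ^ g * (32 * B)
    N≤GM = subst (N ≤_) (trans (ℕₚ.^-distribˡ-+-* 2 g (5 + 18 * ℓ)) (cong (2 ^ g *_) 32B≡)) hi′
    u≤26 : 5 + g ≤ 26
    u≤26 = subst (λ g → 5 + g ≤ 26) (sym g≡) (ℕₚ.m≤m+n 23 3)
    assoc : ∀ g x → g + (5 + x) ≡ 5 + g + x
    assoc = solve-∀
    N≤2^ : N ≤ 2 ^ (5 + g + B)
    N≤2^ = ℕₚ.≤-trans hi′ (ℕₚ.^-monoʳ-≤ 2 (ℕₚ.≤-trans (ℕₚ.≤-reflexive (assoc g (18 * ℓ))) (ℕₚ.+-monoʳ-≤ (5 + g) (ℕₚ.<⇒≤ (n<2^n (18 * ℓ))))))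
  bound : ∀ x → x ≥ 2 ^ suc (2 ^ λ₀) → 1 * x < 8 * (A * A) * count x
  bound zero h = ⊥-elim (ℕₚ.<⇒≱ (2^n≥1 (suc (2 ^ λ₀))) h)
  bound x@(suc x') h = go (floor-log 2 ℕₚ.≤-refl x')
    where
    go : ∃[ e ] (2 ^ e ≤ x × x < 2 ^ suc e) → 1 * x < 8 * (A * A) * count x
    go (e , lo , hi) = with-N e lo hi (ℕ.s≤s⁻¹ (2^-cancel-< (ℕₚ.≤-<-trans h hi)))
      where
      with-N : ∀ e → 2 ^ e ≤ x → x < 2 ^ suc e → suc (2 ^ λ₀) ≤ e → 1 * x < 8 * (A * A) * count x
      with-N (suc N) lo hi (s≤s 2^≤N) = conclude N lo hi (ℕₚ.≤-trans (2^n≥1 λ₀) 2^≤N) (scale {λ₀} N 185≤ 2^≤N)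
        where
        conclude : ∀ N → 2 ^ suc N ≤ x → x < 2 ^ suc (suc N) → 1 ≤ N →
          ∃[ ℓ ] ∃[ e ] (10 ≤ ℓ × 5 + 18 * ℓ ≤ e × suc e ≤ 23 + 18 * ℓ × 2 ^ e ≤ N × N ≤ 2 ^ suc e) → 1 * x < 8 * (A * A) * count x
        conclude N@(suc n) lo hi _ (ℓ , e , 10≤ℓ , e≥ , e≤ , loN , hiN) = begin-strict
          1 * x  ≡⟨ ℕₚ.*-identityˡ x ⟩
          x  <⟨ hi ⟩
          -- As N = n + 1, this is 8 times the unit 2^(N - 1) in which `at-scale` is stated.
          2 ^ suc (suc N)  ≡⟨ ℕₚ.^-distribˡ-+-* 2 3 n ⟩
          8 * 2 ^ n  ≤⟨ ℕₚ.*-monoʳ-≤ 8 (at-scale N ℓ e 10≤ℓ e≥ e≤ loN hiN) ⟩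
          8 * (A * A * count (2 ^ suc N))  ≤⟨ ℕₚ.*-monoʳ-≤ 8 (ℕₚ.*-monoʳ-≤ (A * A) (count-mono lo)) ⟩
          8 * (A * A * count x)  ≡⟨ ℕₚ.*-assoc 8 (A * A) (count x) ⟨
          8 * (A * A) * count x  ∎
          where open ℕₚ.≤-Reasoning

mainTheorem1 : ∃[ a ] ∃[ b ] (0 < a × 0 < b × ∃[ X ] (∀ x → x ≥ X → a * x < b * count x))
mainTheorem1 = density 18 185 (1444 * 262144 * 1024) (proj₁ romanoff) refl ℕₚ.≤-refl
  (trans (ι-* (1444 * 262144) 1024) (cong (_⊗ ι 1024) (ι-* 1444 262144))) (proj₂ romanoff)
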